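{- Let $p\equiv 4\pmod 5$ be a prime, and let $N$ be a positive integer which is coprime to $p$ such that $pN\equiv 3\pmod 8$. Then \[\mathrm{pod}\Big(\frac{5p^{3}N+1}{8}\Big)\equiv 0\pmod 5.\]
   Context: For an integer $n\ge 0$, $\mathrm{pod}(n)$ denotes the number of partitions of $n$ in which the odd parts are distinct (even parts may repeat); equivalently $\sum_{n\ge 0}\mathrm{pod}(n)q^n=\prod_{i\ge 1}\frac{1+q^{2i-1}}{1-q^{2i}}$. -}

module Defs where

open import Data.List.Base using (List; []; _∷_; length; filter; upTo; cartesianProductWith)
open import Data.List.Membership.Propositional using (_∈_)
open import Data.List.Membership.Propositional.Properties
  using (∈-filter⁺; ∈-filter⁻; ∈-cartesianProductWith⁺; ∈-cartesianProductWith⁻; ∈-upTo⁺)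
open import Data.List.Properties using (∷-injective)
open import Data.List.Relation.Unary.All as All using (All; []; _∷_)
open import Data.List.Relation.Unary.AllPairs using ([]; _∷_)
open import Data.List.Relation.Unary.Any using (here; there)
open import Data.List.Relation.Unary.Linked using (Linked; linked?)
open import Data.List.Relation.Unary.Unique.Propositional using (Unique)
open import Data.List.Relation.Unary.Unique.Propositional.Properties
  using (filter⁺; cartesianProductWith⁺; upTo⁺)
open import Data.Nat.Base using (ℕ; zero; suc; _+_; _≤_; _<_; _≥_; z≤n; s≤s)
open import Data.Nat.Divisibility using (_∣_; _∣?_)
open import Data.Nat.ListAction using (sum)
open import Data.Nat.Properties
  using (_≟_; _≥?_; _<?_; ≤-trans; m≤m+n; m≤n+m; +-mono-≤)
open import Data.List.Relation.Unary.Unique.DecPropositional _≟_ using (unique?)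
open import Data.Product.Base using (_×_; _,_; proj₂)
open import Function.Bundles using (_⇔_; mk⇔)
open import Relation.Binary.PropositionalEquality using (_≡_; refl)
open import Relation.Nullary.Decidable using (map′; ¬?; _×-dec_)
open import Relation.Nullary.Negation using (¬_)
open import Relation.Unary using (Decidable)

Odd : ℕ → Set
Odd k = ¬ (2 ∣ k)

odd? : Decidable Odd
odd? k = ¬? (2 ∣? k)

-- Partitions are written as weakly decreasing lists of positive parts.
record IsPartition (n : ℕ) (parts : List ℕ) : Set where
  constructor isPartition
  field
    decreasing : Linked _≥_ parts
    positive   : All (0 <_) parts
    sums       : sum parts ≡ n

record IsPodPartition (n : ℕ) (parts : List ℕ) : Set where
  constructor isPodPartition
  field
    partition        : IsPartition n parts
    oddPartsDistinct : Unique (filter odd? parts)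

isPartition? : ∀ n → Decidable (IsPartition n)
isPartition? n parts =
  map′ (λ (d , p , s) → isPartition d p s)
       (λ (isPartition d p s) → d , p , s)
       (linked? _≥?_ parts ×-dec All.all? (0 <?_) parts ×-dec (sum parts ≟ n))

isPodPartition? : ∀ n → Decidable (IsPodPartition n)
isPodPartition? n parts =
  map′ (λ (p , u) → isPodPartition p u)
       (λ (isPodPartition p u) → p , u)
       (isPartition? n parts ×-dec unique? (filter odd? parts))

-- All lists of length at most ℓ with entries from xs.
words : {A : Set} → ℕ → List A → List (List A)
words zero    xs = [] ∷ []
words (suc ℓ) xs = [] ∷ cartesianProductWith _∷_ xs (words ℓ xs)

-- A partition of n has at most n parts, each at most n, so the candidates
-- searched here suffice; see ∈-podPartitions and podPartitions-unique.
podPartitions : ℕ → List (List ℕ)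
podPartitions n = filter (isPodPartition? n) (words n (upTo (suc n)))

pod : ℕ → ℕ
pod n = length (podPartitions n)

words-complete : ∀ {A : Set} {xs : List A} ℓ {ys} →
                 length ys ≤ ℓ → All (_∈ xs) ys → ys ∈ words ℓ xs
words-complete zero    {[]}     _       _        = here refl
words-complete (suc ℓ) {[]}     _       _        = here refl
words-complete (suc ℓ) {y ∷ ys} (s≤s l) (p ∷ ps) =
  there (∈-cartesianProductWith⁺ _∷_ p (words-complete ℓ l ps))

words-unique : ∀ {A : Set} {xs : List A} ℓ → Unique xs → Unique (words ℓ xs)
words-unique           zero    u = [] ∷ []
words-unique {xs = xs} (suc ℓ) u =
  All.tabulate nonEmpty ∷ cartesianProductWith⁺ _∷_ ∷-injective u (words-unique ℓ u)
  where
  nonEmpty : ∀ {zs} → zs ∈ cartesianProductWith _∷_ xs (words ℓ xs) → ¬ ([] ≡ zs)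
  nonEmpty zs∈ refl with ∈-cartesianProductWith⁻ _∷_ xs (words ℓ xs) zs∈
  ... | _ , _ , _ , _ , ()

length≤sum : ∀ {parts} → All (0 <_) parts → length parts ≤ sum parts
length≤sum []       = z≤n
length≤sum (p ∷ ps) = +-mono-≤ p (length≤sum ps)

parts≤sum : ∀ parts → All (_≤ sum parts) parts
parts≤sum []       = []
parts≤sum (x ∷ xs) =
  m≤m+n x (sum xs) ∷ All.map (λ y≤ → ≤-trans y≤ (m≤n+m (sum xs) x)) (parts≤sum xs)

∈-podPartitions : ∀ n parts → parts ∈ podPartitions n ⇔ IsPodPartition n parts
∈-podPartitions n parts =
  mk⇔ (λ m → proj₂ (∈-filter⁻ (isPodPartition? n) {xs = words n (upTo (suc n))} m)) complete
  where
  complete : IsPodPartition n parts → parts ∈ podPartitions n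
  complete pp@(isPodPartition (isPartition _ pos refl) _) =
    ∈-filter⁺ (isPodPartition? n)
      (words-complete n (length≤sum pos) (All.map (λ y≤ → ∈-upTo⁺ (s≤s y≤)) (parts≤sum parts)))
      pp

podPartitions-unique : ∀ n → Unique (podPartitions n)
podPartitions-unique n = filter⁺ (isPodPartition? n) (words-unique n (upTo⁺ (suc n)))

{-# OPTIONS --safe #-}
module Submission where

-- Let ψ(q) = Σ_{k ∈ ℤ} q^(2k²+k) and C(q) = Σ (−1)ⁿ pod(n) qⁿ, so that Cψ = 1 by Gauss; we use Shanks'
-- finite form of this identity. Since ψ(q)⁵ = ψ(q⁵) modulo 5, we get C(q) ψ(q⁵) = ψ(q)⁴. Multiplication
-- of sums of two odd squares by 2 + i shows that the terms of ψ⁴ with exponent 2 modulo 5 add up to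
-- q² ψ(q⁵)⁴ modulo 5. Hence (−1)ⁿ pod(5n+2) is congruent to the coefficient of qⁿ in ψ³, and 8 times
-- this coefficient is the number of x ∈ ℤ³ with |x|² = 8n + 3.
--
-- In the theorem 8n + 3 = p²m, where m = pN is exactly divisible by p. Let α run through the integral
-- quaternions of norm p. View vectors as pure quaternions. For each α, the map y ↦ ᾱyα identifies the
-- vectors of norm m with those x of norm p²m for which p² divides αxᾱ, and each x of norm p²m has this
-- property for exactly 8 of the α. So 8 r₃(p²m) = r₄(p) r₃(m). Finally each α annihilates exactly one of
-- the p + 1 isotropic lines modulo p, and each line is annihilated by 8 of the α, found by the descent
-- of Euler and Lagrange. Therefore r₄(p) = 8(p + 1), which is divisible by 5.

open import Defs
open import Algebra.Bundles using (CommutativeRing)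
open import Data.Bool.Base using (Bool; false; true)
open import Data.List.Base using (List; []; _++_; _∷_; cartesianProduct; filter; length; map; upTo)
open import Data.List.Membership.Propositional using (_∈_)
open import Data.List.Membership.Propositional.Properties
  using (∈-++⁺ʳ; ∈-++⁺ˡ; ∈-++⁻; ∈-cartesianProduct⁺; ∈-cartesianProduct⁻; ∈-filter⁺; ∈-filter⁻; ∈-map⁺;
    ∈-map⁻; ∈-upTo⁺; ∈-upTo⁻)
open import Data.List.Properties
  using (filter-++; filter-accept; filter-reject; length-++; length-map; length-upTo; ∷-injectiveʳ)
open import Data.List.Relation.Unary.All as All using (All; []; _∷_)
open import Data.List.Relation.Unary.AllPairs using ([]; _∷_)
open import Data.List.Relation.Unary.Any using (here; there)
open import Data.List.Relation.Unary.Unique.Propositional using (Unique)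
open import Data.List.Relation.Unary.Unique.Propositional.Properties
  using (++⁺; cartesianProduct⁺; filter⁺; map⁺; upTo⁺)
open import Data.Nat.Base as ℕ using (suc; s≤s; zero; z≤n; ℕ)
import Data.Nat.Divisibility as ℕ
open import Data.Nat.Primality using (Prime; euclidsLemma; prime?; prime⇒irreducible; prime⇒nonZero)
import Data.Nat.Properties as ℕ
open import Data.Product.Base using (_,_; proj₁; proj₂; ∃)
open import Data.Sum.Base as Sum using ([_,_]′; _⊎_; inj₁; inj₂)
open import Function.Base using (_∘_)
open import Function.Bundles using (Equivalence; mk⇔)
open import Level using (0ℓ)
open import Relation.Nullary.Decidable
  using (Dec; _×-dec_; decidable-stable; from-no; map′; no; toWitness; yes)
open import Relation.Nullary.Negation using (contradiction; ¬_)

-- Why a factor ψ can be cancelled: the multinomial coefficients 6, 12, 1 of the terms of ψ⁴ with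
-- exponent 2 modulo 5 reduce to 1, 2, 1. With the residue components in ψ = A(q⁵) + q B(q⁵) + q³
-- D(q⁵) they form the perfect square (AB + qD²)², and AB + qD² is again ψ². Lattice points are
-- counted as lengths of lists, so each series is a sum over a finite window of integers and
-- identities hold up to a power of q; this is why Gauss' identity enters in a finite form. That p
-- divides m exactly removes two terms of the general Hecke relation, the one with a Legendre symbol
-- and the one with m/p². Concretely, each x carries a vector, x or x/p, that is isotropic and
-- nonzero modulo p. The quaternions have integer coordinates, so there are eight units and rounding
-- may leave every remainder equal to half the modulus. In that boundary case of the descent the
-- modulus divides p, which is excluded. The p + 1 isotropic lines are parametrized from one known
-- point of the conic a² + b² + c² = 0 modulo p; it is read off a quaternion of norm p.

-- Counting finite lists by bijections and by incidences.

module Counting where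

  open import Data.List.Membership.Propositional.Properties.WithK using (unique∧set⇒bag)
  open import Data.List.Relation.Binary.BagAndSetEquality using (∼bag⇒↭)
  open import Data.List.Relation.Binary.Permutation.Propositional.Properties using (↭-length)
  open import Data.Nat.Base using (_+_; _*_)
  open import Data.Nat.ListAction using (sum)
  open import Data.Nat.Properties using (*-comm)
  open import Data.Nat.Tactic.RingSolver using (solve-∀)
  open import Data.Product.Base using (_×_)
  import Relation.Binary.Definitions as B
  open import Relation.Binary.PropositionalEquality
  open import Relation.Unary using (Decidable)

  Unique-map⁺-∈ : ∀ {A B : Set} (f : A → B) {xs} →
                  (∀ {x y} → x ∈ xs → y ∈ xs → f x ≡ f y → x ≡ y) →
                  Unique xs → Unique (map f xs)
  Unique-map⁺-∈ f inj []       = []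
  Unique-map⁺-∈ f inj (x∉ ∷ u) =
    All.tabulate distinct ∷ Unique-map⁺-∈ f (λ i j → inj (there i) (there j)) u
    where
    distinct : ∀ {z} → z ∈ map f _ → f _ ≢ z
    distinct z∈ fx≡z with ∈-map⁻ f z∈
    ... | y , y∈ , refl = All.lookup x∉ y∈ (inj (here refl) (there y∈) fx≡z)

  -- The hypotheses make `map f xs` and `ys` equal as sets. Without repetitions equal sets are equal
  -- bags, hence permutations of each other.
  length-bijection : ∀ {A B : Set} {xs : List A} {ys : List B} (f : A → B) →
                     Unique xs → Unique ys →
                     (∀ {x} → x ∈ xs → f x ∈ ys) →
                     (∀ {x y} → x ∈ xs → y ∈ xs → f x ≡ f y → x ≡ y) →
                     (∀ {y} → y ∈ ys → ∃ λ x → x ∈ xs × f x ≡ y) →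
                     length xs ≡ length ys
  length-bijection {xs = xs} f uxs uys into inj onto =
    trans (sym (length-map f xs))
          (↭-length (∼bag⇒↭ (unique∧set⇒bag (Unique-map⁺-∈ f inj uxs) uys (mk⇔ to from))))
    where
    to : ∀ {y} → y ∈ map f xs → y ∈ _
    to y∈ with ∈-map⁻ f y∈
    ... | _ , x∈ , refl = into x∈
    from : ∀ {y} → y ∈ _ → y ∈ map f xs
    from y∈ with onto y∈
    ... | _ , x∈ , refl = ∈-map⁺ f x∈

  length-≡-set : ∀ {A : Set} {xs ys : List A} → Unique xs → Unique ys →
                 (∀ {x} → x ∈ xs → x ∈ ys) → (∀ {x} → x ∈ ys → x ∈ xs) →
                 length xs ≡ length ys
  length-≡-set uxs uys to from =
    length-bijection (λ x → x) uxs uys to (λ _ _ e → e) (λ y∈ → _ , from y∈ , refl)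

  sum-map-const : ∀ {A : Set} (f : A → ℕ) c xs → (∀ {x} → x ∈ xs → f x ≡ c) →
                  sum (map f xs) ≡ length xs * c
  sum-map-const f c []       const = refl
  sum-map-const f c (x ∷ xs) const =
    cong₂ _+_ (const (here refl)) (sum-map-const f c xs (const ∘ there))

  sum-map-+ : ∀ {A : Set} (f g : A → ℕ) xs →
              sum (map (λ x → f x + g x) xs) ≡ sum (map f xs) + sum (map g xs)
  sum-map-+ f g []       = refl
  sum-map-+ f g (x ∷ xs) =
    trans (cong ((f x + g x) +_) (sum-map-+ f g xs)) (interchange (f x) (g x) _ _)
    where
    interchange : ∀ a b c d → (a + b) + (c + d) ≡ (a + c) + (b + d)
    interchange = solve-∀

  module _ {A B : Set} {R : A → B → Set} (R? : B.Decidable R) where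

    -- Both sides count the related pairs. The induction splits off one row, which contributes 0 or
    -- 1 to each column.
    incidences-swap : ∀ xs ys →
      sum (map (λ x → length (filter (R? x) ys)) xs) ≡
      sum (map (λ y → length (filter (λ x → R? x y) xs)) ys)
    incidences-swap []       ys = sym (trans (sum-map-const _ 0 ys (λ _ → refl)) (*-comm (length ys) 0))
    incidences-swap (x ∷ xs) ys = begin
      length (filter (R? x) ys) + sum (map (λ x′ → length (filter (R? x′) ys)) xs)
        ≡⟨ cong₂ _+_ (row ys) (incidences-swap xs ys) ⟩
      sum (map (λ y → length (filter (λ x′ → R? x′ y) (x ∷ []))) ys) +
      sum (map (λ y → length (filter (λ x′ → R? x′ y) xs)) ys)
        ≡⟨ sum-map-+ _ _ ys ⟨
      sum (map (λ y → length (filter (λ x′ → R? x′ y) (x ∷ [])) + length (filter (λ x′ → R? x′ y) xs)) ys)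
        ≡⟨ cong sum (map-cong′ ys) ⟩
      sum (map (λ y → length (filter (λ x′ → R? x′ y) (x ∷ xs))) ys) ∎
      where
      open ≡-Reasoning
      row : ∀ zs → length (filter (R? x) zs) ≡
                   sum (map (λ y → length (filter (λ x′ → R? x′ y) (x ∷ []))) zs)
      row []       = refl
      row (z ∷ zs) with R? x z
      ... | yes _ = cong suc (row zs)
      ... | no  _ = row zs
      map-cong′ : ∀ zs →
        map (λ y → length (filter (λ x′ → R? x′ y) (x ∷ [])) + length (filter (λ x′ → R? x′ y) xs)) zs ≡
        map (λ y → length (filter (λ x′ → R? x′ y) (x ∷ xs))) zs
      map-cong′ []       = refl
      map-cong′ (z ∷ zs) = cong₂ _∷_ (sym (trans (cong length (filter-++ (λ x′ → R? x′ z) (x ∷ []) xs))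
                                                (length-++ (filter (λ x′ → R? x′ z) (x ∷ [])))))
                                     (map-cong′ zs)

    -- Applied to vectors against quaternions of norm p, which gives the Hecke relation, and to
    -- quaternions of norm p against isotropic lines, which gives r₄(p).
    double-counting : ∀ {xs ys c d} →
      (∀ {x} → x ∈ xs → length (filter (R? x) ys) ≡ c) →
      (∀ {y} → y ∈ ys → length (filter (λ x → R? x y) xs) ≡ d) →
      length xs * c ≡ length ys * d
    double-counting {xs} {ys} {c} {d} rows columns = begin
      length xs * c                                          ≡⟨ sum-map-const _ c xs rows ⟨
      sum (map (λ x → length (filter (R? x) ys)) xs)         ≡⟨ incidences-swap xs ys ⟩
      sum (map (λ y → length (filter (λ x → R? x y) xs)) ys) ≡⟨ sum-map-const _ d ys columns ⟩
      length ys * d                                          ∎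
      where open ≡-Reasoning

-- Integers modulo a prime.

module IntegerPrimes where

  open import Data.Integer.Base as ℤ using (ℤ; +_; -[1+_]; -_; _+_; _-_; _*_; 1ℤ)
  open import Data.Integer.DivMod using (_%ℕ_; _/ℕ_; n%ℕd<d; a≡a%ℕn+[a/ℕn]*n)
  open import Data.Integer.Divisibility.Signed
  open import Data.Integer.Properties using (abs-*; pos-*)
  open import Data.Integer.Tactic.RingSolver using (solve-∀)
  open import Data.Nat.Coprimality using (Coprime; coprime-Bézout)
  open import Data.Nat.GCD using (module Bézout)
  open import Data.Product.Base using (_×_)
  open import Relation.Binary.PropositionalEquality

  module _ {p : ℕ} (pr : Prime p) where

    euclidsLemmaℤ : ∀ x y → + p ∣ x * y → + p ∣ x ⊎ + p ∣ y
    euclidsLemmaℤ x y p∣xy =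
      Sum.map ∣ᵤ⇒∣ ∣ᵤ⇒∣ (euclidsLemma (ℤ.∣ x ∣) (ℤ.∣ y ∣) pr (subst (p ℕ.∣_) (abs-* x y) (∣⇒∣ᵤ p∣xy)))

    invertible : ∀ y → ¬ + p ∣ y → ∃ λ u → + p ∣ y * u - 1ℤ
    invertible y p∤y = signed y (bézout (ℤ.∣ y ∣) coprime)
      where
      coprime : Coprime p (ℤ.∣ y ∣)
      coprime (d∣p , d∣y) with prime⇒irreducible pr d∣p
      ... | inj₁ d≡1  = d≡1
      ... | inj₂ refl = contradiction (∣ᵤ⇒∣ d∣y) p∤y
      open ≡-Reasoning
      bézout : ∀ n → Coprime p n → ∃ λ u → + p ∣ + n * u - 1ℤ
      bézout n c with coprime-Bézout c
      ... | Bézout.+- x y e = - + y , divides (- + x) (begin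
        + n * - + y - 1ℤ         ≡⟨ rearrange (+ n) (+ y) ⟩
        - (1ℤ + + y * + n)       ≡⟨ cong (λ z → - (1ℤ + z)) (pos-* y n) ⟨
        - (+ (1 ℕ.+ y ℕ.* n))    ≡⟨ cong (λ z → - (+ z)) e ⟩
        - (+ (x ℕ.* p))          ≡⟨ cong -_ (pos-* x p) ⟩
        - (+ x * + p)            ≡⟨ pull (+ x) (+ p) ⟩
        - + x * + p              ∎)
        where
        rearrange : ∀ n y → n * - y - 1ℤ ≡ - (1ℤ + y * n)
        rearrange = solve-∀
        pull : ∀ x p → - (x * p) ≡ - x * p
        pull = solve-∀
      ... | Bézout.-+ x y e = + y , divides (+ x) (begin
        + n * + y - 1ℤ           ≡⟨ commute (+ n) (+ y) ⟩
        + y * + n - 1ℤ           ≡⟨ cong (_- 1ℤ) (pos-* y n) ⟨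
        + (y ℕ.* n) - 1ℤ         ≡⟨ cong (λ z → + z - 1ℤ) e ⟨
        + (1 ℕ.+ x ℕ.* p) - 1ℤ   ≡⟨ cong (λ z → 1ℤ + z - 1ℤ) (pos-* x p) ⟩
        1ℤ + + x * + p - 1ℤ      ≡⟨ cancel (+ x * + p) ⟩
        + x * + p                ∎)
        where
        commute : ∀ n y → n * y - 1ℤ ≡ y * n - 1ℤ
        commute = solve-∀
        cancel : ∀ z → 1ℤ + z - 1ℤ ≡ z
        cancel = solve-∀
      signed : ∀ y → (∃ λ u → + p ∣ + (ℤ.∣ y ∣) * u - 1ℤ) → ∃ λ u → + p ∣ y * u - 1ℤ
      signed (+ n)    inverse = inverse
      signed -[1+ n ] (u , d) = - u , subst (λ z → + p ∣ z - 1ℤ) (flip (+ ℕ.suc n) u) d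
        where
        flip : ∀ n u → n * u ≡ - n * - u
        flip = solve-∀

    -- The root -x/y is taken as its least residue, so that it can serve as the parameter of a
    -- finite point of the projective line over the field with p elements.
    linear-root : ∀ x y → ¬ + p ∣ y → ∃ λ t → t ℕ.< p × + p ∣ x + y * + t
    linear-root x y p∤y with invertible y p∤y
    ... | u , d = t , n%ℕd<d z p , subst (+ p ∣_) (sym root)
        (∣m∣n⇒∣m-n (∣n⇒∣m*n (- x) d) (∣n⇒∣m*n (y * (z /ℕ p)) ∣-refl))
      where
      instance
        p≢0 : ℕ.NonZero p
        p≢0 = prime⇒nonZero pr
      z : ℤ
      z = - x * u
      t : ℕ
      t = z %ℕ p
      open ≡-Reasoning
      root : x + y * + t ≡ - x * (y * u - 1ℤ) - y * (z /ℕ p) * + p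
      root = begin
        x + y * + t                                       ≡⟨ restore x y (+ t) (z /ℕ p) (+ p) ⟩
        x + y * (+ t + z /ℕ p * + p) - y * (z /ℕ p) * + p ≡⟨ cong (λ w → x + y * w - y * (z /ℕ p) * + p) (a≡a%ℕn+[a/ℕn]*n z p) ⟨
        x + y * (- x * u) - y * (z /ℕ p) * + p            ≡⟨ collect x y u (y * (z /ℕ p) * + p) ⟩
        - x * (y * u - 1ℤ) - y * (z /ℕ p) * + p           ∎
        where
        restore : ∀ x y t q p → x + y * t ≡ x + y * (t + q * p) - y * q * p
        restore = solve-∀
        collect : ∀ x y u w → x + y * (- x * u) - w ≡ - x * (y * u - 1ℤ) - w
        collect = solve-∀

-- The ring of integers modulo m.

module Modular where

  import Algebra.Properties.Semiring.Mult as Mult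
  open import Data.Integer.Base using (ℤ; +_; _+_; _*_; -_; _-_; 0ℤ; 1ℤ)
  open import Data.Integer.Divisibility.Signed
  import Data.Integer.Properties as ℤ
  open import Data.Integer.Tactic.RingSolver using (solve-∀)
  open import Relation.Binary.PropositionalEquality

  module _ (m : ℤ) where

    infix 4 _≡ₘ_
    record _≡ₘ_ (x y : ℤ) : Set where
      constructor congruent
      field difference : m ∣ x - y
    open _≡ₘ_

    private
      from : ∀ {x y} q → x - y ≡ q * m → x ≡ₘ y
      from q e = congruent (divides q e)

      ≡⇒≡ₘ : ∀ {x y} → x ≡ y → x ≡ₘ y
      ≡⇒≡ₘ {x} refl = from 0ℤ (ℤ.+-inverseʳ x)

      ≡ₘ-sym : ∀ {x y} → x ≡ₘ y → y ≡ₘ x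
      ≡ₘ-sym {x} {y} (congruent (divides q e)) = from (- q) (begin
        y - x     ≡⟨ flip x y ⟩
        - (x - y) ≡⟨ cong -_ e ⟩
        - (q * m) ≡⟨ ℤ.neg-distribˡ-* q m ⟩
        - q * m   ∎)
        where
        open ≡-Reasoning
        flip : ∀ x y → y - x ≡ - (x - y)
        flip = solve-∀

      ≡ₘ-trans : ∀ {x y z} → x ≡ₘ y → y ≡ₘ z → x ≡ₘ z
      ≡ₘ-trans {x} {y} {z} (congruent (divides q e)) (congruent (divides r f)) = from (q + r) (begin
        x - z             ≡⟨ split x y z ⟩
        (x - y) + (y - z) ≡⟨ cong₂ _+_ e f ⟩
        q * m + r * m     ≡⟨ ℤ.*-distribʳ-+ m q r ⟨
        (q + r) * m       ∎)
        where
        open ≡-Reasoning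
        split : ∀ x y z → x - z ≡ (x - y) + (y - z)
        split = solve-∀

      +-cong : ∀ {x y u v} → x ≡ₘ y → u ≡ₘ v → x + u ≡ₘ y + v
      +-cong {x} {y} {u} {v} (congruent (divides q e)) (congruent (divides r f)) = from (q + r) (begin
        (x + u) - (y + v) ≡⟨ split x y u v ⟩
        (x - y) + (u - v) ≡⟨ cong₂ _+_ e f ⟩
        q * m + r * m     ≡⟨ ℤ.*-distribʳ-+ m q r ⟨
        (q + r) * m       ∎)
        where
        open ≡-Reasoning
        split : ∀ x y u v → (x + u) - (y + v) ≡ (x - y) + (u - v)
        split = solve-∀

      *-cong : ∀ {x y u v} → x ≡ₘ y → u ≡ₘ v → x * u ≡ₘ y * v
      *-cong {x} {y} {u} {v} (congruent (divides q e)) (congruent (divides r f)) = from (q * u + y * r) (begin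
        x * u - y * v             ≡⟨ split x y u v ⟩
        (x - y) * u + y * (u - v) ≡⟨ cong₂ (λ a b → a * u + y * b) e f ⟩
        q * m * u + y * (r * m)   ≡⟨ collect q m u y r ⟩
        (q * u + y * r) * m       ∎)
        where
        open ≡-Reasoning
        split : ∀ x y u v → x * u - y * v ≡ (x - y) * u + y * (u - v)
        split = solve-∀
        collect : ∀ q m u y r → q * m * u + y * (r * m) ≡ (q * u + y * r) * m
        collect = solve-∀

      -‿cong : ∀ {x y} → x ≡ₘ y → - x ≡ₘ - y
      -‿cong {x} {y} (congruent (divides q e)) = from (- q) (begin
        - x - - y   ≡⟨ flip x y ⟩
        - (x - y)   ≡⟨ cong -_ e ⟩
        - (q * m)   ≡⟨ ℤ.neg-distribˡ-* q m ⟩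
        - q * m     ∎)
        where
        open ≡-Reasoning
        flip : ∀ x y → - x - - y ≡ - (x - y)
        flip = solve-∀

    -- The carrier stays ℤ and congruence is only the setoid equality. Results about coefficients
    -- are therefore statements about actual integers, and `n × 1ℤ` is propositionally `+ n`.
    ℤ/ : CommutativeRing 0ℓ 0ℓ
    ℤ/ = record
      { Carrier = ℤ ; _≈_ = _≡ₘ_ ; _+_ = _+_ ; _*_ = _*_ ; -_ = -_ ; 0# = 0ℤ ; 1# = 1ℤ
      ; isCommutativeRing = record
        { isRing = record
          { +-isAbelianGroup = record
            { isGroup = record
              { isMonoid = record
                { isSemigroup = record
                  { isMagma = record
                    { isEquivalence = record { refl = ≡⇒≡ₘ refl ; sym = ≡ₘ-sym ; trans = ≡ₘ-trans }
                    ; ∙-cong = +-cong }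
                  ; assoc = λ x y z → ≡⇒≡ₘ (ℤ.+-assoc x y z) }
                ; identity = (λ x → ≡⇒≡ₘ (ℤ.+-identityˡ x)) , (λ x → ≡⇒≡ₘ (ℤ.+-identityʳ x)) }
              ; inverse = (λ x → ≡⇒≡ₘ (ℤ.+-inverseˡ x)) , (λ x → ≡⇒≡ₘ (ℤ.+-inverseʳ x))
              ; ⁻¹-cong = -‿cong }
            ; comm = λ x y → ≡⇒≡ₘ (ℤ.+-comm x y) }
          ; *-cong = *-cong
          ; *-assoc = λ x y z → ≡⇒≡ₘ (ℤ.*-assoc x y z)
          ; *-identity = (λ x → ≡⇒≡ₘ (ℤ.*-identityˡ x)) , (λ x → ≡⇒≡ₘ (ℤ.*-identityʳ x))
          ; distrib = (λ x y z → ≡⇒≡ₘ (ℤ.*-distribˡ-+ x y z)) , (λ x y z → ≡⇒≡ₘ (ℤ.*-distribʳ-+ x y z)) }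
        ; *-comm = λ x y → ≡⇒≡ₘ (ℤ.*-comm x y) } }

    open Mult (CommutativeRing.semiring ℤ/) using (_×_)

    ×1≡ : ∀ n → n × 1ℤ ≡ + n
    ×1≡ zero    = refl
    ×1≡ (suc n) = cong (λ x → 1ℤ + x) (×1≡ n)

    ≡ₘ0⇒∣ : ∀ {x} → x ≡ₘ 0ℤ → m ∣ x
    ≡ₘ0⇒∣ {x} (congruent m∣) = subst (m ∣_) (ℤ.+-identityʳ x) m∣

    ∣⇒≡ₘ0 : ∀ {x} → m ∣ x → x ≡ₘ 0ℤ
    ∣⇒≡ₘ0 {x} m∣ = congruent (subst (m ∣_) (sym (ℤ.+-identityʳ x)) m∣)

-- Formal power series and the extraction of exponents modulo 5.

module Series (K : CommutativeRing 0ℓ 0ℓ) where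

  open import Algebra.Bundles using (CommutativeSemiring)
  import Algebra.Properties.CommutativeSemigroup as CommutativeSemigroupProperties
  import Algebra.Properties.Group as GroupProperties
  import Algebra.Properties.Semiring.Mult as Mult
  import Algebra.Solver.Ring.NaturalCoefficients.Default as NaturalCoefficients
  open import Data.Product.Base using (_,_) renaming (_×_ to _∧_)
  open import Relation.Binary.PropositionalEquality as ≡ using (_≡_)
  import Relation.Binary.Reasoning.Setoid as SetoidReasoning

  open CommutativeRing K hiding (_-_; setoid; zero)
  open Mult semiring using (_×_)
  open CommutativeSemigroupProperties +-commutativeSemigroup using (interchange)
  open GroupProperties +-group using (∙-cancelˡ; ∙-cancelʳ)
  module ≈-Reasoning = SetoidReasoning (CommutativeRing.setoid K)

  Series : Set
  Series = ℕ → Carrier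

  infix 4 _≋_ _≋[_]_

  record _≋_ (f g : Series) : Set where
    constructor coefficients
    field at : ∀ n → f n ≈ g n
  open _≋_ public

  -- Congruence modulo q^(n+1).
  record _≋[_]_ (f : Series) (n : ℕ) (g : Series) : Set where
    constructor coefficients≤
    field at≤ : ∀ m → m ℕ.≤ n → f m ≈ g m
  open _≋[_]_ public

  tail : Series → Series
  tail f n = f (suc n)

  -- Multiplication by q.
  delay : Series → Series
  delay f zero    = 0#
  delay f (suc n) = f n

  infixl 6 _⊕_
  infixl 7 _⊛_ _·_

  0ₛ 1ₛ : Series
  0ₛ _ = 0#
  1ₛ zero    = 1#
  1ₛ (suc _) = 0#

  -- The product unfolds f = f(0) + q · `tail f`, which turns the semiring laws into inductions on
  -- the exponent.
  _⊕_ _⊛_ : Series → Series → Series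
  (f ⊕ g) n       = f n + g n
  (f ⊛ g) zero    = f 0 * g 0
  (f ⊛ g) (suc n) = f 0 * g (suc n) + (tail f ⊛ g) n

  _·_ : Carrier → Series → Series
  (c · f) n = c * f n

  ≋-refl : ∀ {f} → f ≋ f
  ≋-refl .at n = refl

  ≋-sym : ∀ {f g} → f ≋ g → g ≋ f
  ≋-sym e .at n = sym (e .at n)

  ≋-trans : ∀ {f g h} → f ≋ g → g ≋ h → f ≋ h
  ≋-trans d e .at n = trans (d .at n) (e .at n)

  -- A coefficient of a product sees no higher coefficients of the factors. This is what makes
  -- calculations modulo q^(n+1) compatible with multiplication.
  ⊛-cong≤ : ∀ {f f′ g g′} n → (∀ m → m ℕ.≤ n → f m ≈ f′ m) → (∀ m → m ℕ.≤ n → g m ≈ g′ m) →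
            (f ⊛ g) n ≈ (f′ ⊛ g′) n
  ⊛-cong≤ zero    d e = *-cong (d 0 z≤n) (e 0 z≤n)
  ⊛-cong≤ (suc n) d e =
    +-cong (*-cong (d 0 z≤n) (e (suc n) ℕ.≤-refl))
           (⊛-cong≤ n (λ m m≤ → d (suc m) (s≤s m≤)) (λ m m≤ → e m (ℕ.m≤n⇒m≤1+n m≤)))

  ⊛-cong : ∀ {f f′ g g′} → f ≋ f′ → g ≋ g′ → f ⊛ g ≋ f′ ⊛ g′
  ⊛-cong d e .at n = ⊛-cong≤ n (λ m _ → d .at m) (λ m _ → e .at m)

  ⊛-distribʳ : ∀ h f g → (f ⊕ g) ⊛ h ≋ f ⊛ h ⊕ g ⊛ h
  ⊛-distribʳ h f g .at zero    = distribʳ _ _ _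
  ⊛-distribʳ h f g .at (suc n) =
    trans (+-cong (distribʳ _ _ _) (⊛-distribʳ h (tail f) (tail g) .at n)) (interchange _ _ _ _)

  ·-⊛ : ∀ c f g → (c · f) ⊛ g ≋ c · (f ⊛ g)
  ·-⊛ c f g .at zero    = *-assoc _ _ _
  ·-⊛ c f g .at (suc n) =
    trans (+-cong (*-assoc _ _ _) (·-⊛ c (tail f) g .at n)) (sym (distribˡ _ _ _))

  ⊛-assoc : ∀ f g h → (f ⊛ g) ⊛ h ≋ f ⊛ (g ⊛ h)
  ⊛-assoc f g h .at zero    = *-assoc _ _ _
  ⊛-assoc f g h .at (suc n) = begin
    f 0 * g 0 * h (suc n) + ((f 0 · tail g ⊕ tail f ⊛ g) ⊛ h) n
      ≈⟨ +-cong (*-assoc _ _ _) (⊛-distribʳ h (f 0 · tail g) (tail f ⊛ g) .at n) ⟩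
    f 0 * (g 0 * h (suc n)) + (((f 0 · tail g) ⊛ h) n + ((tail f ⊛ g) ⊛ h) n)
      ≈⟨ +-congˡ (+-cong (·-⊛ (f 0) (tail g) h .at n) (⊛-assoc (tail f) g h .at n)) ⟩
    f 0 * (g 0 * h (suc n)) + (f 0 * (tail g ⊛ h) n + (tail f ⊛ (g ⊛ h)) n)
      ≈⟨ +-assoc _ _ _ ⟨
    f 0 * (g 0 * h (suc n)) + f 0 * (tail g ⊛ h) n + (tail f ⊛ (g ⊛ h)) n
      ≈⟨ +-congʳ (distribˡ _ _ _) ⟨
    f 0 * (g 0 * h (suc n) + (tail g ⊛ h) n) + (tail f ⊛ (g ⊛ h)) n ∎
    where open ≈-Reasoning

  -- The mirror image of the defining clause, which expands the second factor instead of the first;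
  -- commutativity compares the two.
  ⊛-sucʳ : ∀ f g n → (f ⊛ g) (suc n) ≈ f (suc n) * g 0 + (f ⊛ tail g) n
  ⊛-sucʳ f g zero    = +-comm _ _
  ⊛-sucʳ f g (suc n) = begin
    f 0 * g (suc (suc n)) + (tail f ⊛ g) (suc n)
      ≈⟨ +-congˡ (⊛-sucʳ (tail f) g n) ⟩
    f 0 * g (suc (suc n)) + (f (suc (suc n)) * g 0 + (tail f ⊛ tail g) n)
      ≈⟨ +-assoc _ _ _ ⟨
    f 0 * g (suc (suc n)) + f (suc (suc n)) * g 0 + (tail f ⊛ tail g) n
      ≈⟨ +-congʳ (+-comm _ _) ⟩
    f (suc (suc n)) * g 0 + f 0 * g (suc (suc n)) + (tail f ⊛ tail g) n
      ≈⟨ +-assoc _ _ _ ⟩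
    f (suc (suc n)) * g 0 + (f 0 * g (suc (suc n)) + (tail f ⊛ tail g) n) ∎
    where open ≈-Reasoning

  ⊛-comm : ∀ f g → f ⊛ g ≋ g ⊛ f
  ⊛-comm f g .at zero    = *-comm _ _
  ⊛-comm f g .at (suc n) =
    trans (+-cong (*-comm _ _) (⊛-comm (tail f) g .at n)) (sym (⊛-sucʳ g f n))

  ⊛-zeroˡ : ∀ f → 0ₛ ⊛ f ≋ 0ₛ
  ⊛-zeroˡ f .at zero    = zeroˡ _
  ⊛-zeroˡ f .at (suc n) = trans (+-cong (zeroˡ _) (⊛-zeroˡ f .at n)) (+-identityˡ _)

  ⊛-identityˡ : ∀ f → 1ₛ ⊛ f ≋ f
  ⊛-identityˡ f .at zero    = *-identityˡ _
  ⊛-identityˡ f .at (suc n) = trans (+-cong (*-identityˡ _) (⊛-zeroˡ f .at n)) (+-identityʳ _)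

  seriesSemiring : CommutativeSemiring 0ℓ 0ℓ
  seriesSemiring = record
    { Carrier = Series ; _≈_ = _≋_ ; _+_ = _⊕_ ; _*_ = _⊛_ ; 0# = 0ₛ ; 1# = 1ₛ
    ; isCommutativeSemiring = record
      { isSemiring = record
        { isSemiringWithoutAnnihilatingZero = record
          { +-isCommutativeMonoid = record
            { isMonoid = record
              { isSemigroup = record
                { isMagma = record
                  { isEquivalence = record { refl = ≋-refl ; sym = ≋-sym ; trans = ≋-trans }
                  ; ∙-cong = λ d e → coefficients λ n → +-cong (d .at n) (e .at n) }
                ; assoc = λ f g h → coefficients λ n → +-assoc (f n) (g n) (h n) }
              ; identity = (λ f → coefficients λ n → +-identityˡ (f n))
                         , (λ f → coefficients λ n → +-identityʳ (f n)) }
            ; comm = λ f g → coefficients λ n → +-comm (f n) (g n) }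
          ; *-cong = ⊛-cong
          ; *-assoc = ⊛-assoc
          ; *-identity = ⊛-identityˡ , λ f → ≋-trans (⊛-comm f 1ₛ) (⊛-identityˡ f)
          ; distrib = (λ f g h → ≋-trans (⊛-comm f (g ⊕ h)) (≋-trans (⊛-distribʳ f g h)
                         (coefficients λ n → +-cong (⊛-comm g f .at n) (⊛-comm h f .at n))))
                    , ⊛-distribʳ }
        ; zero = ⊛-zeroˡ , λ f → ≋-trans (⊛-comm f 0ₛ) (⊛-zeroˡ f) }
      ; *-comm = ⊛-comm } }

  module S = CommutativeSemiring seriesSemiring
  module Solver = NaturalCoefficients seriesSemiring
  module ≋-Reasoning = SetoidReasoning S.setoid

  ⊕-cancelˡ : ∀ f {g h} → f ⊕ g ≋ f ⊕ h → g ≋ h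
  ⊕-cancelˡ f e .at n = ∙-cancelˡ (f n) _ _ (e .at n)

  ≋⇒≋[] : ∀ {n f g} → f ≋ g → f ≋[ n ] g
  ≋⇒≋[] e .at≤ m _ = e .at m

  ≋[]-sym : ∀ {n f g} → f ≋[ n ] g → g ≋[ n ] f
  ≋[]-sym e .at≤ m m≤n = sym (e .at≤ m m≤n)

  ≋[]-trans : ∀ {n f g h} → f ≋[ n ] g → g ≋[ n ] h → f ≋[ n ] h
  ≋[]-trans d e .at≤ m m≤n = trans (d .at≤ m m≤n) (e .at≤ m m≤n)

  ≋[]-weaken : ∀ {m n f g} → m ℕ.≤ n → f ≋[ n ] g → f ≋[ m ] g
  ≋[]-weaken m≤n e .at≤ l l≤m = e .at≤ l (ℕ.≤-trans l≤m m≤n)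

  ⊛-cong[] : ∀ {n f f′ g g′} → f ≋[ n ] f′ → g ≋[ n ] g′ → f ⊛ g ≋[ n ] f′ ⊛ g′
  ⊛-cong[] d e .at≤ m m≤n =
    ⊛-cong≤ m (λ l l≤m → d .at≤ l (ℕ.≤-trans l≤m m≤n)) (λ l l≤m → e .at≤ l (ℕ.≤-trans l≤m m≤n))

  delay-cong : ∀ {f g} → f ≋ g → delay f ≋ delay g
  delay-cong e .at zero    = refl
  delay-cong e .at (suc n) = e .at n

  delay-⊛ : ∀ f g → delay f ⊛ g ≋ delay (f ⊛ g)
  delay-⊛ f g .at zero    = zeroˡ _
  delay-⊛ f g .at (suc n) = trans (+-congʳ (zeroˡ _)) (+-identityˡ _)

  q^ : ℕ → Series
  q^ zero    = 1ₛ
  q^ (suc n) = delay (q^ n)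

  q^-homo : ∀ m n → q^ (m ℕ.+ n) ≋ q^ m ⊛ q^ n
  q^-homo zero    n = ≋-sym (⊛-identityˡ (q^ n))
  q^-homo (suc m) n = ≋-trans (delay-cong (q^-homo m n)) (≋-sym (delay-⊛ (q^ m) (q^ n)))

  q^-cong : ∀ {m n} → m ≡ n → q^ m ≋ q^ n
  q^-cong ≡.refl = ≋-refl

  q^-⊛-< : ∀ k f {n} → n ℕ.< k → (q^ k ⊛ f) n ≈ 0#
  q^-⊛-< (suc k) f {zero}  _         = zeroˡ _
  q^-⊛-< (suc k) f {suc n} (s≤s n<k) = trans (delay-⊛ (q^ k) f .at (suc n)) (q^-⊛-< k f n<k)

  q^-⊛-+ : ∀ k f n → (q^ k ⊛ f) (k ℕ.+ n) ≈ f n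
  q^-⊛-+ zero    f n = ⊛-identityˡ f .at n
  q^-⊛-+ (suc k) f n = trans (delay-⊛ (q^ k) f .at (suc k ℕ.+ n)) (q^-⊛-+ k f n)

  q^-same : ∀ n → q^ n n ≈ 1#
  q^-same zero    = refl
  q^-same (suc n) = q^-same n

  q^-differ : ∀ m n → ¬ m ≡ n → q^ m n ≈ 0#
  q^-differ zero    zero    m≢n = contradiction ≡.refl m≢n
  q^-differ zero    (suc n) m≢n = refl
  q^-differ (suc m) zero    m≢n = refl
  q^-differ (suc m) (suc n) m≢n = q^-differ m n (λ e → m≢n (≡.cong suc e))

  -- (1 − q^(k+1)) X = W − Z determines X.
  fixpoint-unique : ∀ k {X X′ Z W} → X ⊕ Z ≋ W ⊕ q^ (suc k) ⊛ X → X′ ⊕ Z ≋ W ⊕ q^ (suc k) ⊛ X′ → X ≋ X′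
  fixpoint-unique k {X} {X′} {Z} d e = coefficients λ n → below (suc n) n ℕ.≤-refl
    where
    below : ∀ b n → n ℕ.< b → X n ≈ X′ n
    below (suc b) n (s≤s n≤b) = ∙-cancelʳ (Z n) _ _ (trans (d .at n) (trans (+-congˡ shifted) (sym (e .at n))))
      where
      shifted : (q^ (suc k) ⊛ X) n ≈ (q^ (suc k) ⊛ X′) n
      shifted with n ℕ.<? suc k
      ... | yes n<k = trans (q^-⊛-< (suc k) X n<k) (sym (q^-⊛-< (suc k) X′ n<k))
      ... | no  n≮k with ℕ.m≤n⇒∃[o]m+o≡n (ℕ.≮⇒≥ n≮k)
      ...   | o , ≡.refl = trans (q^-⊛-+ (suc k) X o)
                          (trans (below b o (ℕ.<-≤-trans (s≤s (ℕ.m≤n+m o k)) n≤b))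
                                 (sym (q^-⊛-+ (suc k) X′ o)))

  module _ {A : Set} where

    gen : (A → ℕ) → List A → Series
    gen w []       = 0ₛ
    gen w (x ∷ xs) = q^ (w x) ⊕ gen w xs

    gen-at : ∀ w xs n → gen w xs n ≈ length (filter (λ x → w x ℕ.≟ n) xs) × 1#
    gen-at w []       n = refl
    gen-at w (x ∷ xs) n with w x ℕ.≟ n
    ... | yes w≡n rewrite filter-accept (λ x → w x ℕ.≟ n) {xs = xs} w≡n =
      +-cong (trans (reflexive (≡.cong (λ k → q^ k n) w≡n)) (q^-same n)) (gen-at w xs n)
    ... | no  w≢n rewrite filter-reject (λ x → w x ℕ.≟ n) {xs = xs} w≢n =
      trans (+-cong (q^-differ (w x) n w≢n) (gen-at w xs n)) (+-identityˡ _)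

    gen-++ : ∀ w xs ys → gen w (xs ++ ys) ≋ gen w xs ⊕ gen w ys
    gen-++ w []       ys = ≋-sym (S.+-identityˡ _)
    gen-++ w (x ∷ xs) ys =
      ≋-trans (S.+-congˡ (gen-++ w xs ys)) (≋-sym (S.+-assoc (q^ (w x)) (gen w xs) (gen w ys)))

    gen-shift : ∀ c w xs → gen (λ x → c ℕ.+ w x) xs ≋ q^ c ⊛ gen w xs
    gen-shift c w []       = ≋-sym (S.zeroʳ (q^ c))
    gen-shift c w (x ∷ xs) = ≋-trans (S.+-cong (q^-homo c (w x)) (gen-shift c w xs))
                                     (≋-sym (S.distribˡ (q^ c) (q^ (w x)) (gen w xs)))

  gen-map : ∀ {A B : Set} (f : A → B) w xs → gen w (map f xs) ≋ gen (λ x → w (f x)) xs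
  gen-map f w []       = ≋-refl
  gen-map f w (x ∷ xs) = S.+-congˡ (gen-map f w xs)

  gen-cartesianProduct : ∀ {A B : Set} (v : A → ℕ) (w : B → ℕ) xs ys →
    gen (λ (x , y) → v x ℕ.+ w y) (cartesianProduct xs ys) ≋ gen v xs ⊛ gen w ys
  gen-cartesianProduct v w []       ys = ≋-sym (⊛-zeroˡ (gen w ys))
  gen-cartesianProduct v w (x ∷ xs) ys = begin
    gen vw (map (x ,_) ys ++ cartesianProduct xs ys)
      ≈⟨ gen-++ vw (map (x ,_) ys) _ ⟩
    gen vw (map (x ,_) ys) ⊕ gen vw (cartesianProduct xs ys)
      ≈⟨ S.+-cong (≋-trans (gen-map (x ,_) vw ys) (gen-shift (v x) w ys)) (gen-cartesianProduct v w xs ys) ⟩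
    q^ (v x) ⊛ gen w ys ⊕ gen v xs ⊛ gen w ys
      ≈⟨ S.distribʳ (gen w ys) (q^ (v x)) (gen v xs) ⟨
    (q^ (v x) ⊕ gen v xs) ⊛ gen w ys ∎
    where
    open ≋-Reasoning
    vw : _ ∧ _ → ℕ
    vw (x , y) = v x ℕ.+ w y

  -- Five successors at a time, so that `5* suc n ℕ.+ r` reduces in step with the recursions of
  -- `dilate` and `⊛`.
  5*_ : ℕ → ℕ
  5* zero  = 0
  5* suc n = suc (suc (suc (suc (suc (5* n)))))

  -- f(q) ↦ f(q⁵).
  dilate : Series → Series
  dilate f 0                                   = f 0
  dilate f 1                                   = 0#
  dilate f 2                                   = 0#
  dilate f 3                                   = 0#
  dilate f 4                                   = 0#
  dilate f (suc (suc (suc (suc (suc n)))))     = dilate (tail f) n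

  section : ℕ → Series → Series
  section r f n = f (5* n ℕ.+ r)

  section-cong : ∀ r {f g} → f ≋ g → section r f ≋ section r g
  section-cong r e .at n = e .at _

  0*x+y≈y : ∀ {x y} → 0# * x + y ≈ y
  0*x+y≈y = trans (+-congʳ (zeroˡ _)) (+-identityˡ _)

  -- A factor in q⁵ shifts exponents by multiples of 5 only, so it passes through the extraction of
  -- a residue class. For r ≤ 4 the coefficient of q^r meets only the constant term of `f`.
  dilate-⊛ : ∀ r f g → r ℕ.≤ 4 → section r (dilate f ⊛ g) ≋ f ⊛ section r g
  dilate-⊛ r f g r≤4 .at zero = first r r≤4
    where
    x+0*y≈x : ∀ {x y} → x + 0# * y ≈ x
    x+0*y≈x = trans (+-congˡ (zeroˡ _)) (+-identityʳ _)
    first : ∀ r → r ℕ.≤ 4 → (dilate f ⊛ g) r ≈ f 0 * g r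
    first 0 _ = refl
    first 1 _ = x+0*y≈x
    first 2 _ = trans (+-congˡ 0*x+y≈y) x+0*y≈x
    first 3 _ = trans (+-congˡ (trans 0*x+y≈y 0*x+y≈y)) x+0*y≈x
    first 4 _ = trans (+-congˡ (trans 0*x+y≈y (trans 0*x+y≈y 0*x+y≈y))) x+0*y≈x
    first (suc (suc (suc (suc (suc _))))) (s≤s (s≤s (s≤s (s≤s ()))))
  dilate-⊛ r f g r≤4 .at (suc n) =
    +-congˡ (trans 0*x+y≈y (trans 0*x+y≈y (trans 0*x+y≈y (trans 0*x+y≈y
      (dilate-⊛ r (tail f) g r≤4 .at n)))))

  dilate-cong : ∀ {f g} → f ≋ g → dilate f ≋ dilate g
  dilate-cong e .at 0 = e .at 0
  dilate-cong e .at 1 = refl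
  dilate-cong e .at 2 = refl
  dilate-cong e .at 3 = refl
  dilate-cong e .at 4 = refl
  dilate-cong e .at (suc (suc (suc (suc (suc n))))) = dilate-cong (coefficients λ m → e .at (suc m)) .at n

  dilate-0 : dilate 0ₛ ≋ 0ₛ
  dilate-0 .at 0 = refl
  dilate-0 .at 1 = refl
  dilate-0 .at 2 = refl
  dilate-0 .at 3 = refl
  dilate-0 .at 4 = refl
  dilate-0 .at (suc (suc (suc (suc (suc n))))) = dilate-0 .at n

  dilate-⊕ : ∀ f g → dilate (f ⊕ g) ≋ dilate f ⊕ dilate g
  dilate-⊕ f g .at 0 = refl
  dilate-⊕ f g .at 1 = sym (+-identityˡ _)
  dilate-⊕ f g .at 2 = sym (+-identityˡ _)
  dilate-⊕ f g .at 3 = sym (+-identityˡ _)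
  dilate-⊕ f g .at 4 = sym (+-identityˡ _)
  dilate-⊕ f g .at (suc (suc (suc (suc (suc n))))) = dilate-⊕ (tail f) (tail g) .at n

  dilate-q^ : ∀ k → dilate (q^ k) ≋ q^ (5* k)
  dilate-q^ zero .at 0 = refl
  dilate-q^ zero .at 1 = refl
  dilate-q^ zero .at 2 = refl
  dilate-q^ zero .at 3 = refl
  dilate-q^ zero .at 4 = refl
  dilate-q^ zero .at (suc (suc (suc (suc (suc n))))) = dilate-0 .at n
  dilate-q^ (suc k) .at 0 = refl
  dilate-q^ (suc k) .at 1 = refl
  dilate-q^ (suc k) .at 2 = refl
  dilate-q^ (suc k) .at 3 = refl
  dilate-q^ (suc k) .at 4 = refl
  dilate-q^ (suc k) .at (suc (suc (suc (suc (suc n))))) = dilate-q^ k .at n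

  dilate-gen : ∀ {A : Set} (w : A → ℕ) xs → dilate (gen w xs) ≋ gen (λ x → 5* w x) xs
  dilate-gen w []       = dilate-0
  dilate-gen w (x ∷ xs) =
    ≋-trans (dilate-⊕ (q^ (w x)) (gen w xs)) (S.+-cong (dilate-q^ (w x)) (dilate-gen w xs))

  infixl 8 _⁵

  _⁵ : Series → Series
  f ⁵ = f ⊛ f ⊛ f ⊛ f ⊛ f

  5ₛ : Series
  5ₛ = 1ₛ ⊕ 1ₛ ⊕ 1ₛ ⊕ 1ₛ ⊕ 1ₛ

  -- The middle binomial coefficients 5, 10, 10, 5 are 5 times 1, 2, 2, 1.
  ⁵-⊕ : ∀ f g → (f ⊕ g) ⁵ ≋
        f ⁵ ⊕ g ⁵ ⊕ 5ₛ ⊛ (f ⊛ g ⊛ (f ⊛ f ⊛ f ⊕ (1ₛ ⊕ 1ₛ) ⊛ f ⊛ f ⊛ g ⊕ (1ₛ ⊕ 1ₛ) ⊛ f ⊛ g ⊛ g ⊕ g ⊛ g ⊛ g))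
  ⁵-⊕ = solve 2 (λ f g → fifth (f :+ g) :=
      fifth f :+ fifth g :+ (one :+ one :+ one :+ one :+ one) :*
        (f :* g :* (f :* f :* f :+ (one :+ one) :* f :* f :* g :+ (one :+ one) :* f :* g :* g :+ g :* g :* g)))
    ≋-refl
    where
    open Solver
    one : ∀ {n} → Polynomial n
    one = con 1
    fifth : ∀ {n} → Polynomial n → Polynomial n
    fifth f = f :* f :* f :* f :* f

  q^-⁵ : ∀ k → q^ k ⁵ ≋ q^ (5* k)
  q^-⁵ k = ≋-sym (≋-trans (q^-cong (5*-+ k))
    (≋-trans (q^-homo (k ℕ.+ k ℕ.+ k ℕ.+ k) k) (S.*-congʳ
    (≋-trans (q^-homo (k ℕ.+ k ℕ.+ k) k) (S.*-congʳ
    (≋-trans (q^-homo (k ℕ.+ k) k) (S.*-congʳ (q^-homo k k))))))))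
    where
    open import Data.Nat.Tactic.RingSolver using (solve-∀)
    step : ∀ k → 5 ℕ.+ (k ℕ.+ k ℕ.+ k ℕ.+ k ℕ.+ k) ≡
                 suc k ℕ.+ suc k ℕ.+ suc k ℕ.+ suc k ℕ.+ suc k
    step = solve-∀
    5*-+ : ∀ k → 5* k ≡ k ℕ.+ k ℕ.+ k ℕ.+ k ℕ.+ k
    5*-+ zero    = ≡.refl
    5*-+ (suc k) = ≡.trans (≡.cong (5 ℕ.+_) (5*-+ k)) (step k)

  HasCharacteristicFive : Set
  HasCharacteristicFive = 5 × 1# ≈ 0#

  -- The fourth power of a + bx + cz, split according to whether the monomial x^j z^k
  -- has j + 3k congruent to 2 modulo 5, up to 5 times the excess.
  module Expansion {A : Set} (_+_ _*_ : A → A → A) (1# : A) where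

    private
      infixl 6 _+′_
      infixl 7 _*′_
      _+′_ _*′_ : A → A → A
      _+′_ = _+_
      _*′_ = _*_

      2× 3× : A → A
      2× f = f +′ f
      3× f = f +′ f +′ f

    total onClass offClass excess : A → A → A → A → A → A
    total a b c x z = y *′ y *′ y *′ y
      where
      y : A
      y = a +′ b *′ x +′ c *′ z
    onClass a b c x z =
      a *′ a *′ b *′ b *′ (x *′ x) +′ 2× (a *′ b *′ c *′ c *′ (x *′ z *′ z)) +′ c *′ c *′ c *′ c *′ (z *′ z *′ z *′ z)
    offClass a b c x z =
      a *′ a *′ a *′ a *′ 1# +′ b *′ b *′ b *′ b *′ (x *′ x *′ x *′ x)
      +′ 2× (2× (a *′ a *′ a *′ b *′ x +′ a *′ a *′ a *′ c *′ z +′ a *′ b *′ b *′ b *′ (x *′ x *′ x)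
              +′ a *′ c *′ c *′ c *′ (z *′ z *′ z) +′ b *′ b *′ b *′ c *′ (x *′ x *′ x *′ z)
              +′ b *′ c *′ c *′ c *′ (x *′ z *′ z *′ z)
              +′ 3× (a *′ a *′ b *′ c *′ (x *′ z) +′ a *′ b *′ b *′ c *′ (x *′ x *′ z))))
      +′ 2× (3× (a *′ a *′ c *′ c *′ (z *′ z) +′ b *′ b *′ c *′ c *′ (x *′ x *′ z *′ z)))
    excess a b c x z = a *′ a *′ b *′ b *′ (x *′ x) +′ 2× (a *′ b *′ c *′ c *′ (x *′ z *′ z))

  module CharacteristicFive (char5 : HasCharacteristicFive) where

    5ₛ≋0 : 5ₛ ≋ 0ₛ
    5ₛ≋0 .at zero    = trans (solve₅ 1#) char5
      where
      solve₅ : ∀ x → x + x + x + x + x ≈ 5 × x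
      solve₅ x = trans (+-assoc _ _ _) (trans (+-assoc _ _ _) (trans (+-assoc _ _ _)
        (+-congˡ (+-congˡ (+-congˡ (+-congˡ (sym (+-identityʳ x))))))))
    5ₛ≋0 .at (suc n) = trans (+-identityʳ _) (trans (+-identityʳ _) (trans (+-identityʳ _) (+-identityʳ _)))

    5ₛ-kill : ∀ f g → f ⊕ 5ₛ ⊛ g ≋ f
    5ₛ-kill f g = ≋-trans (S.+-congˡ (≋-trans (S.*-congʳ 5ₛ≋0) (⊛-zeroˡ g))) (S.+-identityʳ f)

    -- Fifth powers are additive in characteristic 5, and all coefficients come from adding
    -- monomials with coefficient 1, so Frobenius does nothing but multiply exponents by 5.
    frobenius-gen : ∀ {A : Set} (w : A → ℕ) xs → gen w xs ⁵ ≋ dilate (gen w xs)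
    frobenius-gen w xs = ≋-trans (go xs) (≋-sym (dilate-gen w xs))
      where
      go : ∀ xs → gen w xs ⁵ ≋ gen (λ x → 5* w x) xs
      go []       = S.zeroʳ _
      go (x ∷ xs) = ≋-trans (⁵-⊕ (q^ (w x)) (gen w xs))
                   (≋-trans (5ₛ-kill _ _) (S.+-cong (q^-⁵ (w x)) (go xs)))

    -- Three components are enough because triangular numbers are 0, 1 or 3 modulo 5.
    module _ {ψ A B C : Series} (dissection : ψ ≋ dilate A ⊕ dilate B ⊛ q^ 1 ⊕ dilate C ⊛ q^ 3) where

      private
        a b c x z : Series
        a = dilate A
        b = dilate B
        c = dilate C
        x = q^ 1
        z = q^ 3

        -- Captures f = F(q⁵) by its effect on sections. It is closed under products, so a monomial
        -- in `a`, `b`, `c` is handled one factor at a time.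
        record Dilates (f F : Series) : Set where
          constructor dilates
          field apply : ∀ g → section 2 (f ⊛ g) ≋ F ⊛ section 2 g
        open Dilates

        infixl 7 _⟨⊛⟩_
        _⟨⊛⟩_ : ∀ {f F g G} → Dilates f F → Dilates g G → Dilates (f ⊛ g) (F ⊛ G)
        _⟨⊛⟩_ {f} {F} {g} {G} df dg .apply h = begin
          section 2 (f ⊛ g ⊛ h)     ≈⟨ section-cong 2 (⊛-assoc f g h) ⟩
          section 2 (f ⊛ (g ⊛ h))   ≈⟨ df .apply (g ⊛ h) ⟩
          F ⊛ section 2 (g ⊛ h)     ≈⟨ S.*-congˡ (dg .apply h) ⟩
          F ⊛ (G ⊛ section 2 h)     ≈⟨ ⊛-assoc F G (section 2 h) ⟨
          F ⊛ G ⊛ section 2 h       ∎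
          where open ≋-Reasoning

        da : Dilates a A
        da = dilates λ g → dilate-⊛ 2 A g (s≤s (s≤s z≤n))
        db : Dilates b B
        db = dilates λ g → dilate-⊛ 2 B g (s≤s (s≤s z≤n))
        dc : Dilates c C
        dc = dilates λ g → dilate-⊛ 2 C g (s≤s (s≤s z≤n))

        section-q^-5+ : ∀ e → section 2 (q^ (5 ℕ.+ e)) ≋ delay (section 2 (q^ e))
        section-q^-5+ e .at zero    = refl
        section-q^-5+ e .at (suc n) = refl

        section-q^-2 : section 2 (q^ 2) ≋ q^ 0
        section-q^-2 .at zero    = refl
        section-q^-2 .at (suc n) = refl

        record Vanishes (f : Series) : Set where
          constructor vanishes
          field section≋0 : section 2 f ≋ 0ₛ
        open Vanishes

        record Avoids (e : ℕ) : Set where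
          constructor avoids
          field power≋0 : section 2 (q^ e) ≋ 0ₛ
        open Avoids

        v0 : Avoids 0
        v0 .power≋0 .at zero    = refl
        v0 .power≋0 .at (suc n) = refl
        v1 : Avoids 1
        v1 .power≋0 .at zero    = refl
        v1 .power≋0 .at (suc n) = refl
        v3 : Avoids 3
        v3 .power≋0 .at zero    = refl
        v3 .power≋0 .at (suc n) = refl
        v4 : Avoids 4
        v4 .power≋0 .at zero    = refl
        v4 .power≋0 .at (suc n) = refl

        v5+ : ∀ {e} → Avoids e → Avoids (5 ℕ.+ e)
        v5+ {e} v .power≋0 = ≋-trans (section-q^-5+ e) (≋-trans (delay-cong (v .power≋0)) delay-0)
          where
          delay-0 : delay 0ₛ ≋ 0ₛ
          delay-0 .at zero    = refl
          delay-0 .at (suc n) = refl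

        record Monomial (m : Series) (e : ℕ) : Set where
          constructor monomial
          field isPower : m ≋ q^ e
        open Monomial

        infixl 7 _⟨^⟩_
        _⟨^⟩_ : ∀ {f g m n} → Monomial f m → Monomial g n → Monomial (f ⊛ g) (m ℕ.+ n)
        _⟨^⟩_ {m = m} {n} d e .isPower = ≋-trans (⊛-cong (d .isPower) (e .isPower)) (≋-sym (q^-homo m n))

        mx : Monomial x 1
        mx = monomial ≋-refl
        mz : Monomial z 3
        mz = monomial ≋-refl

        section-monomial : ∀ {f F m e} → Dilates f F → Monomial m e →
                           section 2 (f ⊛ m) ≋ F ⊛ section 2 (q^ e)
        section-monomial df m = ≋-trans (df .apply _) (S.*-congˡ (section-cong 2 (m .isPower)))

        off : ∀ {f F m e} → Dilates f F → Monomial m e → Avoids e → Vanishes (f ⊛ m)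
        off {F = F} df m v .section≋0 =
          ≋-trans (section-monomial df m) (≋-trans (S.*-congˡ (v .power≋0)) (S.zeroʳ F))

        infixl 6 _⟨+⟩_
        _⟨+⟩_ : ∀ {f g} → Vanishes f → Vanishes g → Vanishes (f ⊕ g)
        (u ⟨+⟩ v) .section≋0 .at n = trans (+-cong (u .section≋0 .at n) (v .section≋0 .at n)) (+-identityʳ _)

        open Expansion _⊕_ _⊛_ 1ₛ

        2v : ∀ {f} → Vanishes f → Vanishes (f ⊕ f)
        2v v = v ⟨+⟩ v
        3v : ∀ {f} → Vanishes f → Vanishes (f ⊕ f ⊕ f)
        3v v = v ⟨+⟩ v ⟨+⟩ v

        -- The same formulas are read in series and in the solver's polynomials. The excess accounts
        -- for 6 = 1 + 5 and 12 = 2 + 2 · 5.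
        expansion : ∀ a b c x z → total a b c x z ≋ onClass a b c x z ⊕ offClass a b c x z ⊕ 5ₛ ⊛ excess a b c x z
        expansion = solve 5 (λ a b c x z → E.total a b c x z := E.onClass a b c x z :+ E.offClass a b c x z :+
          (con 1 :+ con 1 :+ con 1 :+ con 1 :+ con 1) :* E.excess a b c x z) ≋-refl
          where
          open Solver
          module E = Expansion {Polynomial 5} _:+_ _:*_ (con 1)

        -- With `x` of exponent 1 and `z` of exponent 3, each `v` term records the exponent of its
        -- monomial as 0, 1, 3 or 4 plus a number of fives.
        offClass-vanishes : Vanishes (offClass a b c x z)
        offClass-vanishes =
          off (da ⟨⊛⟩ da ⟨⊛⟩ da ⟨⊛⟩ da) (monomial {e = 0} ≋-refl) v0
          ⟨+⟩ off (db ⟨⊛⟩ db ⟨⊛⟩ db ⟨⊛⟩ db) (mx ⟨^⟩ mx ⟨^⟩ mx ⟨^⟩ mx) v4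
          ⟨+⟩ 2v (2v (off (da ⟨⊛⟩ da ⟨⊛⟩ da ⟨⊛⟩ db) mx v1
                  ⟨+⟩ off (da ⟨⊛⟩ da ⟨⊛⟩ da ⟨⊛⟩ dc) mz v3
                  ⟨+⟩ off (da ⟨⊛⟩ db ⟨⊛⟩ db ⟨⊛⟩ db) (mx ⟨^⟩ mx ⟨^⟩ mx) v3
                  ⟨+⟩ off (da ⟨⊛⟩ dc ⟨⊛⟩ dc ⟨⊛⟩ dc) (mz ⟨^⟩ mz ⟨^⟩ mz) (v5+ v4)
                  ⟨+⟩ off (db ⟨⊛⟩ db ⟨⊛⟩ db ⟨⊛⟩ dc) (mx ⟨^⟩ mx ⟨^⟩ mx ⟨^⟩ mz) (v5+ v1)
                  ⟨+⟩ off (db ⟨⊛⟩ dc ⟨⊛⟩ dc ⟨⊛⟩ dc) (mx ⟨^⟩ mz ⟨^⟩ mz ⟨^⟩ mz) (v5+ (v5+ v0))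
                  ⟨+⟩ 3v (off (da ⟨⊛⟩ da ⟨⊛⟩ db ⟨⊛⟩ dc) (mx ⟨^⟩ mz) v4
                      ⟨+⟩ off (da ⟨⊛⟩ db ⟨⊛⟩ db ⟨⊛⟩ dc) (mx ⟨^⟩ mx ⟨^⟩ mz) (v5+ v0))))
          ⟨+⟩ 2v (3v (off (da ⟨⊛⟩ da ⟨⊛⟩ dc ⟨⊛⟩ dc) (mz ⟨^⟩ mz) (v5+ v1)
                  ⟨+⟩ off (db ⟨⊛⟩ db ⟨⊛⟩ dc ⟨⊛⟩ dc) (mx ⟨^⟩ mx ⟨^⟩ mz ⟨^⟩ mz) (v5+ v3)))

        section-⊕ : ∀ f g {F G} → section 2 f ≋ F → section 2 g ≋ G → section 2 (f ⊕ g) ≋ F ⊕ G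
        section-⊕ f g d e .at n = +-cong (d .at n) (e .at n)

        section-q^-7 : section 2 (q^ 7) ≋ q^ 1
        section-q^-7 = ≋-trans (section-q^-5+ 2) (delay-cong section-q^-2)
        section-q^-12 : section 2 (q^ 12) ≋ q^ 2
        section-q^-12 = ≋-trans (section-q^-5+ 7) (delay-cong section-q^-7)

        section-onClass : section 2 (onClass a b c x z) ≋
          A ⊛ A ⊛ B ⊛ B ⊛ q^ 0 ⊕ (A ⊛ B ⊛ C ⊛ C ⊛ q^ 1 ⊕ A ⊛ B ⊛ C ⊛ C ⊛ q^ 1) ⊕ C ⊛ C ⊛ C ⊛ C ⊛ q^ 2
        section-onClass =
          section-⊕ (f₁ ⊕ (f₂ ⊕ f₂)) f₃ (section-⊕ f₁ (f₂ ⊕ f₂) first (section-⊕ f₂ f₂ second second)) third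
          where
          f₁ f₂ f₃ : Series
          f₁ = a ⊛ a ⊛ b ⊛ b ⊛ (x ⊛ x)
          f₂ = a ⊛ b ⊛ c ⊛ c ⊛ (x ⊛ z ⊛ z)
          f₃ = c ⊛ c ⊛ c ⊛ c ⊛ (z ⊛ z ⊛ z ⊛ z)
          first : section 2 f₁ ≋ A ⊛ A ⊛ B ⊛ B ⊛ q^ 0
          first = ≋-trans (section-monomial (da ⟨⊛⟩ da ⟨⊛⟩ db ⟨⊛⟩ db) (mx ⟨^⟩ mx)) (S.*-congˡ section-q^-2)
          second : section 2 f₂ ≋ A ⊛ B ⊛ C ⊛ C ⊛ q^ 1
          second = ≋-trans (section-monomial (da ⟨⊛⟩ db ⟨⊛⟩ dc ⟨⊛⟩ dc) (mx ⟨^⟩ mz ⟨^⟩ mz)) (S.*-congˡ section-q^-7)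
          third : section 2 f₃ ≋ C ⊛ C ⊛ C ⊛ C ⊛ q^ 2
          third = ≋-trans (section-monomial (dc ⟨⊛⟩ dc ⟨⊛⟩ dc ⟨⊛⟩ dc) (mz ⟨^⟩ mz ⟨^⟩ mz ⟨^⟩ mz)) (S.*-congˡ section-q^-12)

        -- The multinomial coefficients 6, 12, 1 have become 1, 2, 1 modulo 5. This perfect square
        -- is what will be recognised as (ψ²)².
        square : ∀ A B C x → A ⊛ A ⊛ B ⊛ B ⊛ 1ₛ ⊕ (A ⊛ B ⊛ C ⊛ C ⊛ x ⊕ A ⊛ B ⊛ C ⊛ C ⊛ x) ⊕ C ⊛ C ⊛ C ⊛ C ⊛ (x ⊛ x) ≋
                 (A ⊛ B ⊕ C ⊛ C ⊛ x) ⊛ (A ⊛ B ⊕ C ⊛ C ⊛ x)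
        square = solve 4 (λ A B C x →
          A :* A :* B :* B :* con 1 :+ (A :* B :* C :* C :* x :+ A :* B :* C :* C :* x) :+ C :* C :* C :* C :* (x :* x) :=
          (A :* B :+ C :* C :* x) :* (A :* B :+ C :* C :* x)) ≋-refl
          where open Solver

      section-fourth-power : section 2 (ψ ⊛ ψ ⊛ ψ ⊛ ψ) ≋ (A ⊛ B ⊕ C ⊛ C ⊛ q^ 1) ⊛ (A ⊛ B ⊕ C ⊛ C ⊛ q^ 1)
      section-fourth-power = begin
        section 2 (ψ ⊛ ψ ⊛ ψ ⊛ ψ)
          ≈⟨ section-cong 2 (⊛-cong (⊛-cong (⊛-cong dissection dissection) dissection) dissection) ⟩
        section 2 (φ ⊛ φ ⊛ φ ⊛ φ)
          ≈⟨ section-cong 2 (≋-trans (expansion a b c x z) (5ₛ-kill (on ⊕ off′) (excess a b c x z))) ⟩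
        section 2 (on ⊕ off′)
          ≈⟨ section-⊕ on off′ section-onClass (offClass-vanishes .section≋0) ⟩
        A ⊛ A ⊛ B ⊛ B ⊛ q^ 0 ⊕ (A ⊛ B ⊛ C ⊛ C ⊛ x ⊕ A ⊛ B ⊛ C ⊛ C ⊛ x) ⊕ C ⊛ C ⊛ C ⊛ C ⊛ q^ 2 ⊕ 0ₛ
          ≈⟨ S.+-identityʳ _ ⟩
        A ⊛ A ⊛ B ⊛ B ⊛ q^ 0 ⊕ (A ⊛ B ⊛ C ⊛ C ⊛ x ⊕ A ⊛ B ⊛ C ⊛ C ⊛ x) ⊕ C ⊛ C ⊛ C ⊛ C ⊛ q^ 2
          ≈⟨ S.+-congˡ (S.*-congˡ (q^-homo 1 1)) ⟩
        A ⊛ A ⊛ B ⊛ B ⊛ q^ 0 ⊕ (A ⊛ B ⊛ C ⊛ C ⊛ x ⊕ A ⊛ B ⊛ C ⊛ C ⊛ x) ⊕ C ⊛ C ⊛ C ⊛ C ⊛ (x ⊛ x)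
          ≈⟨ square A B C x ⟩
        (A ⊛ B ⊕ C ⊛ C ⊛ x) ⊛ (A ⊛ B ⊕ C ⊛ C ⊛ x) ∎
        where
        open ≋-Reasoning
        φ on off′ : Series
        on = onClass a b c x z
        off′ = offClass a b c x z
        φ = a ⊕ b ⊛ x ⊕ c ⊛ z

-- Recurrences for pod partitions with bounded parts.

module PodRecurrence where

  open Counting
  open import Data.List.Relation.Unary.Linked as Linked using (Linked; []; [-]; _∷_)
  import Data.List.Relation.Unary.Linked.Properties as Linked
  open import Data.Nat.Base
  open import Data.Nat.ListAction using (sum)
  open import Data.Nat.Properties
  open import Data.Product.Base using (_×_)
  open import Relation.Binary.PropositionalEquality

  boundedPods : ℕ → ℕ → List (List ℕ)
  boundedPods k n = filter (All.all? (_≤? k)) (podPartitions n)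

  podCount : ℕ → ℕ → ℕ
  podCount k n = length (boundedPods k n)

  record BoundedPod (k n : ℕ) (ps : List ℕ) : Set where
    constructor boundedPod
    field
      isPod   : IsPodPartition n ps
      bounded : All (_≤ k) ps

  ∈-boundedPods⁺ : ∀ k n {ps} → BoundedPod k n ps → ps ∈ boundedPods k n
  ∈-boundedPods⁺ k n {ps} (boundedPod pod all≤) =
    ∈-filter⁺ (All.all? (_≤? k)) (Equivalence.from (∈-podPartitions n ps) pod) all≤

  ∈-boundedPods⁻ : ∀ k n {ps} → ps ∈ boundedPods k n → BoundedPod k n ps
  ∈-boundedPods⁻ k n {ps} ps∈ with ∈-filter⁻ (All.all? (_≤? k)) {xs = podPartitions n} ps∈
  ... | ps∈′ , all≤ = boundedPod (Equivalence.to (∈-podPartitions n ps) ps∈′) all≤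

  boundedPods-unique : ∀ k n → Unique (boundedPods k n)
  boundedPods-unique k n = filter⁺ (All.all? (_≤? k)) (podPartitions-unique n)

  podCount-full : ∀ {k n} → n ≤ k → podCount k n ≡ pod n
  podCount-full {k} {n} n≤k =
    length-≡-set (boundedPods-unique k n) (podPartitions-unique n)
      (λ {ps} ps∈ → Equivalence.from (∈-podPartitions n ps) (BoundedPod.isPod (∈-boundedPods⁻ k n ps∈)))
      (λ {ps} ps∈ → ∈-boundedPods⁺ k n (full (Equivalence.to (∈-podPartitions n ps) ps∈)))
    where
    full : ∀ {ps} → IsPodPartition n ps → BoundedPod k n ps
    full {ps} pod@(isPodPartition (isPartition _ _ refl) _) =
      boundedPod pod (All.map (λ x≤ → ≤-trans x≤ n≤k) (parts≤sum ps))

  linked-∷⁺ : ∀ {x ps} → All (_≤ x) ps → Linked _≥_ ps → Linked _≥_ (x ∷ ps)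
  linked-∷⁺ []        []  = [-]
  linked-∷⁺ (p ∷ _)   [-] = p ∷ [-]
  linked-∷⁺ (p ∷ _) (l ∷ ls) = p ∷ l ∷ ls

  linked-∷⁻ : ∀ {x ps} → Linked _≥_ (x ∷ ps) → All (_≤ x) ps × Linked _≥_ ps
  linked-∷⁻ l with Linked.Linked⇒AllPairs (λ a b → ≤-trans b a) l
  ... | all≤ ∷ _ = all≤ , Linked.tail l

  tighten : ∀ {k x} → x ≤ suc k → ¬ x ≡ suc k → x ≤ k
  tighten x≤ x≢ = s≤s⁻¹ (≤∧≢⇒< x≤ x≢)

  -- Removing one part k+1 from a pod partition with largest part k+1 leaves parts at most j.
  record Removal (k j : ℕ) : Set where
    field
      insert : ∀ {n ps} → BoundedPod j n ps → BoundedPod (suc k) (suc k + n) (suc k ∷ ps)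
      remove : ∀ {n ps} → BoundedPod (suc k) n (suc k ∷ ps) → BoundedPod j (n ∸ suc k) ps

  all-pred : ∀ {k x n ps} → ¬ x ≡ suc k → BoundedPod (suc k) n (x ∷ ps) → BoundedPod k n (x ∷ ps)
  all-pred x≢ (boundedPod pod@(isPodPartition (isPartition dec _ _) _) (x≤ ∷ _)) =
    boundedPod pod (tighten x≤ x≢ ∷ All.map (λ y≤x → ≤-trans y≤x (tighten x≤ x≢)) (proj₁ (linked-∷⁻ dec)))

  weaken : ∀ {k n ps} → BoundedPod k n ps → BoundedPod (suc k) n ps
  weaken (boundedPod pod all≤) = boundedPod pod (All.map m≤n⇒m≤1+n all≤)

  podCount-small : ∀ {k n} → n < suc k → podCount (suc k) n ≡ podCount k n
  podCount-small n<k = trans (podCount-full (<⇒≤ n<k)) (sym (podCount-full (s≤s⁻¹ n<k)))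

  -- Since parts decrease, a partition with parts at most k+1 either starts with k+1 or has all its
  -- parts at most k. What may follow a leading k+1 is described by `j`.
  podCount-remove : ∀ {k j} → Removal k j → ∀ n →
                    podCount (suc k) (suc k + n) ≡ podCount k (suc k + n) + podCount j n
  podCount-remove {k} {j} R n = begin
    podCount (suc k) (suc k + n)
      ≡⟨ length-≡-set (boundedPods-unique (suc k) (suc k + n))
           (++⁺ (boundedPods-unique k (suc k + n)) (map⁺ ∷-injectiveʳ (boundedPods-unique j n)) disjoint)
           to from ⟩
    length (boundedPods k (suc k + n) ++ map (suc k ∷_) (boundedPods j n))
      ≡⟨ length-++ (boundedPods k (suc k + n)) ⟩
    podCount k (suc k + n) + length (map (suc k ∷_) (boundedPods j n))
      ≡⟨ cong (podCount k (suc k + n) +_) (length-map (suc k ∷_) (boundedPods j n)) ⟩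
    podCount k (suc k + n) + podCount j n ∎
    where
    open ≡-Reasoning
    open Removal R
    disjoint : ∀ {ps} → ¬ (ps ∈ boundedPods k (suc k + n) × ps ∈ map (suc k ∷_) (boundedPods j n))
    disjoint (ps∈ , ps∈′) with ∈-map⁻ (suc k ∷_) ps∈′
    ... | _ , _ , refl with ∈-boundedPods⁻ k (suc k + n) ps∈
    ...   | boundedPod _ (k<k ∷ _) = 1+n≰n k<k
    to : ∀ {ps} → ps ∈ boundedPods (suc k) (suc k + n) →
         ps ∈ boundedPods k (suc k + n) ++ map (suc k ∷_) (boundedPods j n)
    to {ps} ps∈ with ps | ∈-boundedPods⁻ (suc k) (suc k + n) ps∈
    ... | [] | boundedPod (isPodPartition (isPartition _ _ ()) _) _
    ... | x ∷ qs | b with x ≟ suc k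
    ...   | no x≢ = ∈-++⁺ˡ (∈-boundedPods⁺ k (suc k + n) (all-pred x≢ b))
    ...   | yes refl = ∈-++⁺ʳ (boundedPods k (suc k + n))
              (∈-map⁺ (suc k ∷_) (∈-boundedPods⁺ j n (subst (λ m → BoundedPod j m qs) (m+n∸m≡n (suc k) n) (remove b))))
    from : ∀ {ps} → ps ∈ boundedPods k (suc k + n) ++ map (suc k ∷_) (boundedPods j n) →
           ps ∈ boundedPods (suc k) (suc k + n)
    from ps∈ with ∈-++⁻ (boundedPods k (suc k + n)) ps∈
    ... | inj₁ ps∈₁ = ∈-boundedPods⁺ (suc k) (suc k + n) (weaken (∈-boundedPods⁻ k (suc k + n) ps∈₁))
    ... | inj₂ ps∈₂ with ∈-map⁻ (suc k ∷_) ps∈₂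
    ...   | _ , qs∈ , refl = ∈-boundedPods⁺ (suc k) (suc k + n) (insert (∈-boundedPods⁻ j n qs∈))

  -- An even part may occur again, so the bound on the remaining parts stays at k+1; for an odd part
  -- it drops to k.
  removal-even : ∀ {k} → ¬ Odd (suc k) → Removal k (suc k)
  removal-even {k} ¬odd = record { insert = insert ; remove = remove }
    where
    insert : ∀ {n ps} → BoundedPod (suc k) n ps → BoundedPod (suc k) (suc k + n) (suc k ∷ ps)
    insert {ps = ps} (boundedPod (isPodPartition (isPartition dec pos s) u) all≤) =
      boundedPod (isPodPartition (isPartition (linked-∷⁺ all≤ dec) (z<s ∷ pos) (cong (suc k +_) s))
        (subst Unique (sym (filter-reject odd? {xs = ps} ¬odd)) u)) (≤-refl ∷ all≤)
    remove : ∀ {n ps} → BoundedPod (suc k) n (suc k ∷ ps) → BoundedPod (suc k) (n ∸ suc k) ps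
    remove {ps = ps} (boundedPod (isPodPartition (isPartition dec (_ ∷ pos) refl) u) (_ ∷ all≤)) =
      boundedPod (isPodPartition (isPartition (proj₂ (linked-∷⁻ dec)) pos (sym (m+n∸m≡n (suc k) (sum ps))))
        (subst Unique (filter-reject odd? {xs = ps} ¬odd) u)) all≤

  removal-odd : ∀ {k} → Odd (suc k) → Removal k k
  removal-odd {k} odd = record { insert = insert ; remove = remove }
    where
    insert : ∀ {n ps} → BoundedPod k n ps → BoundedPod (suc k) (suc k + n) (suc k ∷ ps)
    insert {ps = ps} b@(boundedPod (isPodPartition (isPartition dec pos s) u) all≤) =
      boundedPod (isPodPartition (isPartition (linked-∷⁺ all≤′ dec) (z<s ∷ pos) (cong (suc k +_) s))
        (subst Unique (sym (filter-accept odd? {xs = ps} odd)) (All.tabulate fresh ∷ u)))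
        (≤-refl ∷ all≤′)
      where
      all≤′ : All (_≤ suc k) ps
      all≤′ = BoundedPod.bounded (weaken b)
      fresh : ∀ {x} → x ∈ filter odd? ps → ¬ suc k ≡ x
      fresh x∈ refl = 1+n≰n (All.lookup all≤ (proj₁ (∈-filter⁻ odd? {xs = ps} x∈)))
    remove : ∀ {n ps} → BoundedPod (suc k) n (suc k ∷ ps) → BoundedPod k (n ∸ suc k) ps
    remove {ps = ps} (boundedPod (isPodPartition (isPartition dec (_ ∷ pos) refl) u) (_ ∷ all≤))
      with subst Unique (filter-accept odd? {xs = ps} odd) u
    ... | fresh ∷ u′ =
      boundedPod (isPodPartition (isPartition (proj₂ (linked-∷⁻ dec)) pos (sym (m+n∸m≡n (suc k) (sum ps)))) u′)
        (All.tabulate λ {x} x∈ → tighten (All.lookup all≤ x∈)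
          λ { refl → All.lookup fresh (∈-filter⁺ odd? x∈ odd) refl })

-- Triangular numbers modulo 5 and multiplication by 2 + i.

module Theta where

  open Counting
  open IntegerPrimes
  open import Data.Integer.Base as ℤ using (ℤ; +_; -[1+_]; -_; _-_)
  import Data.Integer.Divisibility.Signed as ℤ
  import Data.Integer.Properties as ℤ
  open import Data.Integer.Tactic.RingSolver using (solve-∀)
  open import Data.Nat.Base using (_+_; _*_; _≤_; _<_; _%_; _/_)
  open import Data.Nat.DivMod using (m≡m%n+[m/n]*n; [m+kn]%n≡m%n; %-distribˡ-+)
  open import Data.Nat.Properties
  import Data.Nat.Tactic.RingSolver as ℕ
  open import Data.Product.Base using (_×_)
  open import Relation.Binary.PropositionalEquality

  -- Recursive, so that `double (suc n)` exposes two successors: the next odd part and the next even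
  -- part, or two changes of sign.
  double : ℕ → ℕ
  double zero    = zero
  double (suc n) = suc (suc (double n))

  double-even : ∀ n → double n ≡ n * 2
  double-even zero    = refl
  double-even (suc n) = cong (λ m → 2 + m) (double-even n)

  -- 2k² + k, which runs through the triangular numbers as k runs through ℤ.
  triangle : ℤ → ℕ
  triangle (+ m)    = m * suc (double m)
  triangle -[1+ m ] = suc m * suc (double m)

  triangle-ℤ : ∀ k → + triangle k ≡ k ℤ.* (+ 2 ℤ.* k ℤ.+ + 1)
  triangle-ℤ (+ m) rewrite double-even m = begin
    + (m * suc (m * 2))         ≡⟨ ℤ.pos-* m (suc (m * 2)) ⟩
    + m ℤ.* + (1 + m * 2)       ≡⟨ cong (λ x → + m ℤ.* (+ 1 ℤ.+ x)) (ℤ.pos-* m 2) ⟩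
    + m ℤ.* (+ 1 ℤ.+ + m ℤ.* + 2) ≡⟨ expand (+ m) ⟩
    + m ℤ.* (+ 2 ℤ.* + m ℤ.+ + 1) ∎
    where
    open ≡-Reasoning
    expand : ∀ m → m ℤ.* (+ 1 ℤ.+ m ℤ.* + 2) ≡ m ℤ.* (+ 2 ℤ.* m ℤ.+ + 1)
    expand = solve-∀
  triangle-ℤ -[1+ m ] rewrite double-even m = begin
    + (suc m * suc (m * 2))               ≡⟨ ℤ.pos-* (suc m) (suc (m * 2)) ⟩
    (+ 1 ℤ.+ + m) ℤ.* + (1 + m * 2)       ≡⟨ cong (λ x → (+ 1 ℤ.+ + m) ℤ.* (+ 1 ℤ.+ x)) (ℤ.pos-* m 2) ⟩
    (+ 1 ℤ.+ + m) ℤ.* (+ 1 ℤ.+ + m ℤ.* + 2) ≡⟨ expand (+ m) ⟩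
    - (+ 1 ℤ.+ + m) ℤ.* (+ 2 ℤ.* - (+ 1 ℤ.+ + m) ℤ.+ + 1) ∎
    where
    open ≡-Reasoning
    expand : ∀ m → (+ 1 ℤ.+ m) ℤ.* (+ 1 ℤ.+ m ℤ.* + 2) ≡ - (+ 1 ℤ.+ m) ℤ.* (+ 2 ℤ.* - (+ 1 ℤ.+ m) ℤ.+ + 1)
    expand = solve-∀

  triangle-residue : ∀ k → triangle k % 5 ≡ 0 ⊎ triangle k % 5 ≡ 1 ⊎ triangle k % 5 ≡ 3
  triangle-residue (+ m) = go m
    where
    step : ∀ m → (5 + m) * suc (10 + double m) % 5 ≡ m * suc (double m) % 5
    step m rewrite double-even m =
      trans (cong (_% 5) (expand m)) ([m+kn]%n≡m%n (m * suc (m * 2)) (4 * m + 11) 5)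
      where
      expand : ∀ m → (5 + m) * suc (10 + m * 2) ≡ m * suc (m * 2) + (4 * m + 11) * 5
      expand = ℕ.solve-∀
    go : ∀ m → let r = m * suc (double m) % 5 in r ≡ 0 ⊎ r ≡ 1 ⊎ r ≡ 3
    go 0 = inj₁ refl
    go 1 = inj₂ (inj₂ refl)
    go 2 = inj₁ refl
    go 3 = inj₂ (inj₁ refl)
    go 4 = inj₂ (inj₁ refl)
    go (suc (suc (suc (suc (suc m))))) rewrite step m = go m
  triangle-residue -[1+ m ] = go m
    where
    step : ∀ m → (6 + m) * suc (10 + double m) % 5 ≡ suc m * suc (double m) % 5
    step m rewrite double-even m =
      trans (cong (_% 5) (expand m)) ([m+kn]%n≡m%n (suc m * suc (m * 2)) (4 * m + 13) 5)
      where
      expand : ∀ m → (6 + m) * suc (10 + m * 2) ≡ suc m * suc (m * 2) + (4 * m + 13) * 5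
      expand = ℕ.solve-∀
    go : ∀ m → let r = suc m * suc (double m) % 5 in r ≡ 0 ⊎ r ≡ 1 ⊎ r ≡ 3
    go 0 = inj₂ (inj₁ refl)
    go 1 = inj₂ (inj₁ refl)
    go 2 = inj₁ refl
    go 3 = inj₂ (inj₂ refl)
    go 4 = inj₁ refl
    go (suc (suc (suc (suc (suc m))))) rewrite step m = go m

  -- The integers from -n to n-1. On them `triangle` takes the first 2n triangular numbers, since
  -- `+ m` and `-[1+ m ]` give those with indices 2m and 2m+1.
  window : ℕ → List ℤ
  window zero    = []
  window (suc n) = + n ∷ -[1+ n ] ∷ window n

  radius : ℤ → ℕ
  radius (+ m)    = m
  radius -[1+ m ] = m

  ∈-window⁻ : ∀ n {k} → k ∈ window n → radius k < n
  ∈-window⁻ (suc n) (here refl)         = n<1+n n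
  ∈-window⁻ (suc n) (there (here refl)) = n<1+n n
  ∈-window⁻ (suc n) (there (there k∈))  = m<n⇒m<1+n (∈-window⁻ n k∈)

  ∈-window⁺ : ∀ n k → radius k < n → k ∈ window n
  ∈-window⁺ (suc n) k (s≤s r≤n) with m≤n⇒m<n∨m≡n r≤n
  ∈-window⁺ (suc n) k        _ | inj₁ r<n  = there (there (∈-window⁺ n k r<n))
  ∈-window⁺ (suc n) (+ _)    _ | inj₂ refl = here refl
  ∈-window⁺ (suc n) -[1+ _ ] _ | inj₂ refl = there (here refl)

  window-unique : ∀ n → Unique (window n)
  window-unique zero    = []
  window-unique (suc n) = ((λ ()) ∷ All.tabulate λ { k∈ refl → <-irrefl refl (∈-window⁻ n k∈) })
                        ∷ (All.tabulate λ { k∈ refl → <-irrefl refl (∈-window⁻ n k∈) })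
                        ∷ window-unique n

  radius≤triangle : ∀ k → radius k ≤ triangle k
  radius≤triangle (+ m)    = m≤m*n m (suc (double m))
  radius≤triangle -[1+ m ] = ≤-trans (n≤1+n m) (m≤m*n (suc m) (suc (double m)))

  triangle<⇒∈-window : ∀ n k → triangle k < n → k ∈ window n
  triangle<⇒∈-window n k t<n = ∈-window⁺ n k (≤-<-trans (radius≤triangle k) t<n)

  residueClass : ℕ → ℕ → List ℤ
  residueClass r M = filter (λ k → triangle k % 5 ≟ r) (window M)

  triangle/5 : ℤ → ℕ
  triangle/5 k = triangle k / 5

  -- The bound puts every integer whose triangular number is at most 5n+1 into `window M`, so the
  -- lists below count solutions over all of ℤ.
  module _ {M n : ℕ} (bound : 1 + n * 5 < M) where

    private
      Pair : Set
      Pair = ℤ × ℤ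

      weight weight₁ weight₃ : Pair → ℕ
      weight  (k , l) = triangle k + triangle l
      weight₁ (u , v) = triangle/5 u + triangle/5 v
      weight₃ (u , v) = 1 + (triangle/5 u + triangle/5 v)

      pairs pairs₁ pairs₃ : List Pair
      pairs  = filter (λ x → weight  x ≟ n) (cartesianProduct (window M) (window M))
      pairs₁ = filter (λ x → weight₁ x ≟ n) (cartesianProduct (residueClass 0 M) (residueClass 1 M))
      pairs₃ = filter (λ x → weight₃ x ≟ n) (cartesianProduct (residueClass 3 M) (residueClass 3 M))

      ∈-pairs⁺ : ∀ k l → triangle k + triangle l ≡ n → (k , l) ∈ pairs
      ∈-pairs⁺ k l e = ∈-filter⁺ (λ x → weight x ≟ n)
        (∈-cartesianProduct⁺ (inside k (≤-trans (m≤m+n _ (triangle l)) (≤-reflexive e)))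
                             (inside l (≤-trans (m≤n+m _ (triangle k)) (≤-reflexive e)))) e
        where
        inside : ∀ k → triangle k ≤ n → k ∈ window M
        inside k t≤n = triangle<⇒∈-window M k
          (≤-<-trans t≤n (≤-<-trans (≤-trans (m≤m*n n 5) (n≤1+n (n * 5))) bound))

      ∈-pairs⁻ : ∀ {k l} → (k , l) ∈ pairs → triangle k + triangle l ≡ n
      ∈-pairs⁻ kl∈ = proj₂ (∈-filter⁻ (λ x → weight x ≟ n) {xs = cartesianProduct (window M) (window M)} kl∈)

      -- Up to order, 0 + 1 and 3 + 3 are the only ways to reach 1 modulo 5 from the residues 0, 1,
      -- 3.
      data Classes (u v : ℤ) : Set where
        zero-one    : triangle u % 5 ≡ 0 → triangle v % 5 ≡ 1 → Classes u v
        three-three : triangle u % 5 ≡ 3 → triangle v % 5 ≡ 3 → Classes u v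

      ∈-class : ∀ r u → triangle u ≤ 1 + n * 5 → triangle u % 5 ≡ r → u ∈ residueClass r M
      ∈-class r u t≤ e = ∈-filter⁺ (λ k → triangle k % 5 ≟ r) (triangle<⇒∈-window M u (≤-<-trans t≤ bound)) e

      class⁻ : ∀ r {u} → u ∈ residueClass r M → triangle u % 5 ≡ r
      class⁻ r u∈ = proj₂ (∈-filter⁻ (λ k → triangle k % 5 ≟ r) {xs = window M} u∈)

      split : ∀ r u → triangle u % 5 ≡ r → triangle u ≡ r + triangle/5 u * 5
      split r u e = trans (m≡m%n+[m/n]*n (triangle u) 5) (cong (_+ triangle/5 u * 5) e)

      -- With residues r and s such that r + s = 5c + 1, the equation T + T′ = 5n + 1 between
      -- triangular numbers becomes c + ⌊T/5⌋ + ⌊T′/5⌋ = n.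
      residues-sum : ∀ c r s u v → r + s ≡ 1 + c * 5 → triangle u % 5 ≡ r → triangle v % 5 ≡ s →
                     triangle u + triangle v ≡ 1 + (c + (triangle/5 u + triangle/5 v)) * 5
      residues-sum c r s u v e p q = begin
        triangle u + triangle v                                ≡⟨ cong₂ _+_ (split r u p) (split s v q) ⟩
        (r + triangle/5 u * 5) + (s + triangle/5 v * 5)        ≡⟨ regroup r s (triangle/5 u) (triangle/5 v) ⟩
        (r + s) + (triangle/5 u + triangle/5 v) * 5            ≡⟨ cong (_+ (triangle/5 u + triangle/5 v) * 5) e ⟩
        (1 + c * 5) + (triangle/5 u + triangle/5 v) * 5        ≡⟨ collect c (triangle/5 u + triangle/5 v) ⟩
        1 + (c + (triangle/5 u + triangle/5 v)) * 5            ∎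
        where
        open ≡-Reasoning
        regroup : ∀ r s a b → (r + a * 5) + (s + b * 5) ≡ (r + s) + (a + b) * 5
        regroup = ℕ.solve-∀
        collect : ∀ c x → (1 + c * 5) + x * 5 ≡ 1 + (c + x) * 5
        collect = ℕ.solve-∀

      descend : ∀ c r s u v → r + s ≡ 1 + c * 5 → triangle u % 5 ≡ r → triangle v % 5 ≡ s →
                triangle u + triangle v ≡ 1 + n * 5 → c + (triangle/5 u + triangle/5 v) ≡ n
      descend c r s u v e p q f =
        *-cancelʳ-≡ _ n 5 (suc-injective (trans (sym (residues-sum c r s u v e p q)) f))

      ∈-classes : ∀ r s u v → triangle u + triangle v ≡ 1 + n * 5 → triangle u % 5 ≡ r → triangle v % 5 ≡ s →
                  (u , v) ∈ cartesianProduct (residueClass r M) (residueClass s M)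
      ∈-classes r s u v e p q = ∈-cartesianProduct⁺
        (∈-class r u (≤-trans (m≤m+n _ (triangle v)) (≤-reflexive e)) p)
        (∈-class s v (≤-trans (m≤n+m _ (triangle u)) (≤-reflexive e)) q)

      ∈-targets⁺ : ∀ {u v} → triangle u + triangle v ≡ 1 + n * 5 → Classes u v → (u , v) ∈ pairs₁ ++ pairs₃
      ∈-targets⁺ {u} {v} e (zero-one p q) =
        ∈-++⁺ˡ (∈-filter⁺ (λ x → weight₁ x ≟ n) (∈-classes 0 1 u v e p q) (descend 0 0 1 u v refl p q e))
      ∈-targets⁺ {u} {v} e (three-three p q) =
        ∈-++⁺ʳ pairs₁ (∈-filter⁺ (λ x → weight₃ x ≟ n) (∈-classes 3 3 u v e p q) (descend 1 3 3 u v refl p q e))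

      Target : ℕ → ℕ → ℤ → ℤ → Set
      Target r s u v = triangle u + triangle v ≡ 1 + n * 5 × triangle u % 5 ≡ r × triangle v % 5 ≡ s

      target : ∀ c r s {u v} → r + s ≡ 1 + c * 5 → c + (triangle/5 u + triangle/5 v) ≡ n →
               (u , v) ∈ cartesianProduct (residueClass r M) (residueClass s M) → Target r s u v
      target c r s {u} {v} e f uv∈ =
        let u∈ , v∈ = ∈-cartesianProduct⁻ (residueClass r M) (residueClass s M) uv∈
        in trans (residues-sum c r s u v e (class⁻ r u∈) (class⁻ s v∈)) (cong (λ m → 1 + m * 5) f) , class⁻ r u∈ , class⁻ s v∈

      ∈-pairs₁⁻ : ∀ {u v} → (u , v) ∈ pairs₁ → Target 0 1 u v
      ∈-pairs₁⁻ uv∈ =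
        let uv∈′ , e = ∈-filter⁻ (λ x → weight₁ x ≟ n) {xs = cartesianProduct (residueClass 0 M) (residueClass 1 M)} uv∈
        in target 0 0 1 refl e uv∈′

      ∈-pairs₃⁻ : ∀ {u v} → (u , v) ∈ pairs₃ → Target 3 3 u v
      ∈-pairs₃⁻ uv∈ =
        let uv∈′ , e = ∈-filter⁻ (λ x → weight₃ x ≟ n) {xs = cartesianProduct (residueClass 3 M) (residueClass 3 M)} uv∈
        in target 1 3 3 refl e uv∈′

      targets-unique : Unique (pairs₁ ++ pairs₃)
      targets-unique = ++⁺
        (filter⁺ (λ x → weight₁ x ≟ n) (cartesianProduct⁺ (class-unique 0) (class-unique 1)))
        (filter⁺ (λ x → weight₃ x ≟ n) (cartesianProduct⁺ (class-unique 3) (class-unique 3)))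
        (λ {x} → disjoint {x})
        where
        class-unique : ∀ r → Unique (residueClass r M)
        class-unique r = filter⁺ (λ k → triangle k % 5 ≟ r) (window-unique M)
        disjoint : ∀ {x} → ¬ (x ∈ pairs₁ × x ∈ pairs₃)
        disjoint (x∈₁ , x∈₃) with trans (sym (proj₁ (proj₂ (∈-pairs₁⁻ x∈₁)))) (proj₁ (proj₂ (∈-pairs₃⁻ x∈₃)))
        ... | ()

      module SumResidue (u v : ℤ) (e : triangle u + triangle v ≡ 1 + n * 5) where
        sum-residue : ∀ {r s} → triangle u % 5 ≡ r → triangle v % 5 ≡ s → (r + s) % 5 ≡ 1
        sum-residue {r} {s} p q = begin
          (r + s) % 5                                     ≡⟨ cong₂ (λ x y → (x + y) % 5) p q ⟨
          (triangle u % 5 + triangle v % 5) % 5           ≡⟨ %-distribˡ-+ (triangle u) (triangle v) 5 ⟨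
          (triangle u + triangle v) % 5                   ≡⟨ cong (_% 5) e ⟩
          (1 + n * 5) % 5                                 ≡⟨ [m+kn]%n≡m%n 1 n 5 ⟩
          1                                               ∎
          where open ≡-Reasoning

      classes : ∀ u v → triangle u + triangle v ≡ 1 + n * 5 → Classes u v ⊎ Classes v u
      classes u v e with triangle-residue u | triangle-residue v
      ... | inj₁ p        | inj₂ (inj₁ q) = inj₁ (zero-one p q)
      ... | inj₂ (inj₁ p) | inj₁ q        = inj₂ (zero-one q p)
      ... | inj₂ (inj₂ p) | inj₂ (inj₂ q) = inj₁ (three-three p q)
      ... | inj₁ p        | inj₁ q        = contradiction (sum-residue p q) λ ()
        where open SumResidue u v e
      ... | inj₁ p        | inj₂ (inj₂ q) = contradiction (sum-residue p q) λ ()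
        where open SumResidue u v e
      ... | inj₂ (inj₁ p) | inj₂ (inj₁ q) = contradiction (sum-residue p q) λ ()
        where open SumResidue u v e
      ... | inj₂ (inj₁ p) | inj₂ (inj₂ q) = contradiction (sum-residue p q) λ ()
        where open SumResidue u v e
      ... | inj₂ (inj₂ p) | inj₁ q        = contradiction (sum-residue p q) λ ()
        where open SumResidue u v e
      ... | inj₂ (inj₂ p) | inj₂ (inj₁ q) = contradiction (sum-residue p q) λ ()
        where open SumResidue u v e

      -- Multiplication of (4k+1) + (4l+1)i by 2 + i, up to conjugation.
      rotate : Pair → Pair
      rotate (k , l) = + 2 ℤ.* k - l , - k - + 2 ℤ.* l - + 1

      rotate-weight : ∀ k l → weight (rotate (k , l)) ≡ 1 + weight (k , l) * 5
      rotate-weight k l = ℤ.+-injective (begin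
        + (triangle u + triangle v)
          ≡⟨ cong₂ ℤ._+_ (triangle-ℤ u) (triangle-ℤ v) ⟩
        u ℤ.* (+ 2 ℤ.* u ℤ.+ + 1) ℤ.+ v ℤ.* (+ 2 ℤ.* v ℤ.+ + 1)
          ≡⟨ expand k l ⟩
        + 1 ℤ.+ (k ℤ.* (+ 2 ℤ.* k ℤ.+ + 1) ℤ.+ l ℤ.* (+ 2 ℤ.* l ℤ.+ + 1)) ℤ.* + 5
          ≡⟨ cong (λ x → + 1 ℤ.+ x ℤ.* + 5) (cong₂ ℤ._+_ (triangle-ℤ k) (triangle-ℤ l)) ⟨
        + 1 ℤ.+ + (triangle k + triangle l) ℤ.* + 5
          ≡⟨ cong (λ x → + 1 ℤ.+ x) (ℤ.pos-* (triangle k + triangle l) 5) ⟨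
        + (1 + (triangle k + triangle l) * 5) ∎)
        where
        open ≡-Reasoning
        u v : ℤ
        u = + 2 ℤ.* k - l
        v = - k - + 2 ℤ.* l - + 1
        expand : ∀ k l → (+ 2 ℤ.* k - l) ℤ.* (+ 2 ℤ.* (+ 2 ℤ.* k - l) ℤ.+ + 1) ℤ.+
                         (- k - + 2 ℤ.* l - + 1) ℤ.* (+ 2 ℤ.* (- k - + 2 ℤ.* l - + 1) ℤ.+ + 1) ≡
                         + 1 ℤ.+ (k ℤ.* (+ 2 ℤ.* k ℤ.+ + 1) ℤ.+ l ℤ.* (+ 2 ℤ.* l ℤ.+ + 1)) ℤ.* + 5
        expand = solve-∀

      rotate-∈ : ∀ k l → (k , l) ∈ pairs → weight (rotate (k , l)) ≡ 1 + n * 5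
      rotate-∈ k l kl∈ = trans (rotate-weight k l) (cong (λ m → 1 + m * 5) (∈-pairs⁻ kl∈))

      -- Solving u = 2k - l and v = -k - 2l - 1 gives 5k = 2u - v - 1 and l = 2k - u. Thus
      -- divisibility of 2u - v - 1 by 5 decides whether (u , v) lies in the image of `rotate`.
      unrotate : ∀ u v q → + 2 ℤ.* u - v - + 1 ≡ q ℤ.* + 5 → rotate (q , + 2 ℤ.* q - u) ≡ (u , v)
      unrotate u v q e = cong₂ _,_ (first q u) (begin
        - q - + 2 ℤ.* (+ 2 ℤ.* q - u) - + 1       ≡⟨ second q u ⟩
        + 2 ℤ.* u - + 1 - q ℤ.* + 5               ≡⟨ cong (λ x → + 2 ℤ.* u - + 1 - x) e ⟨
        + 2 ℤ.* u - + 1 - (+ 2 ℤ.* u - v - + 1)   ≡⟨ third u v ⟩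
        v                                         ∎)
        where
        open ≡-Reasoning
        first : ∀ q u → + 2 ℤ.* q - (+ 2 ℤ.* q - u) ≡ u
        first = solve-∀
        second : ∀ q u → - q - + 2 ℤ.* (+ 2 ℤ.* q - u) - + 1 ≡ + 2 ℤ.* u - + 1 - q ℤ.* + 5
        second = solve-∀
        third : ∀ u v → + 2 ℤ.* u - + 1 - (+ 2 ℤ.* u - v - + 1) ≡ v
        third = solve-∀

      unrotate-∈ : ∀ u v q → + 2 ℤ.* u - v - + 1 ≡ q ℤ.* + 5 → triangle u + triangle v ≡ 1 + n * 5 →
                   (q , + 2 ℤ.* q - u) ∈ pairs
      unrotate-∈ u v q e s = ∈-pairs⁺ q (+ 2 ℤ.* q - u) (*-cancelʳ-≡ _ n 5 (suc-injective
        (trans (sym (rotate-weight q (+ 2 ℤ.* q - u))) (trans (cong weight (unrotate u v q e)) s))))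

      rotate-∣ : ∀ k l → + 2 ℤ.* proj₁ (rotate (k , l)) - proj₂ (rotate (k , l)) - + 1 ≡ k ℤ.* + 5
      rotate-∣ k l = expand k l
        where
        expand : ∀ k l → + 2 ℤ.* (+ 2 ℤ.* k - l) - (- k - + 2 ℤ.* l - + 1) - + 1 ≡ k ℤ.* + 5
        expand = solve-∀

      rotate-injective : ∀ {x y} → rotate x ≡ rotate y → x ≡ y
      rotate-injective {k , l} {k′ , l′} e = cong₂ _,_ k≡k′ (begin
        l                                     ≡⟨ second k l ⟨
        + 2 ℤ.* k - proj₁ (rotate (k , l))    ≡⟨ cong₂ (λ x z → + 2 ℤ.* x - proj₁ z) k≡k′ e ⟩
        + 2 ℤ.* k′ - proj₁ (rotate (k′ , l′)) ≡⟨ second k′ l′ ⟩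
        l′                                    ∎)
        where
        open ≡-Reasoning
        k≡k′ : k ≡ k′
        k≡k′ = ℤ.*-cancelʳ-≡ k k′ (+ 5) (trans (sym (rotate-∣ k l))
          (trans (cong (λ z → + 2 ℤ.* proj₁ z - proj₂ z - + 1) e) (rotate-∣ k′ l′)))
        second : ∀ k l → + 2 ℤ.* k - (+ 2 ℤ.* k - l) ≡ l
        second = solve-∀

      prime5 : Prime 5
      prime5 = toWitness {a? = prime? 5} _

      -- The two factors are ±(x − 2y) and ±(y − 2x) for x = 4u+1 and y = 4v+1, and 5 divides x² + y².
      one-factor : ∀ u v → triangle u + triangle v ≡ 1 + n * 5 →
                   + 5 ℤ.∣ + 2 ℤ.* u - v - + 1 ⊎ + 5 ℤ.∣ + 2 ℤ.* v - u - + 1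
      one-factor u v e = euclidsLemmaℤ prime5 _ _ (ℤ.divides (u ℤ.* v - + n) (begin
        (+ 2 ℤ.* u - v - + 1) ℤ.* (+ 2 ℤ.* v - u - + 1)
          ≡⟨ expand u v ⟩
        u ℤ.* v ℤ.* + 5 - (u ℤ.* (+ 2 ℤ.* u ℤ.+ + 1) ℤ.+ v ℤ.* (+ 2 ℤ.* v ℤ.+ + 1)) ℤ.+ + 1
          ≡⟨ cong (λ x → u ℤ.* v ℤ.* + 5 - x ℤ.+ + 1) (cong₂ ℤ._+_ (triangle-ℤ u) (triangle-ℤ v)) ⟨
        u ℤ.* v ℤ.* + 5 - + (triangle u + triangle v) ℤ.+ + 1
          ≡⟨ cong (λ x → u ℤ.* v ℤ.* + 5 - x ℤ.+ + 1) (trans (cong +_ e) (cong (λ x → + 1 ℤ.+ x) (ℤ.pos-* n 5))) ⟩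
        u ℤ.* v ℤ.* + 5 - (+ 1 ℤ.+ + n ℤ.* + 5) ℤ.+ + 1
          ≡⟨ collect u v (+ n) ⟩
        (u ℤ.* v - + n) ℤ.* + 5 ∎))
        where
        open ≡-Reasoning
        expand : ∀ u v → (+ 2 ℤ.* u - v - + 1) ℤ.* (+ 2 ℤ.* v - u - + 1) ≡
                 u ℤ.* v ℤ.* + 5 - (u ℤ.* (+ 2 ℤ.* u ℤ.+ + 1) ℤ.+ v ℤ.* (+ 2 ℤ.* v ℤ.+ + 1)) ℤ.+ + 1
        expand = solve-∀
        collect : ∀ u v n → u ℤ.* v ℤ.* + 5 - (+ 1 ℤ.+ n ℤ.* + 5) ℤ.+ + 1 ≡ (u ℤ.* v - n) ℤ.* + 5
        collect = solve-∀

      split-ℤ : ∀ r u → triangle u % 5 ≡ r → u ℤ.* (+ 2 ℤ.* u ℤ.+ + 1) ≡ + r ℤ.+ + triangle/5 u ℤ.* + 5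
      split-ℤ r u e = begin
        u ℤ.* (+ 2 ℤ.* u ℤ.+ + 1)       ≡⟨ triangle-ℤ u ⟨
        + triangle u                    ≡⟨ cong +_ (split r u e) ⟩
        + (r + triangle/5 u * 5)        ≡⟨ cong (λ x → + r ℤ.+ x) (ℤ.pos-* (triangle/5 u) 5) ⟩
        + r ℤ.+ + triangle/5 u ℤ.* + 5  ∎
        where open ≡-Reasoning

      factored : ∀ u → triangle u % 5 ≡ 3 → (+ 2 ℤ.* u ℤ.+ + 3) ℤ.* (u - + 1) ≡ + triangle/5 u ℤ.* + 5
      factored u e = begin
        (+ 2 ℤ.* u ℤ.+ + 3) ℤ.* (u - + 1)                ≡⟨ factor u ⟩
        u ℤ.* (+ 2 ℤ.* u ℤ.+ + 1) - + 3                  ≡⟨ cong (_- + 3) (split-ℤ 3 u e) ⟩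
        + 3 ℤ.+ + triangle/5 u ℤ.* + 5 - + 3             ≡⟨ cancel (+ triangle/5 u ℤ.* + 5) ⟩
        + triangle/5 u ℤ.* + 5                           ∎
        where
        open ≡-Reasoning
        factor : ∀ u → (+ 2 ℤ.* u ℤ.+ + 3) ℤ.* (u - + 1) ≡ u ℤ.* (+ 2 ℤ.* u ℤ.+ + 1) - + 3
        factor = solve-∀
        cancel : ∀ x → + 3 ℤ.+ x - + 3 ≡ x
        cancel = solve-∀

      -- In 2u² + u - 3 = (2u + 3)(u - 1) the two factors have the same root modulo 5, because 3(2u
      -- + 3) = (u - 1) + 5(u + 2).
      residue-three : ∀ u → triangle u % 5 ≡ 3 → + 5 ℤ.∣ u - + 1
      residue-three u e with euclidsLemmaℤ prime5 (+ 2 ℤ.* u ℤ.+ + 3) (u - + 1) (ℤ.divides (+ triangle/5 u) (factored u e))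
      ... | inj₂ d = d
      ... | inj₁ (ℤ.divides q e′) = ℤ.divides (+ 3 ℤ.* q - u - + 2)
        (trans (combine₁ u) (trans (cong (λ x → + 3 ℤ.* x - (u ℤ.+ + 2) ℤ.* + 5) e′) (combine₂ u q)))
        where
        combine₁ : ∀ u → u - + 1 ≡ + 3 ℤ.* (+ 2 ℤ.* u ℤ.+ + 3) - (u ℤ.+ + 2) ℤ.* + 5
        combine₁ = solve-∀
        combine₂ : ∀ u q → + 3 ℤ.* (q ℤ.* + 5) - (u ℤ.+ + 2) ℤ.* + 5 ≡ (+ 3 ℤ.* q - u - + 2) ℤ.* + 5
        combine₂ = solve-∀

      -- P + 2Q = 3(v - 1), so both divisibilities force v ≡ 1 modulo 5, where 2v² + v ≡ 3. Hence a
      -- pair with residues 0 and 1 cannot lie in the image of `rotate` in both orders.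
      not-both : ∀ u v q q′ → + 2 ℤ.* u - v - + 1 ≡ q ℤ.* + 5 → + 2 ℤ.* v - u - + 1 ≡ q′ ℤ.* + 5 →
                 triangle v % 5 ≢ 1
      not-both u v q q′ e e′ r = contradiction (ℕ.∣⇒≤ (ℤ.∣⇒∣ᵤ 5∣2)) λ { (s≤s (s≤s ())) }
        where
        open ≡-Reasoning
        P Q d : ℤ
        P = + 2 ℤ.* u - v - + 1
        Q = + 2 ℤ.* v - u - + 1
        d = + 2 ℤ.* (q ℤ.+ + 2 ℤ.* q′) - (v - + 1)
        v-1 : v - + 1 ≡ d ℤ.* + 5
        v-1 = begin
          v - + 1                                                ≡⟨ combine₁ u v ⟩
          + 2 ℤ.* (P ℤ.+ + 2 ℤ.* Q) - (v - + 1) ℤ.* + 5          ≡⟨ cong₂ (λ x y → + 2 ℤ.* (x ℤ.+ + 2 ℤ.* y) - (v - + 1) ℤ.* + 5) e e′ ⟩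
          + 2 ℤ.* (q ℤ.* + 5 ℤ.+ + 2 ℤ.* (q′ ℤ.* + 5)) - (v - + 1) ℤ.* + 5 ≡⟨ combine₂ q q′ (v - + 1) ⟩
          d ℤ.* + 5                                              ∎
          where
          combine₁ : ∀ u v → v - + 1 ≡ + 2 ℤ.* ((+ 2 ℤ.* u - v - + 1) ℤ.+ + 2 ℤ.* (+ 2 ℤ.* v - u - + 1)) - (v - + 1) ℤ.* + 5
          combine₁ = solve-∀
          combine₂ : ∀ q q′ x → + 2 ℤ.* (q ℤ.* + 5 ℤ.+ + 2 ℤ.* (q′ ℤ.* + 5)) - x ℤ.* + 5 ≡ (+ 2 ℤ.* (q ℤ.+ + 2 ℤ.* q′) - x) ℤ.* + 5
          combine₂ = solve-∀
        5∣2 : + 5 ℤ.∣ + 2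
        5∣2 = ℤ.divides (+ triangle/5 v - (+ 2 ℤ.* v ℤ.+ + 3) ℤ.* d) (begin
          + 2
            ≡⟨ combine₁ v ⟩
          v ℤ.* (+ 2 ℤ.* v ℤ.+ + 1) - + 1 - (+ 2 ℤ.* v ℤ.+ + 3) ℤ.* (v - + 1)
            ≡⟨ cong₂ (λ x y → x - + 1 - (+ 2 ℤ.* v ℤ.+ + 3) ℤ.* y) (split-ℤ 1 v r) v-1 ⟩
          + 1 ℤ.+ + triangle/5 v ℤ.* + 5 - + 1 - (+ 2 ℤ.* v ℤ.+ + 3) ℤ.* (d ℤ.* + 5)
            ≡⟨ combine₂ (+ triangle/5 v) (+ 2 ℤ.* v ℤ.+ + 3) d ⟩
          (+ triangle/5 v - (+ 2 ℤ.* v ℤ.+ + 3) ℤ.* d) ℤ.* + 5 ∎)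
          where
          combine₁ : ∀ v → + 2 ≡ v ℤ.* (+ 2 ℤ.* v ℤ.+ + 1) - + 1 - (+ 2 ℤ.* v ℤ.+ + 3) ℤ.* (v - + 1)
          combine₁ = solve-∀
          combine₂ : ∀ a b d → + 1 ℤ.+ a ℤ.* + 5 - + 1 - b ℤ.* (d ℤ.* + 5) ≡ (a - b ℤ.* d) ℤ.* + 5
          combine₂ = solve-∀

      -- The image of `rotate` contains exactly one order of each pair with residues 0 and 1, while
      -- the target list fixes the order; swapping reconciles the two. Pairs with residues 3 and 3
      -- lie in the image as they stand.
      orient : Pair → Pair
      orient (u , v) with triangle u % 5 ≟ 1
      ... | yes _ = v , u
      ... | no  _ = u , v

      orient-∈ : ∀ u v → triangle u + triangle v ≡ 1 + n * 5 → orient (u , v) ∈ pairs₁ ++ pairs₃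
      orient-∈ u v e with triangle u % 5 ≟ 1 | classes u v e
      ... | no  _ | inj₁ c                 = ∈-targets⁺ e c
      ... | yes _ | inj₂ c                 = ∈-targets⁺ (trans (+-comm (triangle v) (triangle u)) e) c
      ... | yes r | inj₁ (zero-one p _)    = contradiction (trans (sym p) r) λ ()
      ... | yes r | inj₁ (three-three p _) = contradiction (trans (sym p) r) λ ()
      ... | no ¬r | inj₂ (zero-one _ p)    = contradiction p ¬r
      ... | no  _ | inj₂ (three-three p q) = ∈-targets⁺ e (three-three q p)

      orient-injective : ∀ u v u′ v′ q q′ →
        + 2 ℤ.* u - v - + 1 ≡ q ℤ.* + 5 → + 2 ℤ.* u′ - v′ - + 1 ≡ q′ ℤ.* + 5 →
        orient (u , v) ≡ orient (u′ , v′) → (u , v) ≡ (u′ , v′)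
      orient-injective u v u′ v′ q q′ d d′ with triangle u % 5 ≟ 1 | triangle u′ % 5 ≟ 1
      ... | yes _ | yes _ = λ { refl → refl }
      ... | no  _ | no  _ = λ e → e
      ... | yes r | no  _ = λ { refl → contradiction r (not-both v u q′ q d′ d) }
      ... | no  _ | yes r = λ { refl → contradiction r (not-both u v q q′ d d′) }

      onto : ∀ {y} → y ∈ pairs₁ ++ pairs₃ → ∃ λ x → x ∈ pairs × orient (rotate x) ≡ y
      onto {u , v} y∈ with ∈-++⁻ pairs₁ y∈
      ... | inj₁ y∈₁ with ∈-pairs₁⁻ y∈₁
      ...   | e , p , q with one-factor u v e
      ...     | inj₁ (ℤ.divides c d) = _ , unrotate-∈ u v c d e , trans (cong orient (unrotate u v c d)) kept
        where
        kept : orient (u , v) ≡ (u , v)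
        kept with triangle u % 5 ≟ 1
        ... | yes r = contradiction (trans (sym p) r) λ ()
        ... | no  _ = refl
      ...     | inj₂ (ℤ.divides c d) = _ , unrotate-∈ v u c d (trans (+-comm (triangle v) (triangle u)) e) , trans (cong orient (unrotate v u c d)) swapped
        where
        swapped : orient (v , u) ≡ (u , v)
        swapped with triangle v % 5 ≟ 1
        ... | yes _ = refl
        ... | no ¬r = contradiction q ¬r
      onto {u , v} y∈ | inj₂ y∈₃ with ∈-pairs₃⁻ y∈₃
      ...   | e , p , q with residue-three u p | residue-three v q
      ...     | ℤ.divides a f | ℤ.divides b g = _ , unrotate-∈ u v c d e , trans (cong orient (unrotate u v c d)) kept
        where
        c : ℤ
        c = + 2 ℤ.* a - b
        d : + 2 ℤ.* u - v - + 1 ≡ c ℤ.* + 5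
        d = trans (combine₁ u v) (trans (cong₂ (λ x y → + 2 ℤ.* x - y) f g) (combine₂ a b))
          where
          combine₁ : ∀ u v → + 2 ℤ.* u - v - + 1 ≡ + 2 ℤ.* (u - + 1) - (v - + 1)
          combine₁ = solve-∀
          combine₂ : ∀ a b → + 2 ℤ.* (a ℤ.* + 5) - b ℤ.* + 5 ≡ (+ 2 ℤ.* a - b) ℤ.* + 5
          combine₂ = solve-∀
        kept : orient (u , v) ≡ (u , v)
        kept with triangle u % 5 ≟ 1
        ... | yes r = contradiction (trans (sym p) r) λ ()
        ... | no  _ = refl

    -- In terms of generating functions this is ψ² = AB + qD², where A, B, D are the components of ψ
    -- with residues 0, 1, 3. It is an identity of integers, before any reduction modulo 5.
    pairs-of-triangles : length pairs ≡ length pairs₁ + length pairs₃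
    pairs-of-triangles = trans
      (length-bijection (orient ∘ rotate)
        (filter⁺ (λ x → weight x ≟ n) (cartesianProduct⁺ (window-unique M) (window-unique M)))
        targets-unique
        (λ {(k , l)} kl∈ → orient-∈ _ _ (rotate-∈ k l kl∈))
        (λ {(k , l)} {(k′ , l′)} _ _ e →
          rotate-injective (orient-injective _ _ _ _ k k′ (rotate-∣ k l) (rotate-∣ k′ l′) e))
        onto)
      (length-++ pairs₁)

-- Gauss' identity in the finite form of Shanks.

module PodSeries (K : CommutativeRing 0ℓ 0ℓ) where

  open Counting using (length-≡-set)
  open PodRecurrence
  open Series K
  open Theta
  import Algebra.Properties.CommutativeSemigroup as CommutativeSemigroupProperties
  import Algebra.Properties.Semiring.Mult as Mult
  open import Data.Integer.Base using (+_)
  open import Data.Nat.Divisibility using (divides)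
  open import Data.Nat.Tactic.RingSolver using (solve-∀)
  open import Relation.Binary.PropositionalEquality as ≡ using (_≡_)
  open import Algebra.Properties.Ring (CommutativeRing.ring K) using (-‿distribˡ-*; -‿involutive)

  open CommutativeRing K hiding (_-_; setoid; zero)
  open Mult semiring using (_×_; ×-homo-+)

  sign : ℕ → Carrier
  sign zero    = 1#
  sign (suc n) = - sign n

  sign-double : ∀ m n → sign (double m ℕ.+ n) ≈ sign n
  sign-double zero    n = refl
  sign-double (suc m) n = trans (-‿involutive _) (sign-double m n)

  -- ∏ (1 − q^(2i−1)) / (1 − q^(2i)) over the parts up to k.
  podSeries : ℕ → Series
  podSeries k n = sign n * (podCount k n × 1#)

  podSeries-small : ∀ {k n} → n ℕ.< suc k → podSeries (suc k) n ≈ podSeries k n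
  podSeries-small {k} {n} n<k = reflexive (≡.cong (λ c → sign n * (c × 1#)) (podCount-small n<k))

  podSeries-remove : ∀ {k j} → Removal k j → ∀ n →
    podSeries (suc k) (suc k ℕ.+ n) ≈ podSeries k (suc k ℕ.+ n) + sign (suc k ℕ.+ n) * (podCount j n × 1#)
  podSeries-remove {k} {j} R n = trans
    (reflexive (≡.cong (λ c → sign (suc k ℕ.+ n) * (c × 1#)) (podCount-remove R n)))
    (trans (*-congˡ (×-homo-+ 1# (podCount k (suc k ℕ.+ n)) (podCount j n))) (distribˡ _ _ _))

  -- Multiplication by 1 - q^(2j+1), where the minus sign arises because removal of an odd part
  -- flips `sign`. The negative term stands on the other side, since series are handled as a
  -- semiring.
  podSeries-odd : ∀ j → podSeries (suc (double j)) ⊕ q^ (suc (double j)) ⊛ podSeries (double j) ≋ podSeries (double j)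
  podSeries-odd j .at n with n ℕ.<? suc (double j)
  ... | yes n<k = trans (+-cong (podSeries-small n<k) (q^-⊛-< (suc (double j)) (podSeries (double j)) n<k)) (+-identityʳ _)
  ... | no  n≮k with ℕ.m≤n⇒∃[o]m+o≡n (ℕ.≮⇒≥ n≮k)
  ...   | o , ≡.refl = begin
    podSeries k⁺ (k⁺ ℕ.+ o) + (q^ k⁺ ⊛ podSeries k) (k⁺ ℕ.+ o)
      ≈⟨ +-cong (podSeries-remove (removal-odd odd) o) (q^-⊛-+ k⁺ (podSeries k) o) ⟩
    podSeries k (k⁺ ℕ.+ o) + - sign (k ℕ.+ o) * c + sign o * c
      ≈⟨ +-assoc _ _ _ ⟩
    podSeries k (k⁺ ℕ.+ o) + (- sign (k ℕ.+ o) * c + sign o * c)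
      ≈⟨ +-congˡ (distribʳ _ _ _) ⟨
    podSeries k (k⁺ ℕ.+ o) + (- sign (k ℕ.+ o) + sign o) * c
      ≈⟨ +-congˡ (*-congʳ (trans (+-congʳ (-‿cong (sign-double j o))) (-‿inverseˡ _))) ⟩
    podSeries k (k⁺ ℕ.+ o) + 0# * c
      ≈⟨ trans (+-congˡ (zeroˡ c)) (+-identityʳ _) ⟩
    podSeries k (k⁺ ℕ.+ o) ∎
    where
    open ≈-Reasoning
    k k⁺ : ℕ
    k  = double j
    k⁺ = suc (double j)
    c : Carrier
    c = podCount k o × 1#
    odd : Odd k⁺
    odd (divides q e) = ℕ.even≢odd q j (≡.trans (ℕ.*-comm 2 q) (≡.trans (≡.sym e)
      (≡.cong suc (≡.trans (double-even j) (ℕ.*-comm j 2)))))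

  podSeries-even : ∀ j → podSeries (double (suc j)) ≋ podSeries (suc (double j)) ⊕ q^ (double (suc j)) ⊛ podSeries (double (suc j))
  podSeries-even j .at n with n ℕ.<? double (suc j)
  ... | yes n<k = sym (trans (+-congˡ (q^-⊛-< (double (suc j)) (podSeries (double (suc j))) n<k))
                             (trans (+-identityʳ _) (sym (podSeries-small n<k))))
  ... | no  n≮k with ℕ.m≤n⇒∃[o]m+o≡n (ℕ.≮⇒≥ n≮k)
  ...   | o , ≡.refl = trans (podSeries-remove (removal-even even) o)
    (+-congˡ (trans (*-congʳ (sign-double (suc j) o)) (sym (q^-⊛-+ (double (suc j)) (podSeries (double (suc j))) o))))
    where
    even : ¬ Odd (double (suc j))
    even odd = odd (divides (suc j) (double-even (suc j)))

  -- That is, (1 - q^(2j+2)) c⁺ = (1 - q^(2j+1)) c for consecutive products c and c⁺.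
  podSeries-step : ∀ j → podSeries (double (suc j)) ⊕ q^ (suc (double j)) ⊛ podSeries (double j) ≋
                         podSeries (double j) ⊕ q^ (double (suc j)) ⊛ podSeries (double (suc j))
  podSeries-step j = begin
    c⁺ ⊕ u              ≈⟨ S.+-congʳ (podSeries-even j) ⟩
    c′ ⊕ v ⊕ u          ≈⟨ xy∙z≈xz∙y c′ v u ⟩
    c′ ⊕ u ⊕ v          ≈⟨ S.+-congʳ (podSeries-odd j) ⟩
    podSeries (double j) ⊕ v ∎
    where
    open ≋-Reasoning
    open CommutativeSemigroupProperties S.+-commutativeSemigroup using (xy∙z≈xz∙y)
    c⁺ c′ u v : Series
    c⁺ = podSeries (double (suc j))
    c′ = podSeries (suc (double j))
    u  = q^ (suc (double j)) ⊛ podSeries (double j)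
    v  = q^ (double (suc j)) ⊛ c⁺

  podSeries-0 : podSeries 0 ≋ 1ₛ
  podSeries-0 .at zero    = trans (*-identityˡ _) (+-identityʳ _)
  podSeries-0 .at (suc n) = trans (reflexive (≡.cong (λ c → sign (suc n) * (c × 1#)) empty)) (zeroʳ _)
    where
    none : ∀ {ps : List ℕ} → ps ∈ boundedPods 0 (suc n) → ps ∈ []
    none {ps} ps∈ with ps | ∈-boundedPods⁻ 0 (suc n) ps∈
    ... | [] | boundedPod (isPodPartition (isPartition _ _ ()) _) _
    ... | suc _ ∷ _ | boundedPod _ (() ∷ _)
    ... | zero ∷ _ | boundedPod (isPodPartition (isPartition _ (() ∷ _) _) _) _
    empty : podCount 0 (suc n) ≡ 0
    empty = length-≡-set (boundedPods-unique 0 (suc n)) [] none (λ ())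

  ψ : ℕ → Series
  ψ n = gen triangle (window n)

  -- Shanks' sum: Σ_{s<j} q^(sk) ∏_{i≤s} (1 − q^(2i−1)) / (1 − q^(2i)).
  shanks : ℕ → ℕ → Series
  shanks k zero    = 0ₛ
  shanks k (suc j) = shanks k j ⊕ q^ (j ℕ.* k) ⊛ podSeries (double j)

  -- The induction step of `shanks-telescope` with x = q, Q = q^k, A = q^((j+1)k) and r = q^(2j+1).
  -- Adding A(b + rb) to both sides brings in both hypotheses without a subtraction.
  telescope-step : ∀ H G Q x A r b b⁺ →
    b⁺ ⊕ r ⊛ b ≋ b ⊕ x ⊛ r ⊛ b⁺ →
    H ⊕ x ⊛ Q ⊛ G ⊕ A ⊛ b ≋ G ⊕ Q ⊛ H ⊕ A ⊛ (r ⊛ b) →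
    (H ⊕ A ⊛ b⁺) ⊕ x ⊛ Q ⊛ (G ⊕ A ⊛ (x ⊛ r) ⊛ b⁺) ⊕ Q ⊛ A ⊛ b⁺ ≋
    (G ⊕ A ⊛ (x ⊛ r) ⊛ b⁺) ⊕ Q ⊛ (H ⊕ A ⊛ b⁺) ⊕ Q ⊛ A ⊛ (x ⊛ (x ⊛ r) ⊛ b⁺)
  telescope-step H G Q x A r b b⁺ R old = ⊕-cancelˡ (A ⊛ b ⊕ A ⊛ (r ⊛ b)) (begin
    A ⊛ b ⊕ A ⊛ (r ⊛ b) ⊕ ((H ⊕ A ⊛ b⁺) ⊕ x ⊛ Q ⊛ (G ⊕ A ⊛ (x ⊛ r) ⊛ b⁺) ⊕ Q ⊛ A ⊛ b⁺)
      ≈⟨ solve 8 (λ H G Q x A r b b⁺ →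
           A :* b :+ A :* (r :* b) :+ ((H :+ A :* b⁺) :+ x :* Q :* (G :+ A :* (x :* r) :* b⁺) :+ Q :* A :* b⁺) :=
           (H :+ x :* Q :* G :+ A :* b) :+ A :* (b⁺ :+ r :* b) :+ (x :* x :* Q :* A :* r :* b⁺ :+ Q :* A :* b⁺))
           ≋-refl H G Q x A r b b⁺ ⟩
    (H ⊕ x ⊛ Q ⊛ G ⊕ A ⊛ b) ⊕ A ⊛ (b⁺ ⊕ r ⊛ b) ⊕ (x ⊛ x ⊛ Q ⊛ A ⊛ r ⊛ b⁺ ⊕ Q ⊛ A ⊛ b⁺)
      ≈⟨ S.+-congʳ (S.+-cong old (S.*-congˡ R)) ⟩
    (G ⊕ Q ⊛ H ⊕ A ⊛ (r ⊛ b)) ⊕ A ⊛ (b ⊕ x ⊛ r ⊛ b⁺) ⊕ (x ⊛ x ⊛ Q ⊛ A ⊛ r ⊛ b⁺ ⊕ Q ⊛ A ⊛ b⁺)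
      ≈⟨ solve 8 (λ H G Q x A r b b⁺ →
           (G :+ Q :* H :+ A :* (r :* b)) :+ A :* (b :+ x :* r :* b⁺) :+ (x :* x :* Q :* A :* r :* b⁺ :+ Q :* A :* b⁺) :=
           A :* b :+ A :* (r :* b) :+ ((G :+ A :* (x :* r) :* b⁺) :+ Q :* (H :+ A :* b⁺) :+ Q :* A :* (x :* (x :* r) :* b⁺)))
           ≋-refl H G Q x A r b b⁺ ⟩
    A ⊛ b ⊕ A ⊛ (r ⊛ b) ⊕ ((G ⊕ A ⊛ (x ⊛ r) ⊛ b⁺) ⊕ Q ⊛ (H ⊕ A ⊛ b⁺) ⊕ Q ⊛ A ⊛ (x ⊛ (x ⊛ r) ⊛ b⁺)) ∎)
    where
    open ≋-Reasoning
    open Solver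

  q^-double-suc : ∀ j → q^ (double (suc j)) ≋ q^ 1 ⊛ q^ (suc (double j))
  q^-double-suc j = q^-homo 1 (suc (double j))

  -- With c_s the product up to the part 2s, the claim is (1 - q^k) Σ q^(sk) c_s - (1 - q^(k+1)) Σ
  -- q^(s(k+2)) c_s = -q^((j+1)k) (1 - q^(2j+1)) c_j, summed over s ≤ j. It telescopes because (1 -
  -- q^(2s)) c_s = (1 - q^(2s-1)) c_(s-1).
  shanks-telescope : ∀ k j →
    shanks k (suc j) ⊕ q^ 1 ⊛ q^ k ⊛ shanks (2 ℕ.+ k) (suc j) ⊕ q^ (suc j ℕ.* k) ⊛ podSeries (double j) ≋
    shanks (2 ℕ.+ k) (suc j) ⊕ q^ k ⊛ shanks k (suc j) ⊕ q^ (suc j ℕ.* k) ⊛ (q^ (suc (double j)) ⊛ podSeries (double j))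
  shanks-telescope k zero = begin
    (0ₛ ⊕ 1ₛ ⊛ c) ⊕ x ⊛ Q ⊛ (0ₛ ⊕ 1ₛ ⊛ c) ⊕ q^ (1 ℕ.* k) ⊛ c
      ≈⟨ S.+-congˡ (S.*-congʳ (q^-cong (ℕ.*-identityˡ k))) ⟩
    (0ₛ ⊕ 1ₛ ⊛ c) ⊕ x ⊛ Q ⊛ (0ₛ ⊕ 1ₛ ⊛ c) ⊕ Q ⊛ c
      ≈⟨ solve 3 (λ c x Q →
           (con 0 :+ con 1 :* c) :+ x :* Q :* (con 0 :+ con 1 :* c) :+ Q :* c :=
           (con 0 :+ con 1 :* c) :+ Q :* (con 0 :+ con 1 :* c) :+ Q :* (x :* c)) ≋-refl c x Q ⟩
    (0ₛ ⊕ 1ₛ ⊛ c) ⊕ Q ⊛ (0ₛ ⊕ 1ₛ ⊛ c) ⊕ Q ⊛ (x ⊛ c)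
      ≈⟨ S.+-congˡ (S.*-congʳ (q^-cong (ℕ.*-identityˡ k))) ⟨
    (0ₛ ⊕ 1ₛ ⊛ c) ⊕ Q ⊛ (0ₛ ⊕ 1ₛ ⊛ c) ⊕ q^ (1 ℕ.* k) ⊛ (x ⊛ c) ∎
    where
    open ≋-Reasoning
    open Solver
    c x Q : Series
    c = podSeries 0
    x = q^ 1
    Q = q^ k
  shanks-telescope k (suc j) = begin
    (H ⊕ A ⊛ b⁺) ⊕ x ⊛ Q ⊛ (G ⊕ q^ (suc j ℕ.* (2 ℕ.+ k)) ⊛ b⁺) ⊕ q^ (k ℕ.+ suc j ℕ.* k) ⊛ b⁺
      ≈⟨ S.+-cong (S.+-congˡ (S.*-congˡ (S.+-congˡ (S.*-congʳ A′≋)))) (S.*-congʳ (q^-homo k (suc j ℕ.* k))) ⟩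
    (H ⊕ A ⊛ b⁺) ⊕ x ⊛ Q ⊛ (G ⊕ A ⊛ (x ⊛ r) ⊛ b⁺) ⊕ Q ⊛ A ⊛ b⁺
      ≈⟨ telescope-step H G Q x A r (podSeries (double j)) b⁺
           (≋-trans (podSeries-step j) (S.+-congˡ (S.*-congʳ (q^-double-suc j)))) (shanks-telescope k j) ⟩
    (G ⊕ A ⊛ (x ⊛ r) ⊛ b⁺) ⊕ Q ⊛ (H ⊕ A ⊛ b⁺) ⊕ Q ⊛ A ⊛ (x ⊛ (x ⊛ r) ⊛ b⁺)
      ≈⟨ S.+-cong (S.+-congʳ (S.+-congˡ (S.*-congʳ A′≋)))
                  (S.*-cong (q^-homo k (suc j ℕ.* k)) (S.*-congʳ (≋-trans (q^-homo 1 (double (suc j))) (S.*-congˡ (q^-double-suc j))))) ⟨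
    (G ⊕ q^ (suc j ℕ.* (2 ℕ.+ k)) ⊛ b⁺) ⊕ Q ⊛ (H ⊕ A ⊛ b⁺) ⊕ q^ (k ℕ.+ suc j ℕ.* k) ⊛ (q^ (suc (double (suc j))) ⊛ b⁺) ∎
    where
    open ≋-Reasoning
    H G Q x A r b⁺ : Series
    H  = shanks k (suc j)
    G  = shanks (2 ℕ.+ k) (suc j)
    Q  = q^ k
    x  = q^ 1
    A  = q^ (suc j ℕ.* k)
    r  = q^ (suc (double j))
    b⁺ = podSeries (double (suc j))
    exponent : ∀ j k d → d ≡ j ℕ.* 2 → suc j ℕ.* (2 ℕ.+ k) ≡ suc j ℕ.* k ℕ.+ (2 ℕ.+ d)
    exponent j k _ ≡.refl = expand j k
      where
      expand : ∀ j k → suc j ℕ.* (2 ℕ.+ k) ≡ suc j ℕ.* k ℕ.+ (2 ℕ.+ j ℕ.* 2)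
      expand = solve-∀
    A′≋ : q^ (suc j ℕ.* (2 ℕ.+ k)) ≋ A ⊛ (x ⊛ r)
    A′≋ = ≋-trans (q^-cong (exponent j k (double j) (double-even j)))
         (≋-trans (q^-homo (suc j ℕ.* k) (2 ℕ.+ double j)) (S.*-congˡ (q^-double-suc j)))

  -- For n = m + 1 both sides solve (1 - q^(2m+2)) X = (1 - q^(2m+1)) W with the same W, which
  -- determines X. The left side does so by the recurrence of the products, the right side by
  -- telescoping.
  shanks-identity : ∀ n → podSeries (double n) ⊛ ψ n ≋ shanks (suc (double n)) n
  shanks-identity zero    = S.zeroʳ _
  shanks-identity (suc m) = fixpoint-unique k lhs rhs
    where
    open ≋-Reasoning
    open Solver
    k : ℕ
    k = suc (double m)
    c c⁺ ψ⁺ H G⁺ A W : Series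
    c  = podSeries (double m)
    c⁺ = podSeries (double (suc m))
    ψ⁺ = ψ (suc m)
    H  = shanks k (suc m)
    G⁺ = shanks (suc (double (suc m))) (suc m)
    A  = q^ (suc m ℕ.* k)
    W  = H ⊕ A ⊛ c
    c⊛ψ⁺ : c ⊛ ψ⁺ ≋ W
    c⊛ψ⁺ = begin
      -- The two indices new in the window contribute q^(mk) and q^((m+1)k). The first supplies the
      -- next term of the Shanks sum, and the second is left over as `A ⊛ c`.
      c ⊛ (q^ (m ℕ.* k) ⊕ (A ⊕ ψ m))
        ≈⟨ solve 4 (λ c a b p → c :* (a :+ (b :+ p)) := c :* p :+ a :* c :+ b :* c) ≋-refl c (q^ (m ℕ.* k)) A (ψ m) ⟩
      c ⊛ ψ m ⊕ q^ (m ℕ.* k) ⊛ c ⊕ A ⊛ c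
        ≈⟨ S.+-congʳ (S.+-congʳ (shanks-identity m)) ⟩
      H ⊕ A ⊛ c ∎
    lhs : c⁺ ⊛ ψ⁺ ⊕ q^ k ⊛ W ≋ W ⊕ q^ (suc k) ⊛ (c⁺ ⊛ ψ⁺)
    lhs = begin
      c⁺ ⊛ ψ⁺ ⊕ q^ k ⊛ W         ≈⟨ S.+-congˡ (S.*-congˡ c⊛ψ⁺) ⟨
      c⁺ ⊛ ψ⁺ ⊕ q^ k ⊛ (c ⊛ ψ⁺)  ≈⟨ solve 4 (λ a b c p → a :* p :+ b :* (c :* p) := (a :+ b :* c) :* p) ≋-refl c⁺ (q^ k) c ψ⁺ ⟩
      (c⁺ ⊕ q^ k ⊛ c) ⊛ ψ⁺       ≈⟨ S.*-congʳ (podSeries-step m) ⟩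
      (c ⊕ q^ (suc k) ⊛ c⁺) ⊛ ψ⁺ ≈⟨ solve 4 (λ a b c p → (c :+ b :* a) :* p := c :* p :+ b :* (a :* p)) ≋-refl c⁺ (q^ (suc k)) c ψ⁺ ⟩
      c ⊛ ψ⁺ ⊕ q^ (suc k) ⊛ (c⁺ ⊛ ψ⁺) ≈⟨ S.+-congʳ c⊛ψ⁺ ⟩
      W ⊕ q^ (suc k) ⊛ (c⁺ ⊛ ψ⁺) ∎
    rhs : G⁺ ⊕ q^ k ⊛ W ≋ W ⊕ q^ (suc k) ⊛ G⁺
    rhs = begin
      G⁺ ⊕ q^ k ⊛ (H ⊕ A ⊛ c)
        ≈⟨ solve 5 (λ G Q H A c → G :+ Q :* (H :+ A :* c) := G :+ Q :* H :+ A :* (Q :* c)) ≋-refl G⁺ (q^ k) H A c ⟩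
      G⁺ ⊕ q^ k ⊛ H ⊕ A ⊛ (q^ k ⊛ c)
        ≈⟨ shanks-telescope k m ⟨
      H ⊕ q^ 1 ⊛ q^ k ⊛ G⁺ ⊕ A ⊛ c
        ≈⟨ S.+-congʳ (S.+-congˡ (S.*-congʳ (q^-homo 1 k))) ⟨
      H ⊕ q^ (suc k) ⊛ G⁺ ⊕ A ⊛ c
        ≈⟨ solve 3 (λ H G a → H :+ G :+ a := H :+ a :+ G) ≋-refl H (q^ (suc k) ⊛ G⁺) (A ⊛ c) ⟩
      W ⊕ q^ (suc k) ⊛ G⁺ ∎

  -- Every term of the Shanks sum after the first is divisible by q^k, and k exceeds the precision
  -- by one.
  podSeries⊛ψ : ∀ n → podSeries (double (suc n)) ⊛ ψ (suc n) ≋[ double (suc n) ] 1ₛ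
  podSeries⊛ψ n .at≤ m m≤ = trans (shanks-identity (suc n) .at m) (first n)
    where
    k : ℕ
    k = suc (double (suc n))
    first : ∀ j → shanks k (suc j) m ≈ 1ₛ m
    first zero    = trans (+-identityˡ _) (trans (⊛-identityˡ (podSeries 0) .at m) (podSeries-0 .at m))
    first (suc j) = trans (+-cong (first j)
        (q^-⊛-< (suc j ℕ.* k) (podSeries (double (suc j))) (ℕ.<-≤-trans (s≤s m≤) (ℕ.m≤m+n k (j ℕ.* k)))))
      (+-identityʳ _)

  podSeries-full : ∀ {k n} → n ℕ.≤ k → podSeries k n ≈ sign n * (pod n × 1#)
  podSeries-full {n = n} n≤k = reflexive (≡.cong (λ c → sign n * (c × 1#)) (podCount-full n≤k))

-- Reduction of pod(5n+2) modulo 5 to sums of three triangular numbers.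

module Congruence (K : CommutativeRing 0ℓ 0ℓ) (char5 : Series.HasCharacteristicFive K) where

  open Counting
  open PodSeries K
  open Series K
  open Theta
  import Algebra.Properties.Semiring.Mult as Mult
  open import Data.Integer.Base using (ℤ; +_)
  import Data.Integer.Divisibility.Signed as ℤ
  open import Data.Nat.Base using (_%_)
  open import Data.Nat.DivMod using (m≡m%n+[m/n]*n)
  open import Data.Product.Base using (_,_) renaming (_×_ to _∧_)
  open import Relation.Binary.PropositionalEquality as ≡ using (_≡_)
  open import Algebra.Properties.Ring (CommutativeRing.ring K) using (-‿distribˡ-*; -‿distribʳ-*; -‿involutive)

  open CommutativeRing K using (_≈_; 0#; 1#; refl; sym; trans; reflexive; +-cong; +-identityʳ; *-cong; *-congˡ; *-congʳ; *-assoc; *-identityˡ; zeroʳ; -‿cong) renaming (_+_ to _⊹_; _*_ to _∙_; -_ to neg)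
  open Mult (CommutativeRing.semiring K) using (_×_; ×-homo-+)

  open CharacteristicFive char5

  5*-* : ∀ n → 5* n ≡ n ℕ.* 5
  5*-* zero    = ≡.refl
  5*-* (suc n) = ≡.cong (λ m → 5 ℕ.+ m) (5*-* n)

  -- For r = 0, 1, 3 these are the components A, B, D in ψ = A(q⁵) + q B(q⁵) + q³ D(q⁵).
  part : ℕ → List ℤ → Series
  part r xs = gen triangle/5 (filter (λ k → triangle k % 5 ℕ.≟ r) xs)

  module Dissect (k : ℤ) (xs : List ℤ) where
    open Solver public
    open ≋-Reasoning public

    w a b c : Series
    w = dilate (q^ (triangle/5 k))
    a = dilate (part 0 xs)
    b = dilate (part 1 xs)
    c = dilate (part 3 xs)

    head : ∀ k r → triangle k % 5 ≡ r → q^ (triangle k) ≋ dilate (q^ (triangle/5 k)) ⊛ q^ r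
    head k r e = ≋-trans (q^-cong (≡.trans (m≡m%n+[m/n]*n (triangle k) 5)
        (≡.trans (≡.cong₂ ℕ._+_ e (≡.sym (5*-* (triangle/5 k)))) (ℕ.+-comm r _))))
      (≋-trans (q^-homo (5* (triangle/5 k)) r) (S.*-congʳ (≋-sym (dilate-q^ (triangle/5 k)))))

  ψ-dissection : ∀ xs → gen triangle xs ≋ dilate (part 0 xs) ⊕ dilate (part 1 xs) ⊛ q^ 1 ⊕ dilate (part 3 xs) ⊛ q^ 3
  ψ-dissection [] = ≋-sym (≋-trans
      (S.+-cong (S.+-cong dilate-0 (≋-trans (S.*-congʳ dilate-0) (⊛-zeroˡ (q^ 1)))) (≋-trans (S.*-congʳ dilate-0) (⊛-zeroˡ (q^ 3))))
      (≋-trans (S.+-identityʳ _) (S.+-identityʳ _)))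
  ψ-dissection (k ∷ xs) with triangle-residue k
  ... | inj₁ e
      rewrite filter-accept (λ k → triangle k % 5 ℕ.≟ 0) {x = k} {xs} e
            | filter-reject (λ k → triangle k % 5 ℕ.≟ 1) {x = k} {xs} (λ f → contradiction (≡.trans (≡.sym e) f) λ ())
            | filter-reject (λ k → triangle k % 5 ℕ.≟ 3) {x = k} {xs} (λ f → contradiction (≡.trans (≡.sym e) f) λ ()) = begin
    q^ (triangle k) ⊕ gen triangle xs
      ≈⟨ S.+-cong (≋-trans (head k 0 e) (S.*-identityʳ w)) (ψ-dissection xs) ⟩
    w ⊕ (a ⊕ b ⊛ q^ 1 ⊕ c ⊛ q^ 3)
      ≈⟨ solve 4 (λ w a b c → w :+ (a :+ b :+ c) := (w :+ a) :+ b :+ c) ≋-refl w a (b ⊛ q^ 1) (c ⊛ q^ 3) ⟩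
    (w ⊕ a) ⊕ b ⊛ q^ 1 ⊕ c ⊛ q^ 3
      ≈⟨ S.+-congʳ (S.+-congʳ (dilate-⊕ (q^ (triangle/5 k)) (part 0 xs))) ⟨
    dilate (q^ (triangle/5 k) ⊕ part 0 xs) ⊕ b ⊛ q^ 1 ⊕ c ⊛ q^ 3 ∎
    where open Dissect k xs
  ... | inj₂ (inj₁ e)
      rewrite filter-reject (λ k → triangle k % 5 ℕ.≟ 0) {x = k} {xs} (λ f → contradiction (≡.trans (≡.sym e) f) λ ())
            | filter-accept (λ k → triangle k % 5 ℕ.≟ 1) {x = k} {xs} e
            | filter-reject (λ k → triangle k % 5 ℕ.≟ 3) {x = k} {xs} (λ f → contradiction (≡.trans (≡.sym e) f) λ ()) = begin
    q^ (triangle k) ⊕ gen triangle xs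
      ≈⟨ S.+-cong (head k 1 e) (ψ-dissection xs) ⟩
    w ⊛ q^ 1 ⊕ (a ⊕ b ⊛ q^ 1 ⊕ c ⊛ q^ 3)
      ≈⟨ solve 5 (λ w x a b c → w :* x :+ (a :+ b :* x :+ c) := a :+ (w :+ b) :* x :+ c) ≋-refl w (q^ 1) a b (c ⊛ q^ 3) ⟩
    a ⊕ (w ⊕ b) ⊛ q^ 1 ⊕ c ⊛ q^ 3
      ≈⟨ S.+-congʳ (S.+-congˡ (S.*-congʳ (dilate-⊕ (q^ (triangle/5 k)) (part 1 xs)))) ⟨
    a ⊕ dilate (q^ (triangle/5 k) ⊕ part 1 xs) ⊛ q^ 1 ⊕ c ⊛ q^ 3 ∎
    where open Dissect k xs
  ... | inj₂ (inj₂ e)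
      rewrite filter-reject (λ k → triangle k % 5 ℕ.≟ 0) {x = k} {xs} (λ f → contradiction (≡.trans (≡.sym e) f) λ ())
            | filter-reject (λ k → triangle k % 5 ℕ.≟ 1) {x = k} {xs} (λ f → contradiction (≡.trans (≡.sym e) f) λ ())
            | filter-accept (λ k → triangle k % 5 ℕ.≟ 3) {x = k} {xs} e = begin
    q^ (triangle k) ⊕ gen triangle xs
      ≈⟨ S.+-cong (head k 3 e) (ψ-dissection xs) ⟩
    w ⊛ q^ 3 ⊕ (a ⊕ b ⊛ q^ 1 ⊕ c ⊛ q^ 3)
      ≈⟨ solve 5 (λ w x a b c → w :* x :+ (a :+ b :+ c :* x) := a :+ b :+ (w :+ c) :* x) ≋-refl w (q^ 3) a (b ⊛ q^ 1) c ⟩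
    a ⊕ b ⊛ q^ 1 ⊕ (w ⊕ c) ⊛ q^ 3
      ≈⟨ S.+-congˡ (S.*-congʳ (dilate-⊕ (q^ (triangle/5 k)) (part 3 xs))) ⟨
    a ⊕ b ⊛ q^ 1 ⊕ dilate (q^ (triangle/5 k) ⊕ part 3 xs) ⊛ q^ 3 ∎
    where open Dissect k xs

  -- A pair encodes the odd integer ±(4k + 1). Every odd integer arises exactly once, and its square
  -- is 8 times the triangular number of k, plus 1.
  SignedIndex : Set
  SignedIndex = Bool ∧ ℤ

  module _ (n : ℕ) where

    index : ℕ
    index = 5* n ℕ.+ 2

    private
      -- The least window size for which `pairs-of-triangles` holds at every exponent up to n. It
      -- equals 5n + 2, so the precision 2M of Gauss' identity also covers the index of `pod`.
      M : ℕ
      M = 2 ℕ.+ n ℕ.* 5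

      C Ψ Ψ³ Ψ⁴ U A B D : Series
      C  = podSeries (double M)
      Ψ  = ψ M
      Ψ³ = Ψ ⊛ Ψ ⊛ Ψ
      Ψ⁴ = Ψ ⊛ Ψ ⊛ Ψ ⊛ Ψ
      U  = section 2 C
      A  = part 0 (window M)
      B  = part 1 (window M)
      D  = part 3 (window M)

      m≤double : ∀ m → m ℕ.≤ double m
      m≤double zero    = z≤n
      m≤double (suc m) = s≤s (ℕ.m≤n⇒m≤1+n (m≤double m))

      index≤ : index ℕ.≤ double M
      index≤ = ℕ.≤-trans (ℕ.≤-reflexive (≡.trans (ℕ.+-comm (5* n) 2) (≡.cong (λ m → 2 ℕ.+ m) (5*-* n)))) (m≤double M)

      C⊛Ψ : C ⊛ Ψ ≋[ double M ] 1ₛ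
      C⊛Ψ = podSeries⊛ψ (1 ℕ.+ n ℕ.* 5)

      n≤double : n ℕ.≤ double M
      n≤double = ℕ.≤-trans (ℕ.≤-trans (ℕ.m≤m*n n 5) (ℕ.m≤n+m (n ℕ.* 5) 2)) (m≤double M)

      dilated : dilate Ψ ⊛ C ≋[ index ] Ψ⁴
      dilated = ≋[]-trans (≋⇒≋[] (begin
          dilate Ψ ⊛ C        ≈⟨ S.*-congʳ (frobenius-gen triangle (window M)) ⟨
          Ψ ⁵ ⊛ C             ≈⟨ solve 2 (λ f c → f :* f :* f :* f :* f :* c := f :* f :* f :* f :* (c :* f)) ≋-refl Ψ C ⟩
          Ψ⁴ ⊛ (C ⊛ Ψ)        ∎))
        (≋[]-trans (⊛-cong[] (≋⇒≋[] ≋-refl) (≋[]-weaken index≤ C⊛Ψ)) (≋⇒≋[] (S.*-identityʳ Ψ⁴)))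
        where
        open ≋-Reasoning
        open Solver

      section-≋[] : ∀ {f g} → f ≋[ index ] g → section 2 f ≋[ n ] section 2 g
      section-≋[] e .at≤ m m≤n = e .at≤ (5* m ℕ.+ 2) (ℕ.+-monoˡ-≤ 2
        (≡.subst₂ ℕ._≤_ (≡.sym (5*-* m)) (≡.sym (5*-* n)) (ℕ.*-monoˡ-≤ 5 m≤n)))

      square : A ⊛ B ⊕ D ⊛ D ⊛ q^ 1 ≋[ n ] Ψ ⊛ Ψ
      square .at≤ m m≤n = begin
        (A ⊛ B) m ⊹ (D ⊛ D ⊛ q^ 1) m
          ≈⟨ +-cong (gen-cartesianProduct triangle/5 triangle/5 xs₀ xs₁ .at m) shifted ⟨
        gen w₁ (cartesianProduct xs₀ xs₁) m ⊹ gen w₃ (cartesianProduct xs₃ xs₃) m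
          ≈⟨ +-cong (gen-at w₁ (cartesianProduct xs₀ xs₁) m) (gen-at w₃ (cartesianProduct xs₃ xs₃) m) ⟩
        length (filter (λ x → w₁ x ℕ.≟ m) (cartesianProduct xs₀ xs₁)) × 1# ⊹
        length (filter (λ x → w₃ x ℕ.≟ m) (cartesianProduct xs₃ xs₃)) × 1#
          ≈⟨ ×-homo-+ 1# (length (filter (λ x → w₁ x ℕ.≟ m) (cartesianProduct xs₀ xs₁))) _ ⟨
        (length (filter (λ x → w₁ x ℕ.≟ m) (cartesianProduct xs₀ xs₁)) ℕ.+
         length (filter (λ x → w₃ x ℕ.≟ m) (cartesianProduct xs₃ xs₃))) × 1#
          ≈⟨ reflexive (≡.cong (_× 1#) (pairs-of-triangles (s≤s (s≤s (ℕ.*-monoˡ-≤ 5 m≤n))))) ⟨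
        length (filter (λ x → w x ℕ.≟ m) (cartesianProduct (window M) (window M))) × 1#
          ≈⟨ gen-at w (cartesianProduct (window M) (window M)) m ⟨
        gen w (cartesianProduct (window M) (window M)) m
          ≈⟨ gen-cartesianProduct triangle triangle (window M) (window M) .at m ⟩
        (Ψ ⊛ Ψ) m ∎
        where
        open ≈-Reasoning
        w w₁ w₃ : ℤ ∧ ℤ → ℕ
        w  (k , l) = triangle k ℕ.+ triangle l
        w₁ (u , v) = triangle/5 u ℕ.+ triangle/5 v
        w₃ (u , v) = 1 ℕ.+ (triangle/5 u ℕ.+ triangle/5 v)
        xs₀ xs₁ xs₃ : List ℤ
        xs₀ = residueClass 0 M
        xs₁ = residueClass 1 M
        xs₃ = residueClass 3 M
        shifted : gen w₃ (cartesianProduct xs₃ xs₃) m ≈ (D ⊛ D ⊛ q^ 1) m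
        shifted = ≋-trans (gen-shift 1 w₁ (cartesianProduct xs₃ xs₃))
                 (≋-trans (S.*-congˡ (gen-cartesianProduct triangle/5 triangle/5 xs₃ xs₃))
                          (S.*-comm (q^ 1) (D ⊛ D))) .at m

      section-Ψ⁴ : section 2 Ψ⁴ ≋[ n ] Ψ⁴
      section-Ψ⁴ = ≋[]-trans (≋⇒≋[] (section-fourth-power {Ψ} {A} {B} {D} (ψ-dissection (window M))))
                  (≋[]-trans (⊛-cong[] square square) (≋⇒≋[] (≋-sym (S.*-assoc (Ψ ⊛ Ψ) Ψ Ψ))))

      Ψ⊛U : Ψ ⊛ U ≋[ n ] Ψ⁴
      Ψ⊛U = ≋[]-trans (≋⇒≋[] (≋-sym (dilate-⊛ 2 Ψ C (s≤s (s≤s z≤n)))))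
           (≋[]-trans (section-≋[] dilated) section-Ψ⁴)

      -- Cancelling Ψ in ΨU = Ψ⁴ means multiplying by `C`, its inverse up to the precision.
      U≋Ψ³ : U ≋[ n ] Ψ³
      U≋Ψ³ = ≋[]-trans (≋⇒≋[] (≋-sym (S.*-identityʳ U)))
            (≋[]-trans (⊛-cong[] (≋⇒≋[] ≋-refl) (≋[]-sym unit))
            (≋[]-trans (≋⇒≋[] (solve 3 (λ u c f → u :* (c :* f) := f :* u :* c) ≋-refl U C Ψ))
            (≋[]-trans (⊛-cong[] Ψ⊛U (≋⇒≋[] ≋-refl))
            (≋[]-trans (≋⇒≋[] (solve 2 (λ c f → f :* f :* f :* f :* c := f :* f :* f :* (c :* f)) ≋-refl C Ψ))
            (≋[]-trans (⊛-cong[] (≋⇒≋[] ≋-refl) unit) (≋⇒≋[] (S.*-identityʳ Ψ³)))))))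
        where
        open Solver
        unit : C ⊛ Ψ ≋[ n ] 1ₛ
        unit = ≋[]-weaken n≤double C⊛Ψ

    signedWindow : List SignedIndex
    signedWindow = cartesianProduct (true ∷ false ∷ []) (window M)

    signedTriples : List (SignedIndex ∧ SignedIndex ∧ SignedIndex)
    signedTriples = filter (λ ((_ , k) , (_ , l) , (_ , m)) → triangle k ℕ.+ (triangle l ℕ.+ triangle m) ℕ.≟ n)
      (cartesianProduct signedWindow (cartesianProduct signedWindow signedWindow))

    private
      gen-signed : gen (λ (_ , k) → triangle k) signedWindow ≋ (1ₛ ⊕ 1ₛ) ⊛ Ψ
      gen-signed = ≋-trans (gen-cartesianProduct (λ _ → 0) triangle (true ∷ false ∷ []) (window M))
        (S.*-congʳ (S.+-congˡ (S.+-identityʳ 1ₛ)))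

      -- The signed triples are enumerated by (2Ψ)³ = 8Ψ³, and 2 is inverse to 8 modulo 5. So 15Ψ³
      -- is added to obtain Ψ³ = 16Ψ³ = 2(2Ψ)³.
      Ψ³-count : Ψ³ n ≈ length signedTriples × 1# ⊹ length signedTriples × 1#
      Ψ³-count = begin
        Ψ³ n
          ≈⟨ 5ₛ-kill Ψ³ ((1ₛ ⊕ 1ₛ ⊕ 1ₛ) ⊛ Ψ³) .at n ⟨
        (Ψ³ ⊕ 5ₛ ⊛ ((1ₛ ⊕ 1ₛ ⊕ 1ₛ) ⊛ Ψ³)) n
          ≈⟨ solve 1 (λ f → f :* f :* f :+ (one :+ one :+ one :+ one :+ one) :* ((one :+ one :+ one) :* (f :* f :* f)) :=
               let g = (one :+ one) :* f in g :* (g :* g) :+ g :* (g :* g)) ≋-refl Ψ .at n ⟩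
        (G ⊕ G) n
          ≈⟨ S.+-cong e e .at n ⟩
        gen weight triples n ⊹ gen weight triples n
          ≈⟨ +-cong (gen-at weight triples n) (gen-at weight triples n) ⟩
        length signedTriples × 1# ⊹ length signedTriples × 1# ∎
        where
        open ≈-Reasoning
        open Solver
        one : ∀ {n} → Polynomial n
        one = con 1
        v : SignedIndex → ℕ
        v (_ , k) = triangle k
        weight : SignedIndex ∧ SignedIndex ∧ SignedIndex → ℕ
        weight (x , y , z) = v x ℕ.+ (v y ℕ.+ v z)
        triples : List (SignedIndex ∧ SignedIndex ∧ SignedIndex)
        triples = cartesianProduct signedWindow (cartesianProduct signedWindow signedWindow)
        g G : Series
        g = (1ₛ ⊕ 1ₛ) ⊛ Ψ
        G = g ⊛ (g ⊛ g)
        e : G ≋ gen weight triples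
        e = ≋-sym (≋-trans (gen-cartesianProduct v (λ (y , z) → v y ℕ.+ v z) signedWindow (cartesianProduct signedWindow signedWindow))
           (⊛-cong gen-signed (≋-trans (gen-cartesianProduct v v signedWindow signedWindow) (⊛-cong gen-signed gen-signed))))

      sign-square : ∀ m → sign m ∙ sign m ≈ 1#
      sign-square zero    = *-identityˡ 1#
      sign-square (suc m) = begin
        neg (sign m) ∙ neg (sign m)     ≈⟨ -‿distribˡ-* (sign m) (neg (sign m)) ⟨
        neg (sign m ∙ neg (sign m))     ≈⟨ -‿cong (-‿distribʳ-* (sign m) (sign m)) ⟨
        neg (neg (sign m ∙ sign m))     ≈⟨ -‿involutive _ ⟩
        sign m ∙ sign m                 ≈⟨ sign-square m ⟩
        1#                              ∎
        where open ≈-Reasoning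

    pod-signedTriples : length signedTriples × 1# ≈ 0# → pod index × 1# ≈ 0#
    pod-signedTriples N≈0 = begin
        pod index × 1#                                  ≈⟨ *-identityˡ _ ⟨
        1# ∙ (pod index × 1#)                           ≈⟨ *-congʳ (sign-square index) ⟨
        sign index ∙ sign index ∙ (pod index × 1#)      ≈⟨ *-assoc (sign index) (sign index) _ ⟩
        sign index ∙ (sign index ∙ (pod index × 1#))    ≈⟨ *-congˡ (podSeries-full index≤) ⟨
        sign index ∙ U n                                ≈⟨ *-congˡ (U≋Ψ³ .at≤ n ℕ.≤-refl) ⟩
        sign index ∙ Ψ³ n                               ≈⟨ *-congˡ Ψ³-count ⟩
        sign index ∙ (N × 1# ⊹ N × 1#)                  ≈⟨ *-congˡ (trans (+-cong N≈0 N≈0) (+-identityʳ 0#)) ⟩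
        sign index ∙ 0#                                 ≈⟨ zeroʳ (sign index) ⟩
        0#                                              ∎
      where
      open ≈-Reasoning
      N : ℕ
      N = length signedTriples

-- Quaternions with integer coordinates.

module Quaternion where

  open IntegerPrimes
  open import Data.Fin using (#_)
  open import Data.Integer.Base
  open import Data.Integer.Divisibility.Signed
  open import Data.Integer.Properties
  open import Data.Integer.Solver using (module +-*-Solver)
  open import Data.Vec.Base using (Vec; []; _∷_)
  open import Relation.Binary.PropositionalEquality

  open +-*-Solver

  record Quaternion (A : Set) : Set where
    constructor quat
    field
      re im₁ im₂ im₃ : A
  open Quaternion public

  quat-≡ : ∀ {A : Set} {a a′ b b′ c c′ d d′ : A} → a ≡ a′ → b ≡ b′ → c ≡ c′ → d ≡ d′ → quat a b c d ≡ quat a′ b′ c′ d′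
  quat-≡ refl refl refl refl = refl

  -- The operations are stated over any signature so that the ring solver can
  -- compute with quaternions of polynomials.
  module Operations {A : Set} (_+_ _*_ : A → A → A) (-_ : A → A) where

    infixl 5 _⊞_ _⊟_
    infixr 6 _•_
    infixl 7 _⊠_

    private
      infixl 6 _+′_ _-′_
      infixl 7 _*′_
      _+′_ _-′_ _*′_ : A → A → A
      _+′_ = _+_
      a -′ b = a + (- b)
      _*′_ = _*_

    _⊞_ _⊟_ _⊠_ : Quaternion A → Quaternion A → Quaternion A
    quat a b c d ⊞ quat a′ b′ c′ d′ = quat (a +′ a′) (b +′ b′) (c +′ c′) (d +′ d′)
    quat a b c d ⊟ quat a′ b′ c′ d′ = quat (a -′ a′) (b -′ b′) (c -′ c′) (d -′ d′)
    quat a b c d ⊠ quat a′ b′ c′ d′ = quat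
      (a *′ a′ -′ b *′ b′ -′ c *′ c′ -′ d *′ d′)
      (a *′ b′ +′ b *′ a′ +′ c *′ d′ -′ d *′ c′)
      (a *′ c′ -′ b *′ d′ +′ c *′ a′ +′ d *′ b′)
      (a *′ d′ +′ b *′ c′ -′ c *′ b′ +′ d *′ a′)

    _•_ : A → Quaternion A → Quaternion A
    n • quat a b c d = quat (n *′ a) (n *′ b) (n *′ c) (n *′ d)

    conj : Quaternion A → Quaternion A
    conj (quat a b c d) = quat a (- b) (- c) (- d)

    ⟨_,_⟩ : Quaternion A → Quaternion A → A
    ⟨ quat a b c d , quat a′ b′ c′ d′ ⟩ = a *′ a′ +′ b *′ b′ +′ c *′ c′ +′ d *′ d′

    N : Quaternion A → A
    N x = ⟨ x , x ⟩

  open Operations _+_ _*_ -_ public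
  module F = Operations {Polynomial 12} _:+_ _:*_ :-_

  ℍ : Set
  ℍ = Quaternion ℤ

  1ₕ : ℍ
  1ₕ = quat 1ℤ 0ℤ 0ℤ 0ℤ

  Pure : ℍ → Set
  Pure x = re x ≡ 0ℤ

  0ₕ : ℍ
  0ₕ = quat 0ℤ 0ℤ 0ℤ 0ℤ

  ⟦_⟧ₕ : ∀ {n} → Quaternion (Polynomial n) → Vec ℤ n → ℍ
  ⟦ quat a b c d ⟧ₕ ρ = quat (⟦ a ⟧ ρ) (⟦ b ⟧ ρ) (⟦ c ⟧ ρ) (⟦ d ⟧ ρ)

  -- Three formal quaternions; a scalar is passed as the real part of the third one.
  X Y Z : Quaternion (Polynomial 12)
  X = quat (var (# 0)) (var (# 1)) (var (# 2)) (var (# 3))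
  Y = quat (var (# 4)) (var (# 5)) (var (# 6)) (var (# 7))
  Z = quat (var (# 8)) (var (# 9)) (var (# 10)) (var (# 11))

  environment : ℍ → ℍ → ℍ → Vec ℤ 12
  environment x y z = re x ∷ im₁ x ∷ im₂ x ∷ im₃ x ∷ re y ∷ im₁ y ∷ im₂ y ∷ im₃ y ∷ re z ∷ im₁ z ∷ im₂ z ∷ im₃ z ∷ []

  scalar : ℤ → ℍ
  scalar n = quat n 0ℤ 0ℤ 0ℤ

  formal-identity : ∀ x y z (l r : Quaternion (Polynomial 12)) → let ρ = environment x y z in
    ⟦ re l ⟧↓ ρ ≡ ⟦ re r ⟧↓ ρ → ⟦ im₁ l ⟧↓ ρ ≡ ⟦ im₁ r ⟧↓ ρ →
    ⟦ im₂ l ⟧↓ ρ ≡ ⟦ im₂ r ⟧↓ ρ → ⟦ im₃ l ⟧↓ ρ ≡ ⟦ im₃ r ⟧↓ ρ → ⟦ l ⟧ₕ ρ ≡ ⟦ r ⟧ₕ ρ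
  formal-identity x y z l r e₀ e₁ e₂ e₃ = quat-≡
    (prove (environment x y z) (re l) (re r) e₀) (prove (environment x y z) (im₁ l) (im₁ r) e₁)
    (prove (environment x y z) (im₂ l) (im₂ r) e₂) (prove (environment x y z) (im₃ l) (im₃ r) e₃)

  1ᶠ : Quaternion (Polynomial 12)
  1ᶠ = quat (con 1ℤ) (con 0ℤ) (con 0ℤ) (con 0ℤ)

  ⊠-assoc : ∀ x y z → (x ⊠ y) ⊠ z ≡ x ⊠ (y ⊠ z)
  ⊠-assoc x y z = formal-identity x y z ((X F.⊠ Y) F.⊠ Z) (X F.⊠ (Y F.⊠ Z)) refl refl refl refl

  ⊠-distribˡ : ∀ x y z → x ⊠ (y ⊞ z) ≡ x ⊠ y ⊞ x ⊠ z
  ⊠-distribˡ x y z = formal-identity x y z (X F.⊠ (Y F.⊞ Z)) (X F.⊠ Y F.⊞ X F.⊠ Z) refl refl refl refl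

  ⊠-distribʳ : ∀ z x y → (x ⊞ y) ⊠ z ≡ x ⊠ z ⊞ y ⊠ z
  ⊠-distribʳ z x y = formal-identity x y z ((X F.⊞ Y) F.⊠ Z) (X F.⊠ Z F.⊞ Y F.⊠ Z) refl refl refl refl

  ⊠-distribˡ-⊟ : ∀ x y z → x ⊠ (y ⊟ z) ≡ x ⊠ y ⊟ x ⊠ z
  ⊠-distribˡ-⊟ x y z = formal-identity x y z (X F.⊠ (Y F.⊟ Z)) (X F.⊠ Y F.⊟ X F.⊠ Z) refl refl refl refl

  ⊠-distribʳ-⊟ : ∀ z x y → (x ⊟ y) ⊠ z ≡ x ⊠ z ⊟ y ⊠ z
  ⊠-distribʳ-⊟ z x y = formal-identity x y z ((X F.⊟ Y) F.⊠ Z) (X F.⊠ Z F.⊟ Y F.⊠ Z) refl refl refl refl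

  x⊟y⊞y : ∀ x y → x ⊟ y ⊞ y ≡ x
  x⊟y⊞y x y = formal-identity x y 0ₕ (X F.⊟ Y F.⊞ Y) X refl refl refl refl

  conj-⊠ : ∀ x y → conj (x ⊠ y) ≡ conj y ⊠ conj x
  conj-⊠ x y = formal-identity x y 0ₕ (F.conj (X F.⊠ Y)) (F.conj Y F.⊠ F.conj X) refl refl refl refl

  conj-involutive : ∀ x → conj (conj x) ≡ x
  conj-involutive x = formal-identity x 0ₕ 0ₕ (F.conj (F.conj X)) X refl refl refl refl

  conj-• : ∀ n x → conj (n • x) ≡ n • conj x
  conj-• n x = formal-identity x 0ₕ (scalar n) (F.conj (re Z F.• X)) (re Z F.• F.conj X) refl refl refl refl

  •-⊠ˡ : ∀ n x y → (n • x) ⊠ y ≡ n • (x ⊠ y)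
  •-⊠ˡ n x y = formal-identity x y (scalar n) ((re Z F.• X) F.⊠ Y) (re Z F.• (X F.⊠ Y)) refl refl refl refl

  •-⊠ʳ : ∀ n x y → x ⊠ (n • y) ≡ n • (x ⊠ y)
  •-⊠ʳ n x y = formal-identity x y (scalar n) (X F.⊠ (re Z F.• Y)) (re Z F.• (X F.⊠ Y)) refl refl refl refl

  •-assoc : ∀ m n x → m • n • x ≡ (m * n) • x
  •-assoc m n (quat a b c d) =
    quat-≡ (sym (*-assoc m n a)) (sym (*-assoc m n b)) (sym (*-assoc m n c)) (sym (*-assoc m n d))

  •-comm : ∀ m n x → m • n • x ≡ n • m • x
  •-comm m n x = trans (•-assoc m n x) (trans (cong (_• x) (*-comm m n)) (sym (•-assoc n m x)))

  •-cancelˡ : ∀ n .{{_ : NonZero n}} {x y} → n • x ≡ n • y → x ≡ y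
  •-cancelˡ n e = quat-≡ (*-cancelˡ-≡ n _ _ (cong re e)) (*-cancelˡ-≡ n _ _ (cong im₁ e))
                         (*-cancelˡ-≡ n _ _ (cong im₂ e)) (*-cancelˡ-≡ n _ _ (cong im₃ e))

  1•-identity : ∀ x → 1ℤ • x ≡ x
  1•-identity x = formal-identity x 0ₕ 0ₕ (con 1ℤ F.• X) X refl refl refl refl

  x⊠conj : ∀ x → x ⊠ conj x ≡ N x • 1ₕ
  x⊠conj x = formal-identity x 0ₕ 0ₕ (X F.⊠ F.conj X) (F.N X F.• 1ᶠ) refl refl refl refl

  polarization : ∀ x y → x ⊠ conj y ⊞ y ⊠ conj x ≡ (+ 2 * ⟨ x , y ⟩) • 1ₕ
  polarization x y = formal-identity x y 0ₕ (X F.⊠ F.conj Y F.⊞ Y F.⊠ F.conj X) ((con (+ 2) :* F.⟨ X , Y ⟩) F.• 1ᶠ) refl refl refl refl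

  N-conj : ∀ x → N (conj x) ≡ N x
  N-conj x = prove (environment x 0ₕ 0ₕ) (F.N (F.conj X)) (F.N X) refl

  conj⊠x : ∀ x → conj x ⊠ x ≡ N x • 1ₕ
  conj⊠x x = trans (cong (conj x ⊠_) (sym (conj-involutive x))) (trans (x⊠conj (conj x)) (cong (_• 1ₕ) (N-conj x)))

  scalar-⊠ : ∀ n x → (n • 1ₕ) ⊠ x ≡ n • x
  scalar-⊠ n x = formal-identity x 0ₕ (scalar n) ((re Z F.• 1ᶠ) F.⊠ X) (re Z F.• X) refl refl refl refl

  ⊠-scalar : ∀ n x → x ⊠ (n • 1ₕ) ≡ n • x
  ⊠-scalar n x = formal-identity x 0ₕ (scalar n) (X F.⊠ (re Z F.• 1ᶠ)) (re Z F.• X) refl refl refl refl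

  conj⊠[x⊠y] : ∀ x y → conj x ⊠ (x ⊠ y) ≡ N x • y
  conj⊠[x⊠y] x y = trans (sym (⊠-assoc (conj x) x y)) (trans (cong (_⊠ y) (conj⊠x x)) (scalar-⊠ (N x) y))

  x⊠[conj⊠y] : ∀ x y → x ⊠ (conj x ⊠ y) ≡ N x • y
  x⊠[conj⊠y] x y = trans (sym (⊠-assoc x (conj x) y)) (trans (cong (_⊠ y) (x⊠conj x)) (scalar-⊠ (N x) y))

  [y⊠conj]⊠x : ∀ x y → (y ⊠ conj x) ⊠ x ≡ N x • y
  [y⊠conj]⊠x x y = trans (⊠-assoc y (conj x) x) (trans (cong (y ⊠_) (conj⊠x x)) (⊠-scalar (N x) y))

  [y⊠x]⊠conj : ∀ x y → (y ⊠ x) ⊠ conj x ≡ N x • y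
  [y⊠x]⊠conj x y = trans (⊠-assoc y x (conj x)) (trans (cong (y ⊠_) (x⊠conj x)) (⊠-scalar (N x) y))

  N-⊠ : ∀ x y → N (x ⊠ y) ≡ N x * N y
  N-⊠ x y = begin
    N (x ⊠ y)                                 ≡⟨ *-identityʳ _ ⟨
    re (N (x ⊠ y) • 1ₕ)                       ≡⟨ cong re (x⊠conj (x ⊠ y)) ⟨
    re ((x ⊠ y) ⊠ conj (x ⊠ y))               ≡⟨ cong (λ z → re ((x ⊠ y) ⊠ z)) (conj-⊠ x y) ⟩
    re ((x ⊠ y) ⊠ (conj y ⊠ conj x))          ≡⟨ cong re (⊠-assoc x y (conj y ⊠ conj x)) ⟩
    re (x ⊠ (y ⊠ (conj y ⊠ conj x)))          ≡⟨ cong (λ z → re (x ⊠ z)) (x⊠[conj⊠y] y (conj x)) ⟩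
    re (x ⊠ (N y • conj x))                   ≡⟨ cong re (•-⊠ʳ (N y) x (conj x)) ⟩
    re (N y • (x ⊠ conj x))                   ≡⟨ cong (λ z → re (N y • z)) (x⊠conj x) ⟩
    N y * (N x * 1ℤ)                          ≡⟨ cong (N y *_) (*-identityʳ (N x)) ⟩
    N y * N x                                 ≡⟨ *-comm (N y) (N x) ⟩
    N x * N y                                 ∎
    where open ≡-Reasoning

  N-• : ∀ n x → N (n • x) ≡ n * n * N x
  N-• n x = prove (environment x 0ₕ (scalar n)) (F.N (re Z F.• X)) (re Z :* re Z :* F.N X) refl

  ⟨⟩-•ˡ : ∀ n x y → ⟨ n • x , y ⟩ ≡ n * ⟨ x , y ⟩
  ⟨⟩-•ˡ n x y = prove (environment x y (scalar n)) F.⟨ re Z F.• X , Y ⟩ (re Z :* F.⟨ X , Y ⟩) refl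

  re-⊠-comm : ∀ x y → re (x ⊠ y) ≡ re (y ⊠ x)
  re-⊠-comm x y = prove (environment x y 0ₕ) (re (X F.⊠ Y)) (re (Y F.⊠ X)) refl

  re-conjugation : ∀ x y → re (x ⊠ y ⊠ conj x) ≡ N x * re y
  re-conjugation x y = begin
    re (x ⊠ y ⊠ conj x)      ≡⟨ re-⊠-comm (x ⊠ y) (conj x) ⟩
    re (conj x ⊠ (x ⊠ y))    ≡⟨ cong re (conj⊠[x⊠y] x y) ⟩
    N x * re y               ∎
    where open ≡-Reasoning

  conj-pure : ∀ x → Pure x → conj x ≡ -1ℤ • x
  conj-pure x pure = trans (quat-≡ (trans pure (cong -_ (sym pure))) refl refl refl) (negate x)
    where
    negate : ∀ x → quat (- re x) (- im₁ x) (- im₂ x) (- im₃ x) ≡ -1ℤ • x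
    negate x = formal-identity x 0ₕ 0ₕ (quat (:- re X) (:- im₁ X) (:- im₂ X) (:- im₃ X)) (con -1ℤ F.• X) refl refl refl refl

  x⊠conj-pure : ∀ x y → Pure y → x ⊠ conj y ≡ -1ℤ • (x ⊠ y)
  x⊠conj-pure x y pure = trans (cong (x ⊠_) (conj-pure y pure)) (•-⊠ʳ -1ℤ x y)

  pure-square : ∀ x → Pure x → x ⊠ x ≡ (-1ℤ * N x) • 1ₕ
  pure-square x pure = begin
    x ⊠ x                        ≡⟨ 1•-identity (x ⊠ x) ⟨
    (-1ℤ * -1ℤ) • (x ⊠ x)        ≡⟨ •-assoc -1ℤ -1ℤ (x ⊠ x) ⟨
    -1ℤ • -1ℤ • (x ⊠ x)          ≡⟨ cong (-1ℤ •_) (x⊠conj-pure x x pure) ⟨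
    -1ℤ • (x ⊠ conj x)           ≡⟨ cong (-1ℤ •_) (x⊠conj x) ⟩
    -1ℤ • N x • 1ₕ               ≡⟨ •-assoc -1ℤ (N x) 1ₕ ⟩
    (-1ℤ * N x) • 1ₕ             ∎
    where open ≡-Reasoning

  x≡trace⊟conj : ∀ x → x ≡ (+ 2 * re x) • 1ₕ ⊟ conj x
  x≡trace⊟conj x = formal-identity x 0ₕ 0ₕ X ((con (+ 2) :* re X) F.• 1ᶠ F.⊟ F.conj X) refl refl refl refl

  infix 4 _∣ₕ_ _∣ₕ?_

  record _∣ₕ_ (n : ℤ) (x : ℍ) : Set where
    constructor dividesₕ
    field
      quotientₕ : ℍ
      equalityₕ : x ≡ n • quotientₕ

  coordinates : ∀ {n x} → n ∣ re x → n ∣ im₁ x → n ∣ im₂ x → n ∣ im₃ x → n ∣ₕ x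
  coordinates {n} (divides a e) (divides b f) (divides c g) (divides d h) =
    dividesₕ (quat a b c d) (quat-≡ (trans e (*-comm a n)) (trans f (*-comm b n)) (trans g (*-comm c n)) (trans h (*-comm d n)))

  coordinate : ∀ {n x} (π : ℍ → ℤ) → (∀ n y → π (n • y) ≡ n * π y) → n ∣ₕ x → n ∣ π x
  coordinate {n} π homo (dividesₕ y e) = divides (π y) (trans (cong π e) (trans (homo n y) (*-comm n (π y))))

  ∣re : ∀ {n x} → n ∣ₕ x → n ∣ re x
  ∣re = coordinate re (λ _ _ → refl)

  ∣im₁ : ∀ {n x} → n ∣ₕ x → n ∣ im₁ x
  ∣im₁ = coordinate im₁ (λ _ _ → refl)

  ∣im₂ : ∀ {n x} → n ∣ₕ x → n ∣ im₂ x
  ∣im₂ = coordinate im₂ (λ _ _ → refl)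

  ∣im₃ : ∀ {n x} → n ∣ₕ x → n ∣ im₃ x
  ∣im₃ = coordinate im₃ (λ _ _ → refl)

  _∣ₕ?_ : ∀ n x → Dec (n ∣ₕ x)
  n ∣ₕ? x = map′ (λ (a , b , c , d) → coordinates a b c d) (λ h → ∣re h , ∣im₁ h , ∣im₂ h , ∣im₃ h)
    (n ∣? re x ×-dec n ∣? im₁ x ×-dec n ∣? im₂ x ×-dec n ∣? im₃ x)

  ∣ₕ-⊠ˡ : ∀ {n x} y → n ∣ₕ x → n ∣ₕ y ⊠ x
  ∣ₕ-⊠ˡ {n} y (dividesₕ q refl) = dividesₕ (y ⊠ q) (•-⊠ʳ n y q)

  ∣ₕ-⊠ʳ : ∀ {n x} y → n ∣ₕ x → n ∣ₕ x ⊠ y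
  ∣ₕ-⊠ʳ {n} y (dividesₕ q refl) = dividesₕ (q ⊠ y) (•-⊠ˡ n q y)

  ∣ₕ-• : ∀ {n x} m → n ∣ₕ x → n ∣ₕ m • x
  ∣ₕ-• {n} m (dividesₕ q refl) = dividesₕ (m • q) (•-comm m n q)

  ∣⇒∣ₕ : ∀ {n m} x → n ∣ m → n ∣ₕ m • x
  ∣⇒∣ₕ {n} x (divides q refl) = dividesₕ (q • x) (trans (cong (_• x) (*-comm q n)) (sym (•-assoc n q x)))

  ∣ₕ-conj : ∀ {n x} → n ∣ₕ x → n ∣ₕ conj x
  ∣ₕ-conj {n} (dividesₕ q refl) = dividesₕ (conj q) (conj-• n q)

  ∣ₕ-conj⁻ : ∀ {n x} → n ∣ₕ conj x → n ∣ₕ x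
  ∣ₕ-conj⁻ {n} {x} h = subst (n ∣ₕ_) (conj-involutive x) (∣ₕ-conj h)

  ∣ₕ-⊞ : ∀ {n x y} → n ∣ₕ x → n ∣ₕ y → n ∣ₕ x ⊞ y
  ∣ₕ-⊞ {n} (dividesₕ (quat a b c d) refl) (dividesₕ (quat a′ b′ c′ d′) refl) =
    dividesₕ (quat a b c d ⊞ quat a′ b′ c′ d′)
      (quat-≡ (sym (*-distribˡ-+ n a a′)) (sym (*-distribˡ-+ n b b′)) (sym (*-distribˡ-+ n c c′)) (sym (*-distribˡ-+ n d d′)))

  x⊟y≡x⊞-y : ∀ x y → x ⊟ y ≡ x ⊞ -1ℤ • y
  x⊟y≡x⊞-y x y = formal-identity x y 0ₕ (X F.⊟ Y) (X F.⊞ con -1ℤ F.• Y) refl refl refl refl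

  ∣ₕ-⊟ : ∀ {n x y} → n ∣ₕ x → n ∣ₕ y → n ∣ₕ x ⊟ y
  ∣ₕ-⊟ {n} {x} {y} h h′ = subst (n ∣ₕ_) (sym (x⊟y≡x⊞-y x y)) (∣ₕ-⊞ h (∣ₕ-• -1ℤ h′))

  ∣ₕ-neg⁻ : ∀ {n x} → n ∣ₕ -1ℤ • x → n ∣ₕ x
  ∣ₕ-neg⁻ {n} {x} h = subst (n ∣ₕ_) (trans (•-assoc -1ℤ -1ℤ x) (1•-identity x)) (∣ₕ-• -1ℤ h)

  ∣ₕ-pure-square : ∀ {n} x → Pure x → n ∣ N x → n ∣ₕ x ⊠ x
  ∣ₕ-pure-square {n} x pure n∣N = subst (n ∣ₕ_) (sym (pure-square x pure)) (∣⇒∣ₕ 1ₕ (∣n⇒∣m*n -1ℤ n∣N))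

  N-∣ₕ : ∀ {n x} → n ∣ₕ x → n * n ∣ N x
  N-∣ₕ {n} (dividesₕ y refl) = divides (N y) (trans (N-• n y) (*-comm (n * n) (N y)))

  module _ {p : ℕ} (pr : Prime p) where

    •-cancel-∣ₕ : ∀ n x → ¬ + p ∣ n → + p ∣ₕ n • x → + p ∣ₕ x
    •-cancel-∣ₕ n x p∤n h = coordinates (cancel (re x) (∣re h)) (cancel (im₁ x) (∣im₁ h))
                                        (cancel (im₂ x) (∣im₂ h)) (cancel (im₃ x) (∣im₃ h))
      where
      cancel : ∀ z → + p ∣ n * z → + p ∣ z
      cancel z p∣ with euclidsLemmaℤ pr n z p∣
      ... | inj₁ p∣n = contradiction p∣n p∤n
      ... | inj₂ p∣z = p∣z

-- The descent of Euler and Lagrange for annihilators.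

module Descent where

  open Quaternion
  open import Data.Integer.Base
  open import Data.Integer.DivMod using (_%ℕ_; _/ℕ_; n%ℕd<d; a≡a%ℕn+[a/ℕn]*n)
  open import Data.Integer.Divisibility.Signed
  open import Data.Integer.Properties
  open import Data.Integer.Solver using (module +-*-Solver)
  open import Data.Integer.Tactic.RingSolver using (solve-∀)
  open import Data.Nat.Base using (z<s; s<s)
  open import Data.Nat.Induction using (<-wellFounded)
  open import Data.Product.Base using (_×_)
  open import Induction.WellFounded using (Acc; acc)
  open import Relation.Binary.PropositionalEquality

  open +-*-Solver using (prove; con; _:+_; _:*_; _:-_)

  square-≤ : ∀ {t m} → t ℕ.+ t ℕ.≤ m → + 4 * (+ t * + t) ≤ + m * + m
  square-≤ {t} {m} 2t≤m = begin
    + 4 * (+ t * + t)          ≡⟨ expand (+ t) ⟩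
    (+ t + + t) * (+ t + + t)  ≡⟨ pos-* (t ℕ.+ t) (t ℕ.+ t) ⟨
    + ((t ℕ.+ t) ℕ.* (t ℕ.+ t)) ≤⟨ +≤+ (ℕ.*-mono-≤ 2t≤m 2t≤m) ⟩
    + (m ℕ.* m)                ≡⟨ pos-* m m ⟩
    + m * + m                  ∎
    where
    open ≤-Reasoning
    expand : ∀ t → + 4 * (t * t) ≡ (t + t) * (t + t)
    expand = solve-∀

  abstract
    -- The absolutely least remainder, of size at most m/2. The bound is squared and multiplied by
    -- 4, because it will be summed into a norm.
    nearest-multiple : ∀ m .{{_ : ℕ.NonZero m}} x → ∃ λ k → + 4 * ((x - + m * k) * (x - + m * k)) ≤ + m * + m
    nearest-multiple m x with (x %ℕ m) ℕ.+ (x %ℕ m) ℕ.≤? m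
    ... | yes small = x /ℕ m , subst (λ z → + 4 * (z * z) ≤ + m * + m) (sym remainder) (square-≤ {x %ℕ m} {m} small)
      where
      remainder : x - + m * (x /ℕ m) ≡ + (x %ℕ m)
      remainder = trans (cong (_- + m * (x /ℕ m)) (a≡a%ℕn+[a/ℕn]*n x m)) (cancel (+ (x %ℕ m)) (x /ℕ m) (+ m))
        where
        cancel : ∀ r q m → r + q * m - m * q ≡ r
        cancel = solve-∀
    ... | no large = x /ℕ m + 1ℤ , subst (λ z → z ≤ + m * + m) (sym remainder) (square-≤ {m ℕ.∸ r} {m} small)
      where
      r : ℕ
      r = x %ℕ m
      r≤m : r ℕ.≤ m
      r≤m = ℕ.<⇒≤ (n%ℕd<d x m)
      small : (m ℕ.∸ r) ℕ.+ (m ℕ.∸ r) ℕ.≤ m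
      small = ℕ.≤-trans (ℕ.+-monoʳ-≤ (m ℕ.∸ r) (ℕ.m≤n+o⇒m∸n≤o m r (ℕ.<⇒≤ (ℕ.≰⇒> large)))) (ℕ.≤-reflexive (ℕ.m∸n+n≡m r≤m))
      remainder : + 4 * ((x - + m * (x /ℕ m + 1ℤ)) * (x - + m * (x /ℕ m + 1ℤ))) ≡ + 4 * (+ (m ℕ.∸ r) * + (m ℕ.∸ r))
      remainder = begin
        + 4 * ((x - + m * (x /ℕ m + 1ℤ)) * (x - + m * (x /ℕ m + 1ℤ)))
          ≡⟨ cong (λ z → + 4 * ((z - + m * (x /ℕ m + 1ℤ)) * (z - + m * (x /ℕ m + 1ℤ)))) (a≡a%ℕn+[a/ℕn]*n x m) ⟩
        + 4 * ((+ r + (x /ℕ m) * + m - + m * (x /ℕ m + 1ℤ)) * (+ r + (x /ℕ m) * + m - + m * (x /ℕ m + 1ℤ)))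
          ≡⟨ flip (+ r) (x /ℕ m) (+ m) ⟩
        + 4 * ((+ m - + r) * (+ m - + r))
          ≡⟨ cong (λ z → + 4 * (z * z)) (trans (m-n≡m⊖n m r) (⊖-≥ r≤m)) ⟩
        + 4 * (+ (m ℕ.∸ r) * + (m ℕ.∸ r)) ∎
        where
        open ≡-Reasoning
        flip : ∀ r q m → + 4 * ((r + q * m - m * (q + 1ℤ)) * (r + q * m - m * (q + 1ℤ))) ≡ + 4 * ((m - r) * (m - r))
        flip = solve-∀

  0≤square : ∀ x → 0ℤ ≤ x * x
  0≤square (+ n)    = subst (0ℤ ≤_) (pos-* n n) (+≤+ z≤n)
  0≤square -[1+ n ] = +≤+ z≤n

  0≤N : ∀ x → 0ℤ ≤ N x
  0≤N (quat a b c d) = +-mono-≤ (+-mono-≤ (+-mono-≤ (0≤square a) (0≤square b)) (0≤square c)) (0≤square d)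

  square≡0 : ∀ x → x * x ≡ 0ℤ → x ≡ 0ℤ
  square≡0 x e with i*j≡0⇒i≡0∨j≡0 x e
  ... | inj₁ x≡0 = x≡0
  ... | inj₂ x≡0 = x≡0

  module _ {M : ℤ} where

    -- Serves the boundary of the descent, where every remainder is ±m/2, and, with M = 0 and
    -- negated squares, the definiteness of the norm.
    extremal : ∀ {a b c d} → a ≤ M → b ≤ M → c ≤ M → d ≤ M → a + b + c + d ≡ M + M + M + M →
               a ≡ M × b ≡ M × c ≡ M × d ≡ M
    extremal {a} {b} {c} {d} a≤ b≤ c≤ d≤ e =
      equal a≤ (λ a< → <⇒≢ (+-mono-<-≤ (+-mono-<-≤ (+-mono-<-≤ a< b≤) c≤) d≤) e) ,
      equal b≤ (λ b< → <⇒≢ (+-mono-<-≤ (+-mono-<-≤ (+-mono-≤-< a≤ b<) c≤) d≤) e) ,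
      equal c≤ (λ c< → <⇒≢ (+-mono-<-≤ (+-mono-≤-< (+-mono-≤ a≤ b≤) c<) d≤) e) ,
      equal d≤ (λ d< → <⇒≢ (+-mono-≤-< (+-mono-≤ (+-mono-≤ a≤ b≤) c≤) d<) e)
      where
      equal : ∀ {x} → x ≤ M → ¬ x < M → x ≡ M
      equal x≤M x≮M = ≤-antisym x≤M (≮⇒≥ x≮M)

  N≡0⇒≡0 : ∀ x → N x ≡ 0ℤ → x ≡ quat 0ℤ 0ℤ 0ℤ 0ℤ
  N≡0⇒≡0 (quat a b c d) e =
    let a≡ , b≡ , c≡ , d≡ = extremal {0ℤ} (nonpos a) (nonpos b) (nonpos c) (nonpos d)
                              (trans (expand (a * a) (b * b) (c * c) (d * d)) (cong -_ e))
    in quat-≡ (zero′ a a≡) (zero′ b b≡) (zero′ c c≡) (zero′ d d≡)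
    where
    nonpos : ∀ x → - (x * x) ≤ 0ℤ
    nonpos x = neg-mono-≤ (0≤square x)
    expand : ∀ a b c d → - a + - b + - c + - d ≡ - (a + b + c + d)
    expand = solve-∀
    zero′ : ∀ x → - (x * x) ≡ 0ℤ → x ≡ 0ℤ
    zero′ x e = square≡0 x (neg-injective e)

  difference-of-squares : ∀ x m → (+ 2 * x - m) * (+ 2 * x + m) ≡ + 4 * (x * x) - m * m
  difference-of-squares = solve-∀

  square-equal : ∀ m x → + 4 * (x * x) ≡ m * m → m ∣ + 2 * x
  square-equal m x e with i*j≡0⇒i≡0∨j≡0 (+ 2 * x - m) (trans (difference-of-squares x m) (trans (cong (_- m * m) e) (+-inverseʳ (m * m))))
  ... | inj₁ z = divides 1ℤ (trans (split x m) (trans (cong (_+ m) z) (trans (+-identityˡ m) (sym (*-identityˡ m)))))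
    where
    split : ∀ x m → + 2 * x ≡ + 2 * x - m + m
    split = solve-∀
  ... | inj₂ z = divides -1ℤ (trans (split x m) (trans (cong (_- m) z) (collect m)))
    where
    split : ∀ x m → + 2 * x ≡ + 2 * x + m - m
    split = solve-∀
    collect : ∀ m → 0ℤ - m ≡ -1ℤ * m
    collect = solve-∀

  ⟨⊟•,⟩ : ∀ m x y → ⟨ x ⊟ m • y , y ⟩ ≡ ⟨ x , y ⟩ - m * N y
  ⟨⊟•,⟩ m x y = prove (environment x y (scalar m)) F.⟨ X F.⊟ re Z F.• Y , Y ⟩ (F.⟨ X , Y ⟩ :- re Z :* F.N Y) refl

  N-⊟• : ∀ m x y → N (x ⊟ m • y) ≡ N x - + 2 * (m * ⟨ x , y ⟩) + m * m * N y
  N-⊟• m x y = prove (environment x y (scalar m)) (F.N (X F.⊟ re Z F.• Y))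
    (F.N X :- con (+ 2) :* (re Z :* F.⟨ X , Y ⟩) :+ re Z :* re Z :* F.N Y) refl

  ∣2⟨⟩ : ∀ {m x} y → m ∣ + 2 * re x → m ∣ + 2 * im₁ x → m ∣ + 2 * im₂ x → m ∣ + 2 * im₃ x → m ∣ + 2 * ⟨ x , y ⟩
  ∣2⟨⟩ {m} {x} y d₀ d₁ d₂ d₃ = subst (m ∣_) (⟨⟩-•ˡ (+ 2) x y)
    (∣m∣n⇒∣m+n (∣m∣n⇒∣m+n (∣m∣n⇒∣m+n (∣m⇒∣m*n (re y) d₀) (∣m⇒∣m*n (im₁ y) d₁)) (∣m⇒∣m*n (im₂ y) d₂)) (∣m⇒∣m*n (im₃ y) d₃))

  nonNegative-quotient : ∀ m .{{_ : Positive m}} {x} q → x ≡ m * q → 0ℤ ≤ x → ∃ λ t → q ≡ + t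
  nonNegative-quotient m (+ t)    e 0≤x = t , refl
  nonNegative-quotient m -[1+ t ] refl 0≤x =
    contradiction (*-cancelˡ-≤-pos 0ℤ -[1+ t ] m (≤-trans (≤-reflexive (*-zeroʳ m)) 0≤x)) λ ()

  N-scalar-⊟ : ∀ p k γ → N (p • 1ₕ ⊟ conj k ⊠ γ) ≡ p * p - + 2 * (p * ⟨ γ , k ⟩) + N k * N γ
  N-scalar-⊟ p k γ = prove (environment k γ (scalar p)) (F.N (re Z F.• 1ᶠ F.⊟ F.conj X F.⊠ Y))
    (re Z :* re Z :- con (+ 2) :* (re Z :* F.⟨ Y , X ⟩) :+ F.N X :* F.N Y) refl

  module _ {p : ℕ} (pr : Prime p) {v : ℍ} where

    private instance
      p≢0 : ℕ.NonZero p
      p≢0 = prime⇒nonZero pr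

    private
      Annihilator : ℕ → ℍ → Set
      Annihilator m γ = N γ ≡ + m * + p × + p ∣ₕ γ ⊠ v

      module Step (m : ℕ) .{{_ : ℕ.NonZero m}} (γ : ℍ) (Nγ : N γ ≡ + m * + p) where

        k ρ : ℍ
        k = quat (proj₁ (nearest-multiple m (re γ))) (proj₁ (nearest-multiple m (im₁ γ)))
                 (proj₁ (nearest-multiple m (im₂ γ))) (proj₁ (nearest-multiple m (im₃ γ)))
        ρ = γ ⊟ + m • k

        -- N ρ / m. It becomes the cofactor of the next annihilator, whose norm is m′p.
        m′ : ℤ
        m′ = + p - + 2 * ⟨ γ , k ⟩ + + m * N k

        Nρ : N ρ ≡ + m * m′
        Nρ = begin
          N ρ                                                             ≡⟨ N-⊟• (+ m) γ k ⟩
          N γ - + 2 * (+ m * ⟨ γ , k ⟩) + + m * + m * N k                 ≡⟨ cong (λ x → x - + 2 * (+ m * ⟨ γ , k ⟩) + + m * + m * N k) Nγ ⟩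
          + m * + p - + 2 * (+ m * ⟨ γ , k ⟩) + + m * + m * N k           ≡⟨ factor (+ m) (+ p) ⟨ γ , k ⟩ (N k) ⟩
          + m * m′                                                        ∎
          where
          open ≡-Reasoning
          factor : ∀ m p t n → m * p - + 2 * (m * t) + m * m * n ≡ m * (p - + 2 * t + m * n)
          factor = solve-∀

        bound : (π : ℍ → ℤ) → (∀ x y → π (x ⊟ + m • y) ≡ π x - + m * π y) →
                π k ≡ proj₁ (nearest-multiple m (π γ)) → + 4 * (π ρ * π ρ) ≤ + m * + m
        bound π homo e = subst (λ z → + 4 * (z * z) ≤ + m * + m)
          (sym (trans (homo γ k) (cong (λ z → π γ - + m * z) e))) (proj₂ (nearest-multiple m (π γ)))

        b₀ : + 4 * (re ρ * re ρ) ≤ + m * + m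
        b₀ = bound re (λ _ _ → refl) refl
        b₁ : + 4 * (im₁ ρ * im₁ ρ) ≤ + m * + m
        b₁ = bound im₁ (λ _ _ → refl) refl
        b₂ : + 4 * (im₂ ρ * im₂ ρ) ≤ + m * + m
        b₂ = bound im₂ (λ _ _ → refl) refl
        b₃ : + 4 * (im₃ ρ * im₃ ρ) ≤ + m * + m
        b₃ = bound im₃ (λ _ _ → refl) refl

        4Nρ : ∀ x → + 4 * N x ≡ + 4 * (re x * re x) + + 4 * (im₁ x * im₁ x) + + 4 * (im₂ x * im₂ x) + + 4 * (im₃ x * im₃ x)
        4Nρ (quat a b c d) = e (a * a) (b * b) (c * c) (d * d)
          where
          e : ∀ a b c d → + 4 * (a + b + c + d) ≡ + 4 * a + + 4 * b + + 4 * c + + 4 * d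
          e = solve-∀

        four : ∀ x → x + x + x + x ≡ + 4 * x
        four = solve-∀

        m′≤m : m′ ≤ + m
        m′≤m = *-cancelˡ-≤-pos m′ (+ m) (+ m) {{pos-m}} (*-cancelˡ-≤-pos (+ m * m′) (+ m * + m) (+ 4) (begin
          + 4 * (+ m * m′)    ≡⟨ cong (+ 4 *_) Nρ ⟨
          + 4 * N ρ           ≡⟨ 4Nρ ρ ⟩
          + 4 * (re ρ * re ρ) + + 4 * (im₁ ρ * im₁ ρ) + + 4 * (im₂ ρ * im₂ ρ) + + 4 * (im₃ ρ * im₃ ρ)
                              ≤⟨ +-mono-≤ (+-mono-≤ (+-mono-≤ b₀ b₁) b₂) b₃ ⟩
          + m * + m + + m * + m + + m * + m + + m * + m
                              ≡⟨ four (+ m * + m) ⟩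
          + 4 * (+ m * + m)   ∎))
          where
          open ≤-Reasoning
          pos-m : Positive (+ m)
          pos-m = positive (+<+ (ℕ.>-nonZero⁻¹ m))

        -- Since p = m′ + 2⟨ρ, k⟩ + m N k. This disposes of both boundary cases: for m′ = 0 the
        -- remainder ρ vanishes, and for m′ = m every coordinate of 2ρ is ±m. Even and odd m are
        -- treated alike.
        ∣p : ∀ {c} → + m ∣ c → m′ ≡ c → + m ∣ + 2 * ⟨ ρ , k ⟩ → + m ∣ + p
        ∣p {c} m∣c m′≡c m∣ = subst (+ m ∣_) (sym p≡) (∣m∣n⇒∣m+n (∣m∣n⇒∣m+n m∣c m∣) (∣m⇒∣m*n (N k) ∣-refl))
          where
          open ≡-Reasoning
          p≡ : + p ≡ c + + 2 * ⟨ ρ , k ⟩ + + m * N k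
          p≡ = begin
            + p                                                    ≡⟨ expand (+ p) ⟨ γ , k ⟩ (+ m) (N k) ⟩
            m′ + + 2 * (⟨ γ , k ⟩ - + m * N k) + + m * N k          ≡⟨ cong₂ (λ x y → x + + 2 * y + + m * N k) m′≡c (sym (⟨⊟•,⟩ (+ m) γ k)) ⟩
            c + + 2 * ⟨ ρ , k ⟩ + + m * N k                         ∎
            where
            expand : ∀ p t m n → p ≡ p - + 2 * t + m * n + + 2 * (t - m * n) + m * n
            expand = solve-∀

        m′≡0⇒∣p : m′ ≡ 0ℤ → + m ∣ + p
        m′≡0⇒∣p e = ∣p (divides 0ℤ refl) e (subst (λ x → + m ∣ + 2 * ⟨ x , k ⟩)
          (sym (N≡0⇒≡0 ρ (trans Nρ (trans (cong (+ m *_) e) (*-zeroʳ (+ m))))))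
          (∣2⟨⟩ {+ m} {quat 0ℤ 0ℤ 0ℤ 0ℤ} k (divides 0ℤ refl) (divides 0ℤ refl) (divides 0ℤ refl) (divides 0ℤ refl)))

        m′≡m⇒∣p : m′ ≡ + m → + m ∣ + p
        m′≡m⇒∣p e = ∣p ∣-refl e (∣2⟨⟩ k
          (square-equal (+ m) (re ρ) (proj₁ equalities)) (square-equal (+ m) (im₁ ρ) (proj₁ (proj₂ equalities)))
          (square-equal (+ m) (im₂ ρ) (proj₁ (proj₂ (proj₂ equalities)))) (square-equal (+ m) (im₃ ρ) (proj₂ (proj₂ (proj₂ equalities)))))
          where
          total : + 4 * (re ρ * re ρ) + + 4 * (im₁ ρ * im₁ ρ) + + 4 * (im₂ ρ * im₂ ρ) + + 4 * (im₃ ρ * im₃ ρ) ≡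
                  + m * + m + + m * + m + + m * + m + + m * + m
          total = trans (sym (4Nρ ρ)) (trans (cong (+ 4 *_) (trans Nρ (cong (+ m *_) e))) (sym (four (+ m * + m))))
          equalities : + 4 * (re ρ * re ρ) ≡ + m * + m × + 4 * (im₁ ρ * im₁ ρ) ≡ + m * + m ×
                       + 4 * (im₂ ρ * im₂ ρ) ≡ + m * + m × + 4 * (im₃ ρ * im₃ ρ) ≡ + m * + m
          equalities = extremal {+ m * + m} {+ 4 * (re ρ * re ρ)} {+ 4 * (im₁ ρ * im₁ ρ)} {+ 4 * (im₂ ρ * im₂ ρ)} {+ 4 * (im₃ ρ * im₃ ρ)}
                         b₀ b₁ b₂ b₃ total

        -- This is ρ̄γ / m.
        γ′ : ℍ
        γ′ = + p • 1ₕ ⊟ conj k ⊠ γ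

        Nγ′ : N γ′ ≡ m′ * + p
        Nγ′ = trans (N-scalar-⊟ (+ p) k γ) (trans (cong (λ x → + p * + p - + 2 * (+ p * ⟨ γ , k ⟩) + N k * x) Nγ)
          (factor (+ p) ⟨ γ , k ⟩ (N k) (+ m)))
          where
          factor : ∀ p t n m → p * p - + 2 * (p * t) + n * (m * p) ≡ (p - + 2 * t + m * n) * p
          factor = solve-∀

        γ′v : + p ∣ₕ γ ⊠ v → + p ∣ₕ γ′ ⊠ v
        γ′v h = subst (+ p ∣ₕ_) (sym (⊠-distribʳ-⊟ v (+ p • 1ₕ) (conj k ⊠ γ)))
          (∣ₕ-⊟ (subst (+ p ∣ₕ_) (sym (scalar-⊠ (+ p) v)) (dividesₕ v refl))
                (subst (+ p ∣ₕ_) (sym (⊠-assoc (conj k) γ v)) (∣ₕ-⊠ˡ (conj k) h)))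

        classify : + p ∣ₕ γ ⊠ v → ∀ t → m′ ≡ + t → t ℕ.< m ⊎ t ≡ m →
                   + m ∣ + p ⊎ ∃ λ t → 0 ℕ.< t × t ℕ.< m × ∃ (Annihilator t)
        classify γv _         m′≡m (inj₂ refl) = inj₁ (m′≡m⇒∣p m′≡m)
        classify γv zero      m′≡0 (inj₁ _)    = inj₁ (m′≡0⇒∣p m′≡0)
        classify γv t@(suc _) m′≡t (inj₁ t<m)  =
          inj₂ (t , z<s , t<m , γ′ , trans Nγ′ (cong (_* + p) m′≡t) , γ′v γv)

        outcome : + p ∣ₕ γ ⊠ v → + m ∣ + p ⊎ ∃ λ t → 0 ℕ.< t × t ℕ.< m × ∃ (Annihilator t)
        outcome γv = classify γv t m′≡t (ℕ.m≤n⇒m<n∨m≡n (drop‿+≤+ (subst (_≤ + m) m′≡t m′≤m)))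
          where
          quotient≡ : ∃ λ t → m′ ≡ + t
          quotient≡ = nonNegative-quotient (+ m) {{positive (+<+ (ℕ.>-nonZero⁻¹ m))}} m′ Nρ (0≤N ρ)
          t : ℕ
          t = proj₁ quotient≡
          m′≡t : m′ ≡ + t
          m′≡t = proj₂ quotient≡

      proper-∤ : ∀ {m} → 1 ℕ.< m → m ℕ.< p → ¬ + m ∣ + p
      proper-∤ 1<m m<p m∣p with prime⇒irreducible pr (∣⇒∣ᵤ m∣p)
      ... | inj₁ refl = ℕ.<-irrefl refl 1<m
      ... | inj₂ refl = ℕ.<-irrefl refl m<p

      descend : ∀ m → Acc ℕ._<_ m → 0 ℕ.< m → m ℕ.< p → ∃ (Annihilator m) → ∃ (Annihilator 1)
      descend 1             _         _ _   ann           = ann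
      descend m@(suc (suc _)) (acc rec) _ m<p (γ , Nγ , γv) = continue (Step.outcome m γ Nγ γv)
        where
        continue : + m ∣ + p ⊎ (∃ λ t → 0 ℕ.< t × t ℕ.< m × ∃ (Annihilator t)) → ∃ (Annihilator 1)
        continue (inj₁ m∣p)                 = contradiction m∣p (proper-∤ (s<s z<s) m<p)
        continue (inj₂ (t , 0<t , t<m , ann)) = descend t (rec t<m) 0<t (ℕ.<-trans t<m m<p) ann

    -- The descent starts from v reduced modulo p: by v² = -N v it annihilates v, and it is nonzero
    -- because p does not divide v. Its vanishing real part bounds the norm by 3p²/4, so the first
    -- cofactor is below p.
    annihilator-exists : Pure v → ¬ + p ∣ₕ v → + p ∣ N v → ∃ λ γ → N γ ≡ + p × + p ∣ₕ γ ⊠ v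
    annihilator-exists pure p∤v (divides c Nv) =
      let t , m₀≡t = nonNegative-quotient (+ p) {{pos-p}} m₀ Nρ (0≤N ρ)
          γ , Nγ , γv = descend t (<-wellFounded t) (t>0 m₀≡t) (t<p m₀≡t)
                          (ρ , trans Nρ (trans (cong (+ p *_) m₀≡t) (*-comm (+ p) (+ t))) , ρv)
      in γ , trans Nγ (*-identityˡ (+ p)) , γv
      where
      k ρ : ℍ
      k = quat 0ℤ (proj₁ (nearest-multiple p (im₁ v))) (proj₁ (nearest-multiple p (im₂ v))) (proj₁ (nearest-multiple p (im₃ v)))
      ρ = v ⊟ + p • k
      m₀ : ℤ
      m₀ = c - + 2 * ⟨ v , k ⟩ + + p * N k
      pos-p : Positive (+ p)
      pos-p = positive (+<+ (ℕ.>-nonZero⁻¹ p))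
      Nρ : N ρ ≡ + p * m₀
      Nρ = trans (N-⊟• (+ p) v k) (trans (cong (λ x → x - + 2 * (+ p * ⟨ v , k ⟩) + + p * + p * N k) Nv)
        (factor (+ p) c ⟨ v , k ⟩ (N k)))
        where
        factor : ∀ p c t n → c * p - + 2 * (p * t) + p * p * n ≡ p * (c - + 2 * t + p * n)
        factor = solve-∀
      vv : + p ∣ₕ v ⊠ v
      vv = ∣ₕ-pure-square v pure (divides c Nv)
      ρv : + p ∣ₕ ρ ⊠ v
      ρv = subst (+ p ∣ₕ_) (sym (⊠-distribʳ-⊟ v v (+ p • k))) (∣ₕ-⊟ vv (∣ₕ-⊠ʳ v (dividesₕ k refl)))
      re-ρ : re ρ ≡ 0ℤ
      re-ρ = trans (cong (_- + p * 0ℤ) pure) (e (+ p))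
        where
        e : ∀ p → 0ℤ - p * 0ℤ ≡ 0ℤ
        e = solve-∀
      t>0 : ∀ {t} → m₀ ≡ + t → 0 ℕ.< t
      t>0 {suc _} _ = z<s
      t>0 {zero} m₀≡0 = contradiction (subst (+ p ∣ₕ_) (sym v≡) (dividesₕ k refl)) p∤v
        where
        ρ≡0 : ρ ≡ quat 0ℤ 0ℤ 0ℤ 0ℤ
        ρ≡0 = N≡0⇒≡0 ρ (trans Nρ (trans (cong (+ p *_) m₀≡0) (*-zeroʳ (+ p))))
        v≡ : v ≡ + p • k
        v≡ = quat-≡ (i-j≡0⇒i≡j _ _ (cong re ρ≡0)) (i-j≡0⇒i≡j _ _ (cong im₁ ρ≡0))
                    (i-j≡0⇒i≡j _ _ (cong im₂ ρ≡0)) (i-j≡0⇒i≡j _ _ (cong im₃ ρ≡0))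
      t<p : ∀ {t} → m₀ ≡ + t → t ℕ.< p
      t<p {t} m₀≡t = drop‿+<+ (*-cancelˡ-<-nonNeg (+ p) (*-cancelˡ-<-nonNeg (+ 4) (begin-strict
        + 4 * (+ p * + t)   ≡⟨ cong (λ x → + 4 * (+ p * x)) m₀≡t ⟨
        + 4 * (+ p * m₀)    ≡⟨ cong (+ 4 *_) Nρ ⟨
        + 4 * N ρ           ≡⟨ 4N ρ re-ρ ⟩
        0ℤ + + 4 * (im₁ ρ * im₁ ρ) + + 4 * (im₂ ρ * im₂ ρ) + + 4 * (im₃ ρ * im₃ ρ)
                            <⟨ +-mono-<-≤ (+-mono-<-≤ (+-mono-<-≤ 0<p² (proj₂ (nearest-multiple p (im₁ v))))
                                 (proj₂ (nearest-multiple p (im₂ v)))) (proj₂ (nearest-multiple p (im₃ v))) ⟩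
        + p * + p + + p * + p + + p * + p + + p * + p
                            ≡⟨ four (+ p * + p) ⟩
        + 4 * (+ p * + p)   ∎)))
        where
        open ≤-Reasoning
        four : ∀ x → x + x + x + x ≡ + 4 * x
        four = solve-∀
        0<p² : 0ℤ < + p * + p
        0<p² = subst (_< + p * + p) (*-zeroʳ (+ p)) (*-monoˡ-<-pos (+ p) {{pos-p}} (+<+ (ℕ.>-nonZero⁻¹ p)))
        4N : ∀ x → re x ≡ 0ℤ → + 4 * N x ≡ 0ℤ + + 4 * (im₁ x * im₁ x) + + 4 * (im₂ x * im₂ x) + + 4 * (im₃ x * im₃ x)
        4N (quat _ b c d) refl = e (b * b) (c * c) (d * d)
          where
          e : ∀ b c d → + 4 * (0ℤ + b + c + d) ≡ 0ℤ + + 4 * b + + 4 * c + + 4 * d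
          e = solve-∀

-- Annihilation modulo p and divisibility by p².

module Annihilator where

  open IntegerPrimes
  open Quaternion
  open import Data.Integer.Base
  open import Data.Integer.Divisibility.Signed
  open import Data.Integer.Properties
  open import Data.Integer.Solver using (module +-*-Solver)
  open import Data.Integer.Tactic.RingSolver using (solve-∀)
  open import Relation.Binary.PropositionalEquality

  open +-*-Solver using (prove; con)

  i₁ i₂ i₃ : ℍ
  i₁ = quat 0ℤ 1ℤ 0ℤ 0ℤ
  i₂ = quat 0ℤ 0ℤ 1ℤ 0ℤ
  i₃ = quat 0ℤ 0ℤ 0ℤ 1ℤ

  ⟨,1⟩ : ∀ v → ⟨ v , 1ₕ ⟩ ≡ re v
  ⟨,1⟩ v = prove (environment v 0ₕ 0ₕ) F.⟨ X , 1ᶠ ⟩ (re X) refl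

  ⟨,i₁⟩ : ∀ v → ⟨ v , i₁ ⟩ ≡ im₁ v
  ⟨,i₁⟩ v = prove (environment v 0ₕ 0ₕ) F.⟨ X , quat (con 0ℤ) (con 1ℤ) (con 0ℤ) (con 0ℤ) ⟩ (im₁ X) refl

  ⟨,i₂⟩ : ∀ v → ⟨ v , i₂ ⟩ ≡ im₂ v
  ⟨,i₂⟩ v = prove (environment v 0ₕ 0ₕ) F.⟨ X , quat (con 0ℤ) (con 0ℤ) (con 1ℤ) (con 0ℤ) ⟩ (im₂ X) refl

  ⟨,i₃⟩ : ∀ v → ⟨ v , i₃ ⟩ ≡ im₃ v
  ⟨,i₃⟩ v = prove (environment v 0ₕ 0ₕ) F.⟨ X , quat (con 0ℤ) (con 0ℤ) (con 0ℤ) (con 1ℤ) ⟩ (im₃ X) refl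

  module _ {p : ℕ} (pr : Prime p) (odd : ¬ + p ∣ + 2) where

    ∣2*⇒∣ : ∀ x → + p ∣ + 2 * x → + p ∣ x
    ∣2*⇒∣ x p∣2x with euclidsLemmaℤ pr (+ 2) x p∣2x
    ... | inj₁ p∣2 = contradiction p∣2 odd
    ... | inj₂ p∣x = p∣x

    -- Modulo p, α and β are singular 2×2 matrices whose common kernel is the image of the adjugate ᾱ.
    common-annihilator : ∀ v α β → ¬ + p ∣ₕ v → + p ∣ₕ α ⊠ v → + p ∣ₕ β ⊠ v → + p ∣ₕ β ⊠ conj α
    common-annihilator v α β p∤v αv βv = cases (+ p ∣? re v) (+ p ∣? im₁ v) (+ p ∣? im₂ v) (+ p ∣? im₃ v)
      where
      -- Polarization gives β(v w̄ + w v̄)ᾱ = 2⟨v, w⟩ βᾱ for every w, and both summands on the left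
      -- vanish modulo p. A basis quaternion w makes ⟨v, w⟩ a coordinate of v prime to p.
      from-coordinate : ∀ w n → ⟨ v , w ⟩ ≡ n → ¬ + p ∣ n → + p ∣ₕ β ⊠ conj α
      from-coordinate w n refl p∤n = •-cancel-∣ₕ pr (+ 2 * n) (β ⊠ conj α) (λ d → p∤n (∣2*⇒∣ n d))
        (subst (+ p ∣ₕ_) expand (∣ₕ-⊞ (∣ₕ-⊠ʳ (conj w ⊠ conj α) βv) (∣ₕ-⊠ˡ (β ⊠ w) (∣ₕ-conj αv))))
        where
        open ≡-Reasoning
        rearrange : ∀ v w → (β ⊠ v) ⊠ (w ⊠ conj α) ≡ β ⊠ (v ⊠ w) ⊠ conj α
        rearrange v w = trans (sym (⊠-assoc (β ⊠ v) w (conj α))) (cong (_⊠ conj α) (⊠-assoc β v w))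
        expand : (β ⊠ v) ⊠ (conj w ⊠ conj α) ⊞ (β ⊠ w) ⊠ conj (α ⊠ v) ≡ (+ 2 * n) • (β ⊠ conj α)
        expand = begin
          (β ⊠ v) ⊠ (conj w ⊠ conj α) ⊞ (β ⊠ w) ⊠ conj (α ⊠ v)
            ≡⟨ cong (λ z → (β ⊠ v) ⊠ (conj w ⊠ conj α) ⊞ (β ⊠ w) ⊠ z) (conj-⊠ α v) ⟩
          (β ⊠ v) ⊠ (conj w ⊠ conj α) ⊞ (β ⊠ w) ⊠ (conj v ⊠ conj α)
            ≡⟨ cong₂ _⊞_ (rearrange v (conj w)) (rearrange w (conj v)) ⟩
          β ⊠ (v ⊠ conj w) ⊠ conj α ⊞ β ⊠ (w ⊠ conj v) ⊠ conj α
            ≡⟨ ⊠-distribʳ (conj α) (β ⊠ (v ⊠ conj w)) (β ⊠ (w ⊠ conj v)) ⟨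
          (β ⊠ (v ⊠ conj w) ⊞ β ⊠ (w ⊠ conj v)) ⊠ conj α
            ≡⟨ cong (_⊠ conj α) (⊠-distribˡ β (v ⊠ conj w) (w ⊠ conj v)) ⟨
          β ⊠ (v ⊠ conj w ⊞ w ⊠ conj v) ⊠ conj α
            ≡⟨ cong (λ z → β ⊠ z ⊠ conj α) (polarization v w) ⟩
          β ⊠ ((+ 2 * n) • 1ₕ) ⊠ conj α
            ≡⟨ cong (_⊠ conj α) (⊠-scalar (+ 2 * n) β) ⟩
          ((+ 2 * n) • β) ⊠ conj α
            ≡⟨ •-⊠ˡ (+ 2 * n) β (conj α) ⟩
          (+ 2 * n) • (β ⊠ conj α) ∎
      cases : Dec (+ p ∣ re v) → Dec (+ p ∣ im₁ v) → Dec (+ p ∣ im₂ v) → Dec (+ p ∣ im₃ v) → + p ∣ₕ β ⊠ conj α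
      cases (no p∤)  _        _        _        = from-coordinate 1ₕ (re v) (⟨,1⟩ v) p∤
      cases _        (no p∤)  _        _        = from-coordinate i₁ (im₁ v) (⟨,i₁⟩ v) p∤
      cases _        _        (no p∤)  _        = from-coordinate i₂ (im₂ v) (⟨,i₂⟩ v) p∤
      cases _        _        _        (no p∤)  = from-coordinate i₃ (im₃ v) (⟨,i₃⟩ v) p∤
      cases (yes d₀) (yes d₁) (yes d₂) (yes d₃) = contradiction (coordinates d₀ d₁ d₂ d₃) p∤v

    -- Let δ = αy be nonzero modulo p. Then δ² ≡ 0 and N δ ≡ 0 force its trace to vanish, so δ̄ ≡
    -- -δ, and both y and α annihilate δ from the left. By `common-annihilator` αȳ = -αy ≡ 0, a
    -- contradiction.
    sandwich : ∀ {α y} → Pure y → + p ∣ N y → + p ∣ₕ α ⊠ y ⊠ conj α → + p ∣ₕ α ⊠ y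
    sandwich {α} {y} pure p∣Ny δᾱ = decidable-stable (+ p ∣ₕ? δ) λ p∤δ →
      p∤δ (∣ₕ-neg⁻ (subst (+ p ∣ₕ_) (x⊠conj-pure α y pure)
        (common-annihilator δ y α p∤δ (yδ (p∣t p∤δ)) (αδ (p∣t p∤δ)))))
      where
      δ : ℍ
      δ = α ⊠ y
      t : ℤ
      t = + 2 * re δ
      trace : ∀ x y → x ⊠ y ≡ (+ 2 * re y) • x ⊟ x ⊠ conj y
      trace x y = trans (cong (x ⊠_) (x≡trace⊟conj y)) (trans (⊠-distribˡ-⊟ x ((+ 2 * re y) • 1ₕ) (conj y))
        (cong (_⊟ x ⊠ conj y) (⊠-scalar (+ 2 * re y) x)))
      δy : + p ∣ₕ δ ⊠ y
      δy = subst (+ p ∣ₕ_) (sym (⊠-assoc α y y)) (∣ₕ-⊠ˡ α (∣ₕ-pure-square y pure p∣Ny))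
      δδ : + p ∣ₕ δ ⊠ δ
      δδ = subst (+ p ∣ₕ_) (sym (begin
        δ ⊠ (α ⊠ y)                                  ≡⟨ ⊠-assoc δ α y ⟨
        δ ⊠ α ⊠ y                                    ≡⟨ cong (_⊠ y) (trace δ α) ⟩
        ((+ 2 * re α) • δ ⊟ δ ⊠ conj α) ⊠ y          ≡⟨ ⊠-distribʳ-⊟ y ((+ 2 * re α) • δ) (δ ⊠ conj α) ⟩
        ((+ 2 * re α) • δ) ⊠ y ⊟ δ ⊠ conj α ⊠ y      ≡⟨ cong (_⊟ δ ⊠ conj α ⊠ y) (•-⊠ˡ (+ 2 * re α) δ y) ⟩
        (+ 2 * re α) • (δ ⊠ y) ⊟ δ ⊠ conj α ⊠ y      ∎))
        (∣ₕ-⊟ (∣ₕ-• (+ 2 * re α) δy) (∣ₕ-⊠ʳ y δᾱ))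
        where open ≡-Reasoning
      tδ : + p ∣ₕ t • δ
      tδ = subst (+ p ∣ₕ_) (sym (begin
        t • δ                                        ≡⟨ x⊟y⊞y (t • δ) (δ ⊠ conj δ) ⟨
        t • δ ⊟ δ ⊠ conj δ ⊞ δ ⊠ conj δ              ≡⟨ cong₂ _⊞_ (sym (trace δ δ)) (x⊠conj δ) ⟩
        δ ⊠ δ ⊞ N δ • 1ₕ                             ∎))
        (∣ₕ-⊞ δδ (∣⇒∣ₕ 1ₕ (subst (+ p ∣_) (sym (N-⊠ α y)) (∣n⇒∣m*n (N α) p∣Ny))))
        where open ≡-Reasoning
      p∣t : ¬ + p ∣ₕ δ → + p ∣ t
      p∣t p∤δ = decidable-stable (+ p ∣? t) λ p∤t → p∤δ (•-cancel-∣ₕ pr t δ p∤t tδ)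
      yδ̄ : + p ∣ₕ y ⊠ conj δ
      yδ̄ = subst (+ p ∣ₕ_) (begin
        -1ℤ • conj (δ ⊠ y)              ≡⟨ cong (-1ℤ •_) (conj-⊠ δ y) ⟩
        -1ℤ • (conj y ⊠ conj δ)         ≡⟨ •-⊠ˡ -1ℤ (conj y) (conj δ) ⟨
        (-1ℤ • conj y) ⊠ conj δ         ≡⟨ cong (_⊠ conj δ) (trans (cong (-1ℤ •_) (conj-pure y pure)) (trans (•-assoc -1ℤ -1ℤ y) (1•-identity y))) ⟩
        y ⊠ conj δ                      ∎) (∣ₕ-• -1ℤ (∣ₕ-conj δy))
        where open ≡-Reasoning
      yδ : + p ∣ t → + p ∣ₕ y ⊠ δ
      yδ d = subst (+ p ∣ₕ_) (sym (trace y δ)) (∣ₕ-⊟ (∣⇒∣ₕ y d) yδ̄)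
      αδ̄ : + p ∣ₕ α ⊠ conj δ
      αδ̄ = subst (+ p ∣ₕ_) (trans (conj-⊠ δ (conj α)) (cong (_⊠ conj δ) (conj-involutive α))) (∣ₕ-conj δᾱ)
      αδ : + p ∣ t → + p ∣ₕ α ⊠ δ
      αδ d = subst (+ p ∣ₕ_) (sym (trace α δ)) (∣ₕ-⊟ (∣⇒∣ₕ α d) αδ̄)

    private instance
      p≢0 : ℕ.NonZero p
      p≢0 = prime⇒nonZero pr

    •-cancel-square : ∀ {x} → + p * + p ∣ₕ + p • x → + p ∣ₕ x
    •-cancel-square {x} (dividesₕ q e) = dividesₕ q (•-cancelˡ (+ p) (trans e (sym (•-assoc (+ p) (+ p) q))))

    -- Write αx = pβ, so that x = ᾱβ and the claim becomes p ∣ δ for δ = βᾱ. Here ᾱδ = xᾱ ≡ 0, and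
    -- p² ∣ N x gives βx ≡ 0, hence β̄δ ≡ 0. If δ were nonzero modulo p, its two annihilators would
    -- yield β̄α = x̄ ≡ 0.
    lift : ∀ {α x m} → Pure x → ¬ + p ∣ₕ x → N x ≡ + p * + p * m → N α ≡ + p →
           + p ∣ₕ α ⊠ x → + p * + p ∣ₕ α ⊠ x ⊠ conj α
    lift {α} {x} {m} pure p∤x Nx Nα (dividesₕ β αx) =
      let dividesₕ γ δ≡ = p∣δ in dividesₕ γ (begin
        α ⊠ x ⊠ conj α             ≡⟨ cong (_⊠ conj α) αx ⟩
        (+ p • β) ⊠ conj α         ≡⟨ •-⊠ˡ (+ p) β (conj α) ⟩
        + p • δ                    ≡⟨ cong (+ p •_) δ≡ ⟩
        + p • + p • γ              ≡⟨ •-assoc (+ p) (+ p) γ ⟩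
        (+ p * + p) • γ            ∎)
      where
      open ≡-Reasoning
      δ : ℍ
      δ = β ⊠ conj α
      x≡ᾱβ : x ≡ conj α ⊠ β
      x≡ᾱβ = •-cancelˡ (+ p) (begin
        + p • x                    ≡⟨ cong (_• x) Nα ⟨
        N α • x                    ≡⟨ conj⊠[x⊠y] α x ⟨
        conj α ⊠ (α ⊠ x)           ≡⟨ cong (conj α ⊠_) αx ⟩
        conj α ⊠ (+ p • β)         ≡⟨ •-⊠ʳ (+ p) (conj α) β ⟩
        + p • (conj α ⊠ β)         ∎)
      pure-δ : Pure δ
      pure-δ = trans (re-⊠-comm β (conj α)) (trans (cong re (sym x≡ᾱβ)) pure)
      ᾱδ : + p ∣ₕ conj α ⊠ δ
      ᾱδ = subst (+ p ∣ₕ_) (begin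
        -1ℤ • conj (α ⊠ x)         ≡⟨ cong (-1ℤ •_) (conj-⊠ α x) ⟩
        -1ℤ • (conj x ⊠ conj α)    ≡⟨ •-⊠ˡ -1ℤ (conj x) (conj α) ⟨
        (-1ℤ • conj x) ⊠ conj α    ≡⟨ cong (_⊠ conj α) (trans (cong (-1ℤ •_) (conj-pure x pure)) (trans (•-assoc -1ℤ -1ℤ x) (1•-identity x))) ⟩
        x ⊠ conj α                 ≡⟨ cong (_⊠ conj α) x≡ᾱβ ⟩
        conj α ⊠ β ⊠ conj α        ≡⟨ ⊠-assoc (conj α) β (conj α) ⟩
        conj α ⊠ δ                 ∎) (∣ₕ-• -1ℤ (∣ₕ-conj (dividesₕ β αx)))
      βx : β ⊠ x ≡ + p • (-1ℤ * m) • α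
      βx = •-cancelˡ (+ p) (begin
        + p • (β ⊠ x)              ≡⟨ •-⊠ˡ (+ p) β x ⟨
        (+ p • β) ⊠ x              ≡⟨ cong (_⊠ x) αx ⟨
        α ⊠ x ⊠ x                  ≡⟨ ⊠-assoc α x x ⟩
        α ⊠ (x ⊠ x)                ≡⟨ cong (α ⊠_) (pure-square x pure) ⟩
        α ⊠ ((-1ℤ * N x) • 1ₕ)     ≡⟨ ⊠-scalar (-1ℤ * N x) α ⟩
        (-1ℤ * N x) • α            ≡⟨ cong (λ n → (-1ℤ * n) • α) Nx ⟩
        (-1ℤ * (+ p * + p * m)) • α ≡⟨ cong (_• α) (reorder (+ p) m) ⟩
        (+ p * (+ p * (-1ℤ * m))) • α ≡⟨ •-assoc (+ p) (+ p * (-1ℤ * m)) α ⟨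
        + p • (+ p * (-1ℤ * m)) • α ≡⟨ cong (+ p •_) (•-assoc (+ p) (-1ℤ * m) α) ⟨
        + p • + p • (-1ℤ * m) • α  ∎)
        where
        reorder : ∀ p m → -1ℤ * (p * p * m) ≡ p * (p * (-1ℤ * m))
        reorder = solve-∀
      β̄δ : + p ∣ₕ conj β ⊠ δ
      β̄δ = ∣ₕ-neg⁻ (subst (+ p ∣ₕ_) (begin
        conj (β ⊠ x)               ≡⟨ cong (λ z → conj (β ⊠ z)) x≡ᾱβ ⟩
        conj (β ⊠ (conj α ⊠ β))    ≡⟨ cong conj (⊠-assoc β (conj α) β) ⟨
        conj (δ ⊠ β)               ≡⟨ conj-⊠ δ β ⟩
        conj β ⊠ conj δ            ≡⟨ x⊠conj-pure (conj β) δ pure-δ ⟩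
        -1ℤ • (conj β ⊠ δ)         ∎) (∣ₕ-conj (dividesₕ ((-1ℤ * m) • α) βx)))
      p∣δ : + p ∣ₕ δ
      p∣δ = decidable-stable (+ p ∣ₕ? δ) λ p∤δ → p∤x (∣ₕ-conj⁻ (subst (+ p ∣ₕ_) (begin
        conj β ⊠ conj (conj α)     ≡⟨ conj-⊠ (conj α) β ⟨
        conj (conj α ⊠ β)          ≡⟨ cong conj x≡ᾱβ ⟨
        conj x                     ∎) (common-annihilator δ (conj α) (conj β) p∤δ ᾱδ β̄δ)))

    record Reduction (x : ℍ) : Set where
      field
        v           : ℍ
        pure        : Pure v
        indivisible : ¬ + p ∣ₕ v
        isotropic   : + p ∣ N v
        to          : ∀ {α} → N α ≡ + p → + p * + p ∣ₕ α ⊠ x ⊠ conj α → + p ∣ₕ α ⊠ v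
        from        : ∀ {α} → N α ≡ + p → + p ∣ₕ α ⊠ v → + p * + p ∣ₕ α ⊠ x ⊠ conj α

    -- If p does not divide x, then v = x and `lift` provides the second factor p. Otherwise v = x/p
    -- has norm m, and `sandwich` strips off ᾱ. That p divides m makes this v isotropic; that p²
    -- does not keeps it nonzero modulo p.
    reduce : ∀ x m → Pure x → N x ≡ + p * + p * m → + p ∣ m → ¬ + p * + p ∣ m → Reduction x
    reduce x m pure Nx p∣m p²∤m = cases (+ p ∣ₕ? x)
      where
      cases : Dec (+ p ∣ₕ x) → Reduction x
      cases (no p∤x) = record
        { v = x ; pure = pure ; indivisible = p∤x
        ; isotropic = subst (+ p ∣_) (sym Nx) (∣n⇒∣m*n (+ p * + p) p∣m)
        ; to = λ {α} Nα h → •-cancel-square {α ⊠ x} (subst (+ p * + p ∣ₕ_)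
            (trans ([y⊠conj]⊠x α (α ⊠ x)) (cong (_• (α ⊠ x)) Nα)) (∣ₕ-⊠ʳ α h))
        ; from = λ {α} Nα → lift {α} {x} {m} pure p∤x Nx Nα }
      cases (yes (dividesₕ z refl)) = record
        { v = z ; pure = pure-z
        ; indivisible = λ p∣z → p²∤m (subst (+ p * + p ∣_) Nz (N-∣ₕ p∣z))
        ; isotropic = subst (+ p ∣_) (sym Nz) p∣m
        ; to = λ {α} _ h → sandwich {α} {z} pure-z (subst (+ p ∣_) (sym Nz) p∣m) (•-cancel-square {α ⊠ z ⊠ conj α} (subst (+ p * + p ∣ₕ_) (pull α) h))
        ; from = λ {α} _ (dividesₕ q e) → subst (+ p * + p ∣ₕ_) (sym (pull α)) (dividesₕ (q ⊠ conj α)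
            (trans (cong (λ w → + p • (w ⊠ conj α)) e) (trans (cong (+ p •_) (•-⊠ˡ (+ p) q (conj α))) (•-assoc (+ p) (+ p) (q ⊠ conj α))))) }
        where
        pure-z : Pure z
        pure-z = *-cancelˡ-≡ (+ p) (re z) 0ℤ (trans pure (sym (*-zeroʳ (+ p))))
        Nz : N z ≡ m
        Nz = *-cancelˡ-≡ (+ p) (N z) m (*-cancelˡ-≡ (+ p) (+ p * N z) (+ p * m)
          (trans (sym (*-assoc (+ p) (+ p) (N z))) (trans (sym (N-• (+ p) z)) (trans Nx (*-assoc (+ p) (+ p) m)))))
        pull : ∀ α → α ⊠ (+ p • z) ⊠ conj α ≡ + p • (α ⊠ z ⊠ conj α)
        pull α = trans (cong (_⊠ conj α) (•-⊠ʳ (+ p) α z)) (•-⊠ˡ (+ p) (α ⊠ z) (conj α))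

-- Quaternions of given norm and the Hecke relation for three squares.

module Sphere where

  open Annihilator
  open Counting
  open Descent
  open Quaternion
  open Theta using (window; window-unique; ∈-window⁺; radius)
  open import Data.Integer.Base hiding (suc)
  open import Data.Integer.Divisibility.Signed
  open import Data.Integer.Properties
  open import Data.Integer.Tactic.RingSolver using (solve-∀)
  open import Data.Product.Base using (_×_)
  open import Relation.Binary.PropositionalEquality

  private
    toℍ : (ℤ × ℤ) × (ℤ × ℤ) → ℍ
    toℍ ((a , b) , (c , d)) = quat a b c d

    coordinatePairs : ℕ → List (ℤ × ℤ)
    coordinatePairs n = cartesianProduct (window (suc n)) (window (suc n))

    box : ℕ → List ℍ
    box n = map toℍ (cartesianProduct (coordinatePairs n) (coordinatePairs n))

  sphere : ℕ → List ℍ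
  sphere n = filter (λ x → N x ≟ + n) (box n)

  sphere-unique : ∀ n → Unique (sphere n)
  sphere-unique n = filter⁺ (λ x → N x ≟ + n)
    (map⁺ {f = toℍ} (λ { {(a , b) , (c , d)} {(a′ , b′) , (c′ , d′)} refl → refl }) (cartesianProduct⁺ pairs-unique pairs-unique))
    where
    pairs-unique : Unique (coordinatePairs n)
    pairs-unique = cartesianProduct⁺ (window-unique (suc n)) (window-unique (suc n))

  ∈-sphere⁻ : ∀ n {x} → x ∈ sphere n → N x ≡ + n
  ∈-sphere⁻ n x∈ = proj₂ (∈-filter⁻ (λ x → N x ≟ + n) {xs = box n} x∈)

  square≤⇒radius≤ : ∀ {n} a → a * a ≤ + n → radius a ℕ.≤ n
  square≤⇒radius≤ {n} a a²≤n = ℕ.≤-trans (radius≤abs a) (ℕ.≤-trans (m≤m*m ∣ a ∣) (drop‿+≤+ (subst (_≤ + n) (square a) a²≤n)))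
    where
    radius≤abs : ∀ a → radius a ℕ.≤ ∣ a ∣
    radius≤abs (+ m)    = ℕ.≤-refl
    radius≤abs -[1+ m ] = ℕ.n≤1+n m
    m≤m*m : ∀ m → m ℕ.≤ m ℕ.* m
    m≤m*m zero    = ℕ.z≤n
    m≤m*m (suc m) = ℕ.m≤m*n (suc m) (suc m)
    square : ∀ a → a * a ≡ + (∣ a ∣ ℕ.* ∣ a ∣)
    square (+ m)    = sym (pos-* m m)
    square -[1+ m ] = refl

  ∈-sphere⁺ : ∀ n x → N x ≡ + n → x ∈ sphere n
  ∈-sphere⁺ n (quat a b c d) e = ∈-filter⁺ (λ x → N x ≟ + n)
    (∈-map⁺ toℍ (∈-cartesianProduct⁺
      (∈-cartesianProduct⁺ (inside a (drop (b * b + c * c + d * d) (0≤+ (0≤+ (0≤square b) (0≤square c)) (0≤square d)) (e₀ (a * a) (b * b) (c * c) (d * d))))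
                           (inside b (drop (a * a + c * c + d * d) (0≤+ (0≤+ (0≤square a) (0≤square c)) (0≤square d)) (e₁ (a * a) (b * b) (c * c) (d * d)))))
      (∈-cartesianProduct⁺ (inside c (drop (a * a + b * b + d * d) (0≤+ (0≤+ (0≤square a) (0≤square b)) (0≤square d)) (e₂ (a * a) (b * b) (c * c) (d * d))))
                           (inside d (drop (a * a + b * b + c * c) (0≤+ (0≤+ (0≤square a) (0≤square b)) (0≤square c)) (e₃ (a * a) (b * b) (c * c) (d * d))))))) e
    where
    inside : ∀ z → z * z ≤ + n → z ∈ window (suc n)
    inside z z²≤n = ∈-window⁺ (suc n) z (s≤s (square≤⇒radius≤ z z²≤n))
    0≤+ : ∀ {x y} → 0ℤ ≤ x → 0ℤ ≤ y → 0ℤ ≤ x + y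
    0≤+ = +-mono-≤
    drop : ∀ {z} r → 0ℤ ≤ r → a * a + b * b + c * c + d * d ≡ z + r → z ≤ + n
    drop {z} r 0≤r f = ≤-trans (≤-reflexive (sym (+-identityʳ z)))
      (≤-trans (+-monoʳ-≤ z 0≤r) (≤-reflexive (trans (sym f) e)))
    e₀ : ∀ a b c d → a + b + c + d ≡ a + (b + c + d)
    e₀ = solve-∀
    e₁ : ∀ a b c d → a + b + c + d ≡ b + (a + c + d)
    e₁ = solve-∀
    e₂ : ∀ a b c d → a + b + c + d ≡ c + (a + b + d)
    e₂ = solve-∀
    e₃ : ∀ a b c d → a + b + c + d ≡ d + (a + b + c)
    e₃ = solve-∀

  pureSphere : ℕ → List ℍ
  pureSphere n = filter (λ x → re x ≟ 0ℤ) (sphere n)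

  pureSphere-unique : ∀ n → Unique (pureSphere n)
  pureSphere-unique n = filter⁺ (λ x → re x ≟ 0ℤ) (sphere-unique n)

  ∈-pureSphere⁺ : ∀ n x → Pure x → N x ≡ + n → x ∈ pureSphere n
  ∈-pureSphere⁺ n x pure e = ∈-filter⁺ (λ x → re x ≟ 0ℤ) (∈-sphere⁺ n x e) pure

  ∈-pureSphere⁻ : ∀ n {x} → x ∈ pureSphere n → Pure x × N x ≡ + n
  ∈-pureSphere⁻ n x∈ with ∈-filter⁻ (λ x → re x ≟ 0ℤ) {xs = sphere n} x∈
  ... | x∈′ , pure = pure , ∈-sphere⁻ n x∈′

  -- Evaluation over the 4⁴ points of the box finds 1, i, j, k and their negatives.
  units-count : length (sphere 1) ≡ 8
  units-count = refl

  module _ {p : ℕ} (pr : Prime p) (odd : ¬ + p ∣ + 2) where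

    private instance
      p≢0 : ℕ.NonZero p
      p≢0 = prime⇒nonZero pr

    private
      NonZero-p² : NonZero (+ p * + p)
      NonZero-p² = subst NonZero (pos-* p p) (ℕ.m*n≢0 p p)

    -- The annihilators of norm p form a single orbit of the units. If γ and α both kill v, then p
    -- divides αγ̄, and u = αγ̄/p has norm 1 and satisfies uγ = α.
    annihilators-count : ∀ v → Pure v → ¬ + p ∣ₕ v → + p ∣ N v →
                         length (filter (λ α → + p ∣ₕ? α ⊠ v) (sphere p)) ≡ 8
    annihilators-count v pure p∤v p∣Nv = trans (sym (length-bijection (_⊠ γ)
        (sphere-unique 1) (filter⁺ (λ α → + p ∣ₕ? α ⊠ v) (sphere-unique p))
        into (λ {u} {u′} _ _ → injective u u′) onto)) units-count
      where
      open ≡-Reasoning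
      witness : ∃ λ γ → N γ ≡ + p × + p ∣ₕ γ ⊠ v
      witness = annihilator-exists pr pure p∤v p∣Nv
      γ : ℍ
      γ = proj₁ witness
      Nγ : N γ ≡ + p
      Nγ = proj₁ (proj₂ witness)
      γv : + p ∣ₕ γ ⊠ v
      γv = proj₂ (proj₂ witness)
      into : ∀ {u} → u ∈ sphere 1 → u ⊠ γ ∈ filter (λ α → + p ∣ₕ? α ⊠ v) (sphere p)
      into {u} u∈ = ∈-filter⁺ (λ α → + p ∣ₕ? α ⊠ v)
        (∈-sphere⁺ p (u ⊠ γ) (trans (N-⊠ u γ) (trans (cong₂ _*_ (∈-sphere⁻ 1 u∈) Nγ) (*-identityˡ (+ p)))))
        (subst (+ p ∣ₕ_) (sym (⊠-assoc u γ v)) (∣ₕ-⊠ˡ u γv))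
      cancel : ∀ u → (u ⊠ γ) ⊠ conj γ ≡ + p • u
      cancel u = trans ([y⊠x]⊠conj γ u) (cong (_• u) Nγ)
      injective : ∀ u u′ → u ⊠ γ ≡ u′ ⊠ γ → u ≡ u′
      injective u u′ e = •-cancelˡ (+ p) (trans (sym (cancel u)) (trans (cong (_⊠ conj γ) e) (cancel u′)))
      onto : ∀ {α} → α ∈ filter (λ α → + p ∣ₕ? α ⊠ v) (sphere p) → ∃ λ u → u ∈ sphere 1 × u ⊠ γ ≡ α
      onto {α} α∈ = preimage (common-annihilator pr odd v γ α p∤v γv αv)
        where
        α∈′ : α ∈ sphere p × + p ∣ₕ α ⊠ v
        α∈′ = ∈-filter⁻ (λ α → + p ∣ₕ? α ⊠ v) {xs = sphere p} α∈
        αv : + p ∣ₕ α ⊠ v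
        αv = proj₂ α∈′
        Nα : N α ≡ + p
        Nα = ∈-sphere⁻ p (proj₁ α∈′)
        preimage : + p ∣ₕ α ⊠ conj γ → ∃ λ u → u ∈ sphere 1 × u ⊠ γ ≡ α
        preimage (dividesₕ u e) = u , ∈-sphere⁺ 1 u (*-cancelˡ-≡ (+ p * + p) (N u) 1ℤ {{NonZero-p²}} (begin
            + p * + p * N u           ≡⟨ N-• (+ p) u ⟨
            N (+ p • u)               ≡⟨ cong N e ⟨
            N (α ⊠ conj γ)            ≡⟨ N-⊠ α (conj γ) ⟩
            N α * N (conj γ)          ≡⟨ cong₂ _*_ Nα (trans (N-conj γ) Nγ) ⟩
            + p * + p                 ≡⟨ *-identityʳ (+ p * + p) ⟨
            + p * + p * 1ℤ            ∎))
          , •-cancelˡ (+ p) (begin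
            + p • (u ⊠ γ)             ≡⟨ •-⊠ˡ (+ p) u γ ⟨
            (+ p • u) ⊠ γ             ≡⟨ cong (_⊠ γ) e ⟨
            (α ⊠ conj γ) ⊠ γ          ≡⟨ [y⊠conj]⊠x γ α ⟩
            N γ • α                   ≡⟨ cong (_• α) Nγ ⟩
            + p • α                   ∎)

    module _ (m : ℕ) where

      private
        dilated : List ℍ
        dilated = pureSphere (p ℕ.* p ℕ.* m)

        +p²m : + (p ℕ.* p ℕ.* m) ≡ + p * + p * + m
        +p²m = trans (pos-* (p ℕ.* p) m) (cong (_* + m) (pos-* p p))

      -- The inverse of y ↦ ᾱyα is x ↦ αxᾱ/p², and both directions preserve purity because
      -- conjugation by α multiplies real parts by p.
      conjugates-count : ∀ α → N α ≡ + p →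
        length (filter (λ x → + p * + p ∣ₕ? α ⊠ x ⊠ conj α) dilated) ≡ length (pureSphere m)
      conjugates-count α Nα = sym (length-bijection (λ y → conj α ⊠ y ⊠ α)
          (pureSphere-unique m) (filter⁺ (λ x → + p * + p ∣ₕ? α ⊠ x ⊠ conj α) (pureSphere-unique (p ℕ.* p ℕ.* m)))
          into (λ {y} {y′} _ _ → injective y y′) onto)
        where
        open ≡-Reasoning
        outer : ∀ y → α ⊠ (conj α ⊠ y ⊠ α) ⊠ conj α ≡ (+ p * + p) • y
        outer y = begin
          α ⊠ (conj α ⊠ y ⊠ α) ⊠ conj α      ≡⟨ cong (_⊠ conj α) (⊠-assoc α (conj α ⊠ y) α) ⟨
          α ⊠ (conj α ⊠ y) ⊠ α ⊠ conj α      ≡⟨ [y⊠x]⊠conj α (α ⊠ (conj α ⊠ y)) ⟩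
          N α • (α ⊠ (conj α ⊠ y))           ≡⟨ cong₂ _•_ Nα (x⊠[conj⊠y] α y) ⟩
          + p • N α • y                      ≡⟨ cong (λ n → + p • n • y) Nα ⟩
          + p • + p • y                      ≡⟨ •-assoc (+ p) (+ p) y ⟩
          (+ p * + p) • y                    ∎
        inner : ∀ x → conj α ⊠ (α ⊠ x ⊠ conj α) ⊠ α ≡ (+ p * + p) • x
        inner x = begin
          conj α ⊠ (α ⊠ x ⊠ conj α) ⊠ α      ≡⟨ cong (_⊠ α) (⊠-assoc (conj α) (α ⊠ x) (conj α)) ⟨
          conj α ⊠ (α ⊠ x) ⊠ conj α ⊠ α      ≡⟨ [y⊠conj]⊠x α (conj α ⊠ (α ⊠ x)) ⟩
          N α • (conj α ⊠ (α ⊠ x))           ≡⟨ cong₂ _•_ Nα (conj⊠[x⊠y] α x) ⟩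
          + p • N α • x                      ≡⟨ cong (λ n → + p • n • x) Nα ⟩
          + p • + p • x                      ≡⟨ •-assoc (+ p) (+ p) x ⟩
          (+ p * + p) • x                    ∎
        N-outer : ∀ x → N (α ⊠ x ⊠ conj α) ≡ + p * + p * N x
        N-outer x = begin
          N (α ⊠ x ⊠ conj α)                 ≡⟨ N-⊠ (α ⊠ x) (conj α) ⟩
          N (α ⊠ x) * N (conj α)             ≡⟨ cong₂ _*_ (N-⊠ α x) (N-conj α) ⟩
          N α * N x * N α                    ≡⟨ cong (λ n → n * N x * n) Nα ⟩
          + p * N x * + p                    ≡⟨ reorder (+ p) (N x) ⟩
          + p * + p * N x                    ∎
          where
          reorder : ∀ p n → p * n * p ≡ p * p * n
          reorder = solve-∀
        re-inner : ∀ y → re (conj α ⊠ y ⊠ α) ≡ + p * re y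
        re-inner y = begin
          re (conj α ⊠ y ⊠ α)                ≡⟨ cong (λ z → re (conj α ⊠ y ⊠ z)) (conj-involutive α) ⟨
          re (conj α ⊠ y ⊠ conj (conj α))    ≡⟨ re-conjugation (conj α) y ⟩
          N (conj α) * re y                  ≡⟨ cong (_* re y) (trans (N-conj α) Nα) ⟩
          + p * re y                         ∎
        N-inner : ∀ y → N (conj α ⊠ y ⊠ α) ≡ + p * + p * N y
        N-inner y = begin
          N (conj α ⊠ y ⊠ α)                 ≡⟨ N-⊠ (conj α ⊠ y) α ⟩
          N (conj α ⊠ y) * N α               ≡⟨ cong (_* N α) (trans (N-⊠ (conj α) y) (cong (_* N y) (N-conj α))) ⟩
          N α * N y * N α                    ≡⟨ cong (λ n → n * N y * n) Nα ⟩
          + p * N y * + p                    ≡⟨ reorder (+ p) (N y) ⟩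
          + p * + p * N y                    ∎
          where
          reorder : ∀ p n → p * n * p ≡ p * p * n
          reorder = solve-∀
        into : ∀ {y} → y ∈ pureSphere m → conj α ⊠ y ⊠ α ∈ filter (λ x → + p * + p ∣ₕ? α ⊠ x ⊠ conj α) dilated
        into {y} y∈ = ∈-filter⁺ (λ x → + p * + p ∣ₕ? α ⊠ x ⊠ conj α)
          (∈-pureSphere⁺ (p ℕ.* p ℕ.* m) (conj α ⊠ y ⊠ α)
            (trans (re-inner y) (trans (cong (+ p *_) (proj₁ (∈-pureSphere⁻ m y∈))) (*-zeroʳ (+ p))))
            (trans (N-inner y) (trans (cong (+ p * + p *_) (proj₂ (∈-pureSphere⁻ m y∈))) (sym +p²m))))
          (dividesₕ y (outer y))
        injective : ∀ y y′ → conj α ⊠ y ⊠ α ≡ conj α ⊠ y′ ⊠ α → y ≡ y′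
        injective y y′ e = •-cancelˡ (+ p * + p) {{NonZero-p²}}
          (trans (sym (outer y)) (trans (cong (λ x → α ⊠ x ⊠ conj α) e) (outer y′)))
        onto : ∀ {x} → x ∈ filter (λ x → + p * + p ∣ₕ? α ⊠ x ⊠ conj α) dilated →
               ∃ λ y → y ∈ pureSphere m × conj α ⊠ y ⊠ α ≡ x
        onto {x} x∈ = preimage (proj₂ x∈′)
          where
          x∈′ : x ∈ dilated × + p * + p ∣ₕ α ⊠ x ⊠ conj α
          x∈′ = ∈-filter⁻ (λ x → + p * + p ∣ₕ? α ⊠ x ⊠ conj α) {xs = dilated} x∈
          pure-x : Pure x
          pure-x = proj₁ (∈-pureSphere⁻ (p ℕ.* p ℕ.* m) (proj₁ x∈′))
          Nx : N x ≡ + p * + p * + m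
          Nx = trans (proj₂ (∈-pureSphere⁻ (p ℕ.* p ℕ.* m) (proj₁ x∈′))) +p²m
          preimage : + p * + p ∣ₕ α ⊠ x ⊠ conj α → ∃ λ y → y ∈ pureSphere m × conj α ⊠ y ⊠ α ≡ x
          preimage (dividesₕ y e) = y , ∈-pureSphere⁺ m y pure-y Ny , image
            where
            pure-y : Pure y
            pure-y = *-cancelˡ-≡ (+ p * + p) (re y) 0ℤ {{NonZero-p²}} (begin
              + p * + p * re y             ≡⟨ cong re e ⟨
              re (α ⊠ x ⊠ conj α)          ≡⟨ re-conjugation α x ⟩
              N α * re x                   ≡⟨ cong (N α *_) pure-x ⟩
              N α * 0ℤ                     ≡⟨ *-zeroʳ (N α) ⟩
              0ℤ                           ≡⟨ *-zeroʳ (+ p * + p) ⟨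
              + p * + p * 0ℤ               ∎)
            Ny : N y ≡ + m
            Ny = *-cancelˡ-≡ (+ p * + p) (N y) (+ m) {{NonZero-p²}} (*-cancelˡ-≡ (+ p * + p) (+ p * + p * N y) (+ p * + p * + m) {{NonZero-p²}} (begin
              + p * + p * (+ p * + p * N y)   ≡⟨ *-assoc (+ p * + p) (+ p * + p) (N y) ⟨
              + p * + p * (+ p * + p) * N y   ≡⟨ N-• (+ p * + p) y ⟨
              N ((+ p * + p) • y)             ≡⟨ cong N e ⟨
              N (α ⊠ x ⊠ conj α)              ≡⟨ N-outer x ⟩
              + p * + p * N x                 ≡⟨ cong (+ p * + p *_) Nx ⟩
              + p * + p * (+ p * + p * + m)   ∎))
            image : conj α ⊠ y ⊠ α ≡ x
            image = •-cancelˡ (+ p * + p) {{NonZero-p²}} (begin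
              (+ p * + p) • (conj α ⊠ y ⊠ α)      ≡⟨ •-⊠ˡ (+ p * + p) (conj α ⊠ y) α ⟨
              ((+ p * + p) • (conj α ⊠ y)) ⊠ α    ≡⟨ cong (_⊠ α) (•-⊠ʳ (+ p * + p) (conj α) y) ⟨
              conj α ⊠ ((+ p * + p) • y) ⊠ α      ≡⟨ cong (λ z → conj α ⊠ z ⊠ α) e ⟨
              conj α ⊠ (α ⊠ x ⊠ conj α) ⊠ α       ≡⟨ inner x ⟩
              (+ p * + p) • x                     ∎)

      -- For p exactly dividing m, an instance of the Hecke relation r₃(p²m) = (p + 1) r₃(m).
      pureSphere-hecke : + p ∣ + m → ¬ + p * + p ∣ + m →
                         length dilated ℕ.* 8 ≡ length (sphere p) ℕ.* length (pureSphere m)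
      pureSphere-hecke p∣m p²∤m = double-counting (λ x α → + p * + p ∣ₕ? α ⊠ x ⊠ conj α) rows
        (λ {α} α∈ → conjugates-count α (∈-sphere⁻ p α∈))
        where
        rows : ∀ {x} → x ∈ dilated → length (filter (λ α → + p * + p ∣ₕ? α ⊠ x ⊠ conj α) (sphere p)) ≡ 8
        rows {x} x∈ = trans
          (length-≡-set (filter⁺ (λ α → + p * + p ∣ₕ? α ⊠ x ⊠ conj α) (sphere-unique p))
                        (filter⁺ (λ α → + p ∣ₕ? α ⊠ v) (sphere-unique p))
            (λ {α} α∈ → let α∈₁ , h = ∈-filter⁻ (λ α → + p * + p ∣ₕ? α ⊠ x ⊠ conj α) {xs = sphere p} α∈
                        in ∈-filter⁺ (λ α → + p ∣ₕ? α ⊠ v) α∈₁ (to {α} (∈-sphere⁻ p α∈₁) h))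
            (λ {α} α∈ → let α∈₁ , h = ∈-filter⁻ (λ α → + p ∣ₕ? α ⊠ v) {xs = sphere p} α∈
                        in ∈-filter⁺ (λ α → + p * + p ∣ₕ? α ⊠ x ⊠ conj α) α∈₁ (from {α} (∈-sphere⁻ p α∈₁) h)))
          (annihilators-count v pure indivisible isotropic)
          where
          x∈′ : Pure x × N x ≡ + (p ℕ.* p ℕ.* m)
          x∈′ = ∈-pureSphere⁻ (p ℕ.* p ℕ.* m) x∈
          open Reduction (reduce pr odd x (+ m) (proj₁ x∈′) (trans (proj₂ x∈′) +p²m) p∣m p²∤m)

-- Isotropic lines modulo p and the number of quaternions of norm p.

module Lines where

  open Annihilator
  open Counting
  open IntegerPrimes
  open Quaternion
  open Sphere
  open import Data.Integer.Base hiding (suc; ∣_∣)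
  open import Data.Integer.Divisibility.Signed
  open import Data.Integer.Properties
  open import Data.Integer.Solver using (module +-*-Solver)
  open import Data.Integer.Tactic.RingSolver using (solve-∀)
  open import Data.Maybe.Base using (Maybe; just; nothing)
  open import Data.Maybe.Properties using (just-injective)
  open import Data.Product.Base using (_×_)
  open import Data.Vec.Base using (Vec)
  open import Relation.Binary.PropositionalEquality

  open +-*-Solver using (Polynomial; prove; con; _:+_; _:*_; _:-_; :-_)

  ∣⟨⟩ : ∀ {n x} y → n ∣ₕ x → n ∣ ⟨ x , y ⟩
  ∣⟨⟩ {n} y (dividesₕ q refl) = subst (n ∣_) (sym (⟨⟩-•ˡ n q y)) (∣m⇒∣m*n ⟨ q , y ⟩ ∣-refl)

  -- Modulo p, if a² + b² + c² = 0 and c is invertible, then i₁ ↦ (a b ; b −a) / c and i₂ ↦ (0 −1 ; 1 0)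
  -- identify quaternions with 2×2 matrices. Under this identification (m₁₁ m₁₂ ; m₂₁ m₂₂) is the matrix
  -- of c x, the rows are the entries of its product with the column (1 , t), and finite t and infinite
  -- are the isotropic vectors whose matrices have as image the lines through (1 , t) and (0 , 1).
  module Formulas {A : Set} (_+_ _*_ : A → A → A) (-_ : A → A) (0# 1# : A) (a b c : A) where

    private
      infixl 6 _+′_ _-′_
      infixl 7 _*′_
      _+′_ _-′_ _*′_ : A → A → A
      _+′_ = _+_
      x -′ y = x + (- y)
      _*′_ = _*_

    norm : A
    norm = a *′ a +′ b *′ b +′ c *′ c

    infinite : Quaternion A
    infinite = quat 0# (- b) c a

    finite : A → Quaternion A
    finite t = quat 0# (- ((t +′ t) *′ a +′ b *′ (t *′ t -′ 1#))) (c *′ (1# +′ t *′ t))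
                       (a *′ (t *′ t -′ 1#) -′ (t +′ t) *′ b)

    m₁₁ m₁₂ m₂₁ m₂₂ : Quaternion A → A
    m₁₁ (quat x₀ x₁ x₂ x₃) = c *′ x₀ +′ a *′ x₁ +′ b *′ x₃
    m₁₂ (quat x₀ x₁ x₂ x₃) = b *′ x₁ -′ c *′ x₂ -′ a *′ x₃
    m₂₁ (quat x₀ x₁ x₂ x₃) = b *′ x₁ +′ c *′ x₂ -′ a *′ x₃
    m₂₂ (quat x₀ x₁ x₂ x₃) = c *′ x₀ -′ a *′ x₁ -′ b *′ x₃

    row₁ row₂ : Quaternion A → A → A
    row₁ x t = m₁₁ x +′ m₁₂ x *′ t
    row₂ x t = m₂₁ x +′ m₂₂ x *′ t

  -- The formal parameters a, b, c and t are the coordinates of the second formal quaternion.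
  private
    module G = Formulas {Polynomial 12} _:+_ _:*_ :-_ (con 0ℤ) (con 1ℤ) (re Y) (im₁ Y) (im₂ Y)
    T : Polynomial 12
    T = im₃ Y

  module _ {p : ℕ} (pr : Prime p) (odd : ¬ + p ∣ + 2) where

    private instance
      p≢0 : ℕ.NonZero p
      p≢0 = prime⇒nonZero pr

    private
      ∣*⇒∣ : ∀ x y → ¬ + p ∣ x → + p ∣ x * y → + p ∣ y
      ∣*⇒∣ x y p∤x h with euclidsLemmaℤ pr x y h
      ... | inj₁ d = contradiction d p∤x
      ... | inj₂ d = d

      p∤1 : ¬ + p ∣ 1ℤ
      p∤1 d = odd (∣n⇒∣m*n (+ 2) d)

      N≡p⇒p∤ : ∀ α → N α ≡ + p → ¬ + p ∣ₕ α
      N≡p⇒p∤ α Nα h with subst (+ p * + p ∣_) Nα (N-∣ₕ h)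
      ... | divides q e = p∤1 (divides q (*-cancelˡ-≡ (+ p) 1ℤ (q * + p)
        (trans (*-identityʳ (+ p)) (trans e (reorder q (+ p))))))
        where
        reorder : ∀ q p → q * (p * p) ≡ p * (q * p)
        reorder = solve-∀

    -- Polarization gives α(v w̄ + w v̄) = 2⟨v, w⟩ α, and α is nonzero modulo p. As distinct
    -- isotropic lines are not orthogonal, α kills at most one of them.
    annihilated-orthogonal : ∀ α v w → N α ≡ + p → + p ∣ₕ α ⊠ v → + p ∣ₕ α ⊠ w → + p ∣ ⟨ v , w ⟩
    annihilated-orthogonal α v w Nα αv αw = from-dec (+ p ∣? + 2 * ⟨ v , w ⟩)
      where
      expand : α ⊠ v ⊠ conj w ⊞ α ⊠ w ⊠ conj v ≡ (+ 2 * ⟨ v , w ⟩) • α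
      expand = begin
        α ⊠ v ⊠ conj w ⊞ α ⊠ w ⊠ conj v        ≡⟨ cong₂ _⊞_ (⊠-assoc α v (conj w)) (⊠-assoc α w (conj v)) ⟩
        α ⊠ (v ⊠ conj w) ⊞ α ⊠ (w ⊠ conj v)    ≡⟨ ⊠-distribˡ α (v ⊠ conj w) (w ⊠ conj v) ⟨
        α ⊠ (v ⊠ conj w ⊞ w ⊠ conj v)          ≡⟨ cong (α ⊠_) (polarization v w) ⟩
        α ⊠ ((+ 2 * ⟨ v , w ⟩) • 1ₕ)           ≡⟨ ⊠-scalar (+ 2 * ⟨ v , w ⟩) α ⟩
        (+ 2 * ⟨ v , w ⟩) • α                  ∎
        where open ≡-Reasoning
      from-dec : Dec (+ p ∣ + 2 * ⟨ v , w ⟩) → + p ∣ ⟨ v , w ⟩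
      from-dec (yes d) = ∣2*⇒∣ pr odd ⟨ v , w ⟩ d
      from-dec (no ¬d) = contradiction
        (•-cancel-∣ₕ pr (+ 2 * ⟨ v , w ⟩) α ¬d (subst (+ p ∣ₕ_) expand (∣ₕ-⊞ (∣ₕ-⊠ʳ (conj w) αv) (∣ₕ-⊠ʳ (conj v) αw))))
        (N≡p⇒p∤ α Nα)

    residue-injective : ∀ {s t} → s ℕ.< p → t ℕ.< p → + p ∣ + s - + t → s ≡ t
    residue-injective {s} {t} s<p t<p d = [ (λ t≤s → ordered t≤s s<p d) ,
        (λ s≤t → sym (ordered s≤t t<p (subst (+ p ∣_) (flip (+ s) (+ t)) (∣m⇒∣-m d)))) ]′ (ℕ.≤-total t s)
      where
      flip : ∀ s t → - (s - t) ≡ t - s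
      flip = solve-∀
      ordered : ∀ {s t} → t ℕ.≤ s → s ℕ.< p → + p ∣ + s - + t → s ≡ t
      ordered {s} {t} t≤s s<p d with s ℕ.∸ t in eq | subst (+ p ∣_) (trans (m-n≡m⊖n s t) (⊖-≥ t≤s)) d
      ... | zero  | _ = ℕ.≤-antisym (ℕ.m∸n≡0⇒m≤n eq) t≤s
      ... | suc k | h = contradiction (ℕ.∣⇒≤ (∣⇒∣ᵤ h)) (ℕ.<⇒≱ (ℕ.≤-<-trans (subst (ℕ._≤ s) eq (ℕ.m∸n≤m s t)) s<p))

    -- The vanishing determinant makes the second row a multiple of the first, whose second entry is
    -- invertible; so a kernel vector (1 , t) of the first row kills both.
    common-root : ∀ x y x′ y′ → + p ∣ x * y′ - y * x′ → ¬ + p ∣ y →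
                  ∃ λ t → t ℕ.< p × + p ∣ x + y * + t × + p ∣ x′ + y′ * + t
    common-root x y x′ y′ d p∤y =
      let t , t<p , h = linear-root pr x y p∤y
      in t , t<p , h , ∣*⇒∣ y _ p∤y (subst (+ p ∣_) (e x y x′ y′ (+ t)) (∣m∣n⇒∣m-n (∣n⇒∣m*n y′ h) d))
      where
      e : ∀ x y x′ y′ t → y′ * (x + y * t) - (x * y′ - y * x′) ≡ y * (x′ + y′ * t)
      e = solve-∀

    module Conic (a b c : ℤ) (p∣norm : + p ∣ Formulas.norm _+_ _*_ -_ 0ℤ 1ℤ a b c) (p∤c : ¬ + p ∣ c) where

      open Formulas _+_ _*_ -_ 0ℤ 1ℤ a b c

      line : Maybe ℕ → ℍ
      line nothing  = infinite
      line (just t) = finite (+ t)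

      lines : List (Maybe ℕ)
      lines = nothing ∷ map just (upTo p)

      lines-unique : Unique lines
      lines-unique = All.tabulate (λ { i∈ refl → contradiction (∈-map⁻ just i∈) λ { (_ , _ , ()) } })
                   ∷ map⁺ just-injective (upTo⁺ p)

      length-lines : length lines ≡ suc p
      length-lines = cong suc (trans (length-map just (upTo p)) (length-upTo p))

      -- Modulo p this is 2c²(s - t)². The case s = t shows isotropy, and otherwise distinct
      -- parameters give lines that are not orthogonal.
      ⟨finite,finite⟩ : ∀ s t → ⟨ finite s , finite t ⟩ ≡
        norm * (+ 4 * s * t + (s * s - 1ℤ) * (t * t - 1ℤ)) + + 2 * (c * (c * ((s - t) * (s - t))))
      ⟨finite,finite⟩ s t = prove (environment (scalar s) (quat a b c t) 0ₕ) F.⟨ G.finite S , G.finite T ⟩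
        (G.norm :* (con (+ 4) :* S :* T :+ (S :* S :- con 1ℤ) :* (T :* T :- con 1ℤ))
          :+ con (+ 2) :* (im₂ Y :* (im₂ Y :* ((S :- T) :* (S :- T))))) refl
        where
        S : Polynomial 12
        S = re X

      ⟨finite,infinite⟩ : ∀ t → ⟨ finite t , infinite ⟩ ≡ norm * (t * t - 1ℤ) + + 2 * (c * c)
      ⟨finite,infinite⟩ t = prove (environment 0ₕ (quat a b c t) 0ₕ) F.⟨ G.finite T , G.infinite ⟩
        (G.norm :* (T :* T :- con 1ℤ) :+ con (+ 2) :* (im₂ Y :* im₂ Y)) refl

      N-infinite : N infinite ≡ norm
      N-infinite = prove (environment 0ₕ (quat a b c 0ℤ) 0ₕ) (F.N G.infinite) G.norm refl

      line-pure : ∀ i → Pure (line i)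
      line-pure nothing  = refl
      line-pure (just t) = refl

      p∤finite-infinite : ∀ t → ¬ + p ∣ ⟨ line (just t) , line nothing ⟩
      p∤finite-infinite t d = p∤c (∣*⇒∣ c c p∤c (∣2*⇒∣ pr odd (c * c)
        (∣m+n∣m⇒∣n (subst (+ p ∣_) (⟨finite,infinite⟩ (+ t)) d) (∣m⇒∣m*n (+ t * + t - 1ℤ) p∣norm))))

      line-indivisible : ∀ i → ¬ + p ∣ₕ line i
      line-indivisible nothing  h = p∤c (∣im₂ h)
      line-indivisible (just t) h = p∤finite-infinite t (∣⟨⟩ (line nothing) h)

      line-isotropic : ∀ i → + p ∣ N (line i)
      line-isotropic nothing  = subst (+ p ∣_) (sym N-infinite) p∣norm
      line-isotropic (just t) = subst (+ p ∣_) (sym (⟨finite,finite⟩ (+ t) (+ t)))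
        (∣m∣n⇒∣m+n (∣m⇒∣m*n (+ 4 * + t * + t + (+ t * + t - 1ℤ) * (+ t * + t - 1ℤ)) p∣norm) (divides 0ℤ (e c (+ t))))
        where
        e : ∀ c t → + 2 * (c * (c * ((t - t) * (t - t)))) ≡ 0ℤ
        e = solve-∀

      ∈-lines-just⁻ : ∀ {t} → just t ∈ lines → t ℕ.< p
      ∈-lines-just⁻ (there i∈) with ∈-map⁻ just i∈
      ... | _ , t∈ , refl = ∈-upTo⁻ t∈

      finite-lines-unique : ∀ s t → + p ∣ ⟨ line (just s) , line (just t) ⟩ → + p ∣ + s - + t
      finite-lines-unique s t d = [ (λ d → d) , (λ d → d) ]′ (euclidsLemmaℤ pr (+ s - + t) (+ s - + t)
        (∣*⇒∣ c ((+ s - + t) * (+ s - + t)) p∤c (∣*⇒∣ c (c * ((+ s - + t) * (+ s - + t))) p∤c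
          (∣2*⇒∣ pr odd (c * (c * ((+ s - + t) * (+ s - + t)))) (∣m+n∣m⇒∣n (subst (+ p ∣_) (⟨finite,finite⟩ (+ s) (+ t)) d)
            (∣m⇒∣m*n (+ 4 * + s * + t + (+ s * + s - 1ℤ) * (+ t * + t - 1ℤ)) p∣norm))))))

      line-unique : ∀ α i j → N α ≡ + p → i ∈ lines → j ∈ lines →
                    + p ∣ₕ α ⊠ line i → + p ∣ₕ α ⊠ line j → i ≡ j
      line-unique α nothing  nothing  Nα i∈ j∈ hi hj = refl
      line-unique α (just s) nothing  Nα i∈ j∈ hi hj =
        contradiction (annihilated-orthogonal α (line (just s)) (line nothing) Nα hi hj) (p∤finite-infinite s)
      line-unique α nothing  (just t) Nα i∈ j∈ hi hj =
        contradiction (annihilated-orthogonal α (line (just t)) (line nothing) Nα hj hi) (p∤finite-infinite t)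
      line-unique α (just s) (just t) Nα i∈ j∈ hi hj =
        cong just (residue-injective (∈-lines-just⁻ i∈) (∈-lines-just⁻ j∈)
          (finite-lines-unique s t (annihilated-orthogonal α (line (just s)) (line (just t)) Nα hi hj)))

      module _ (α : ℍ) where

        -- The determinant of the matrix of cα is c² N α, up to a multiple of a² + b² + c².
        singular : N α ≡ + p → + p ∣ m₁₁ α * m₂₂ α - m₁₂ α * m₂₁ α
        singular Nα = subst (+ p ∣_) (sym (prove (environment α (quat a b c 0ℤ) 0ₕ)
            (G.m₁₁ X :* G.m₂₂ X :- G.m₁₂ X :* G.m₂₁ X)
            (im₂ Y :* im₂ Y :* F.N X :- G.norm :* (im₁ X :* im₁ X :+ im₃ X :* im₃ X)) refl))
          (∣m∣n⇒∣m-n (∣n⇒∣m*n (c * c) (subst (+ p ∣_) (sym Nα) ∣-refl)) (∣m⇒∣m*n (im₁ α * im₁ α + im₃ α * im₃ α) p∣norm))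

        -- The image of `infinite` is spanned by (0 , 1), so the second column of α decides. Two
        -- coordinates of the product are its entries; the other two, after multiplication by the
        -- invertible c, are combinations of its entries and the norm.
        kills-infinite : + p ∣ m₁₂ α → + p ∣ m₂₂ α → + p ∣ₕ α ⊠ infinite
        kills-infinite d₁ d₂ = coordinates
          (subst (+ p ∣_) (prove ρ (G.m₁₂ X) (re X∞) refl) d₁)
          (∣*⇒∣ c (im₁ (α ⊠ infinite)) p∤c (subst (+ p ∣_)
            (prove ρ (:- (re Y :* G.m₁₂ X :+ im₁ Y :* G.m₂₂ X :+ G.norm :* im₃ X)) (im₂ Y :* im₁ X∞) refl)
            (∣m⇒∣-m (∣m∣n⇒∣m+n (∣m∣n⇒∣m+n (∣n⇒∣m*n a d₁) (∣n⇒∣m*n b d₂)) (∣m⇒∣m*n (im₃ α) p∣norm)))))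
          (subst (+ p ∣_) (prove ρ (G.m₂₂ X) (im₂ X∞) refl) d₂)
          (∣*⇒∣ c (im₃ (α ⊠ infinite)) p∤c (subst (+ p ∣_)
            (prove ρ (re Y :* G.m₂₂ X :- im₁ Y :* G.m₁₂ X :+ G.norm :* im₁ X) (im₂ Y :* im₃ X∞) refl)
            (∣m∣n⇒∣m+n (∣m∣n⇒∣m-n (∣n⇒∣m*n a d₂) (∣n⇒∣m*n b d₁)) (∣m⇒∣m*n (im₁ α) p∣norm))))
          where
          ρ : Vec ℤ 12
          ρ = environment α (quat a b c 0ℤ) 0ₕ
          X∞ : Quaternion (Polynomial 12)
          X∞ = X F.⊠ G.infinite

        kills-finite : ∀ t → + p ∣ row₁ α t → + p ∣ row₂ α t → + p ∣ₕ α ⊠ finite t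
        kills-finite t d₁ d₂ = coordinates
          (subst (+ p ∣_) (prove ρ (G.row₁ X T :* T :- G.row₂ X T) (re XT) refl) (∣m∣n⇒∣m-n (∣m⇒∣m*n t d₁) d₂))
          (∣*⇒∣ c (im₁ (α ⊠ finite t)) p∤c (subst (+ p ∣_)
            (prove ρ (:- (re Y :* U :+ im₁ Y :* V :+ G.norm :* (im₃ X :* (con 1ℤ :+ T :* T)))) (im₂ Y :* im₁ XT) refl)
            (∣m⇒∣-m (∣m∣n⇒∣m+n (∣m∣n⇒∣m+n (∣n⇒∣m*n a d₃) (∣n⇒∣m*n b d₄)) (∣m⇒∣m*n (im₃ α * (1ℤ + t * t)) p∣norm)))))
          (subst (+ p ∣_) (prove ρ (G.row₂ X T :* T :+ G.row₁ X T) (im₂ XT) refl) (∣m∣n⇒∣m+n (∣m⇒∣m*n t d₂) d₁))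
          (∣*⇒∣ c (im₃ (α ⊠ finite t)) p∤c (subst (+ p ∣_)
            (prove ρ (re Y :* V :- im₁ Y :* U :+ G.norm :* (im₁ X :* (con 1ℤ :+ T :* T))) (im₂ Y :* im₃ XT) refl)
            (∣m∣n⇒∣m+n (∣m∣n⇒∣m-n (∣n⇒∣m*n a d₄) (∣n⇒∣m*n b d₃)) (∣m⇒∣m*n (im₁ α * (1ℤ + t * t)) p∣norm))))
          where
          ρ : Vec ℤ 12
          ρ = environment α (quat a b c t) 0ₕ
          XT : Quaternion (Polynomial 12)
          XT = X F.⊠ G.finite T
          U V : Polynomial 12
          U = G.row₁ X T :* T :+ G.row₂ X T
          V = G.row₂ X T :* T :- G.row₁ X T
          d₃ : + p ∣ row₁ α t * t + row₂ α t
          d₃ = ∣m∣n⇒∣m+n (∣m⇒∣m*n t d₁) d₂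
          d₄ : + p ∣ row₂ α t * t - row₁ α t
          d₄ = ∣m∣n⇒∣m-n (∣m⇒∣m*n t d₂) d₁

        -- A singular matrix kills some vector: (0 , 1) if its second column vanishes, and otherwise
        -- (1 , t) with t read off a row whose second entry is invertible.
        killed-line : N α ≡ + p → ∃ λ i → i ∈ lines × + p ∣ₕ α ⊠ line i
        killed-line Nα = cases (+ p ∣? m₁₂ α) (+ p ∣? m₂₂ α)
          where
          Killed : Set
          Killed = ∃ λ i → i ∈ lines × + p ∣ₕ α ⊠ line i
          killed : ∀ {t} → t ℕ.< p → + p ∣ row₁ α (+ t) → + p ∣ row₂ α (+ t) → Killed
          killed {t} t<p h₁ h₂ = just t , there (∈-map⁺ just (∈-upTo⁺ t<p)) , kills-finite (+ t) h₁ h₂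
          exchange : ∀ x y x′ y′ → - (x * y′ - y * x′) ≡ x′ * y - y′ * x
          exchange = solve-∀
          cases : Dec (+ p ∣ m₁₂ α) → Dec (+ p ∣ m₂₂ α) → Killed
          cases (yes d₁) (yes d₂) = nothing , here refl , kills-infinite d₁ d₂
          cases (no ¬d)  _        =
            let t , t<p , h₁ , h₂ = common-root (m₁₁ α) (m₁₂ α) (m₂₁ α) (m₂₂ α) (singular Nα) ¬d
            in killed t<p h₁ h₂
          cases (yes _)  (no ¬d)  =
            let t , t<p , h₂ , h₁ = common-root (m₂₁ α) (m₂₂ α) (m₁₁ α) (m₁₂ α)
                  (subst (+ p ∣_) (exchange (m₁₁ α) (m₁₂ α) (m₂₁ α) (m₂₂ α)) (∣m⇒∣-m (singular Nα))) ¬d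
            in killed t<p h₁ h₂

      sphere-count : length (sphere p) ℕ.* 1 ≡ suc p ℕ.* 8
      sphere-count = trans (double-counting (λ α i → + p ∣ₕ? α ⊠ line i) rows columns) (cong (ℕ._* 8) length-lines)
        where
        rows : ∀ {α} → α ∈ sphere p → length (filter (λ i → + p ∣ₕ? α ⊠ line i) lines) ≡ 1
        rows {α} α∈ = row (killed-line α (∈-sphere⁻ p α∈))
          where
          row : (∃ λ i → i ∈ lines × + p ∣ₕ α ⊠ line i) → length (filter (λ i → + p ∣ₕ? α ⊠ line i) lines) ≡ 1
          row (i , i∈ , h) = length-≡-set {ys = i ∷ []} (filter⁺ (λ i → + p ∣ₕ? α ⊠ line i) lines-unique) ([] ∷ [])
            (λ {j} j∈ → let j∈′ , h′ = ∈-filter⁻ (λ i → + p ∣ₕ? α ⊠ line i) {xs = lines} j∈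
                        in here (line-unique α j i (∈-sphere⁻ p α∈) j∈′ i∈ h′ h))
            (λ { (here refl) → ∈-filter⁺ (λ i → + p ∣ₕ? α ⊠ line i) i∈ h })
        columns : ∀ {i} → i ∈ lines → length (filter (λ α → + p ∣ₕ? α ⊠ line i) (sphere p)) ≡ 8
        columns {i} _ = annihilators-count pr odd (line i) (line-pure i) (line-indivisible i) (line-isotropic i)

    -- The coefficients come from |zw|² = |z|²|w|² = |z|² (p − |z|²) for z = x₀ + x₁i and w = x₂ − x₃i.
    sphere-count-from : ∀ α → N α ≡ + p → ¬ + p ∣ re α * re α + im₁ α * im₁ α → length (sphere p) ℕ.* 1 ≡ suc p ℕ.* 8
    sphere-count-from α Nα = Conic.sphere-count (re α * im₂ α + im₁ α * im₃ α) (re α * im₃ α - im₁ α * im₂ α)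
      (re α * re α + im₁ α * im₁ α) (divides (re α * re α + im₁ α * im₁ α)
        (trans (e (re α) (im₁ α) (im₂ α) (im₃ α)) (cong ((re α * re α + im₁ α * im₁ α) *_) Nα)))
      where
      e : ∀ x₀ x₁ x₂ x₃ →
        (x₀ * x₂ + x₁ * x₃) * (x₀ * x₂ + x₁ * x₃) + (x₀ * x₃ - x₁ * x₂) * (x₀ * x₃ - x₁ * x₂)
        + (x₀ * x₀ + x₁ * x₁) * (x₀ * x₀ + x₁ * x₁) ≡
        (x₀ * x₀ + x₁ * x₁) * (x₀ * x₀ + x₁ * x₁ + x₂ * x₂ + x₃ * x₃)
      e = solve-∀

    -- The conic point requires x₀² + x₁² to be prime to p, and permuting the imaginary coordinates
    -- offers three such sums. If p divided all of them, then their total minus N α = p, which is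
    -- 2x₀², would make p divide x₀ and so every coordinate.
    sphere-count-any : ∀ α → N α ≡ + p → length (sphere p) ℕ.* 1 ≡ suc p ℕ.* 8
    sphere-count-any (quat x₀ x₁ x₂ x₃) Nα =
      cases (+ p ∣? x₀ * x₀ + x₁ * x₁) (+ p ∣? x₀ * x₀ + x₂ * x₂) (+ p ∣? x₀ * x₀ + x₃ * x₃)
      where
      square-∣ : ∀ x → + p ∣ x * x → + p ∣ x
      square-∣ x h = [ (λ d → d) , (λ d → d) ]′ (euclidsLemmaℤ pr x x h)
      swap₂ : ∀ x₀ x₁ x₂ x₃ → x₀ * x₀ + x₂ * x₂ + x₁ * x₁ + x₃ * x₃ ≡ x₀ * x₀ + x₁ * x₁ + x₂ * x₂ + x₃ * x₃
      swap₂ = solve-∀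
      swap₃ : ∀ x₀ x₁ x₂ x₃ → x₀ * x₀ + x₃ * x₃ + x₁ * x₁ + x₂ * x₂ ≡ x₀ * x₀ + x₁ * x₁ + x₂ * x₂ + x₃ * x₃
      swap₃ = solve-∀
      total : ∀ x₀ x₁ x₂ x₃ → (x₀ * x₀ + x₁ * x₁) + (x₀ * x₀ + x₂ * x₂) + (x₀ * x₀ + x₃ * x₃)
              - (x₀ * x₀ + x₁ * x₁ + x₂ * x₂ + x₃ * x₃) ≡ + 2 * (x₀ * x₀)
      total = solve-∀
      cases : Dec (+ p ∣ x₀ * x₀ + x₁ * x₁) → Dec (+ p ∣ x₀ * x₀ + x₂ * x₂) → Dec (+ p ∣ x₀ * x₀ + x₃ * x₃) →
              length (sphere p) ℕ.* 1 ≡ suc p ℕ.* 8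
      cases (no ¬d)  _        _        = sphere-count-from (quat x₀ x₁ x₂ x₃) Nα ¬d
      cases _        (no ¬d)  _        = sphere-count-from (quat x₀ x₂ x₁ x₃) (trans (swap₂ x₀ x₁ x₂ x₃) Nα) ¬d
      cases _        _        (no ¬d)  = sphere-count-from (quat x₀ x₃ x₁ x₂) (trans (swap₃ x₀ x₁ x₂ x₃) Nα) ¬d
      cases (yes d₁) (yes d₂) (yes d₃) =
        contradiction (coordinates (square-∣ x₀ p∣x₀²) (from x₁ d₁) (from x₂ d₂) (from x₃ d₃)) (N≡p⇒p∤ (quat x₀ x₁ x₂ x₃) Nα)
        where
        p∣x₀² : + p ∣ x₀ * x₀
        p∣x₀² = ∣2*⇒∣ pr odd (x₀ * x₀) (subst (+ p ∣_) (total x₀ x₁ x₂ x₃)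
          (∣m∣n⇒∣m-n (∣m∣n⇒∣m+n (∣m∣n⇒∣m+n d₁ d₂) d₃) (subst (+ p ∣_) (sym Nα) ∣-refl)))
        from : ∀ x → + p ∣ x₀ * x₀ + x * x → + p ∣ x
        from x d = square-∣ x (∣m+n∣m⇒∣n d p∣x₀²)

    -- The first case is vacuous by Jacobi's four-square theorem.
    sphere-length : length (sphere p) ≡ 0 ⊎ length (sphere p) ≡ suc p ℕ.* 8
    sphere-length = go (sphere p) (λ {α} α∈ → sphere-count-any α (∈-sphere⁻ p α∈)) refl
      where
      go : ∀ xs → (∀ {α} → α ∈ xs → length (sphere p) ℕ.* 1 ≡ suc p ℕ.* 8) → xs ≡ sphere p →
           length (sphere p) ≡ 0 ⊎ length (sphere p) ≡ suc p ℕ.* 8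
      go []      _     eq = inj₁ (cong length (sym eq))
      go (_ ∷ _) count eq = inj₂ (trans (sym (ℕ.*-identityʳ (length (sphere p)))) (count (here refl)))

-- Sums of three odd squares and sums of three triangular numbers.

module ThreeSquares where

  open Counting
  open Modular
  open Quaternion
  open Sphere
  open Theta
  open import Data.Integer.Base hiding (suc; ∣_∣)
  open import Data.Integer.DivMod using (_%ℕ_; _/ℕ_; n%ℕd<d; a≡a%ℕn+[a/ℕn]*n)
  open import Data.Integer.Divisibility.Signed
  open import Data.Integer.Properties
  open import Data.Integer.Tactic.RingSolver using (solve-∀)
  open import Data.Product.Base using (_×_)
  open import Relation.Binary.PropositionalEquality
  open import Algebra.Properties.AbelianGroup +-0-abelianGroup using () renaming (∙-cancelʳ to +-cancelʳ-≡)
  open Congruence (ℤ/ (+ 5)) (∣⇒≡ₘ0 (+ 5) (divides 1ℤ refl))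

  private
    odd-value : ℤ → ℤ
    odd-value k = + 4 * k + 1ℤ

  value : SignedIndex → ℤ
  value (true  , k) = odd-value k
  value (false , k) = - odd-value k

  weight : SignedIndex → ℕ
  weight (_ , k) = triangle k

  value-square : ∀ i → value i * value i ≡ + 8 * + weight i + 1ℤ
  value-square (true  , k) = trans (e k) (cong (λ z → + 8 * z + 1ℤ) (sym (triangle-ℤ k)))
    where
    e : ∀ k → (+ 4 * k + 1ℤ) * (+ 4 * k + 1ℤ) ≡ + 8 * (k * (+ 2 * k + + 1)) + 1ℤ
    e = solve-∀
  value-square (false , k) = trans (e k) (cong (λ z → + 8 * z + 1ℤ) (sym (triangle-ℤ k)))
    where
    e : ∀ k → - (+ 4 * k + 1ℤ) * - (+ 4 * k + 1ℤ) ≡ + 8 * (k * (+ 2 * k + + 1)) + 1ℤ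
    e = solve-∀

  odd-value-injective : ∀ {k l} → odd-value k ≡ odd-value l → k ≡ l
  odd-value-injective {k} {l} e = *-cancelˡ-≡ (+ 4) k l (+-cancelʳ-≡ 1ℤ (+ 4 * k) (+ 4 * l) e)

  opposite-values : ∀ k l → ¬ odd-value k ≡ - odd-value l
  opposite-values k l e = from-no (4 ℕ.∣? 2) (∣⇒∣ᵤ (divides (- (k + l)) (begin
    + 2                               ≡⟨ shift (odd-value k) (odd-value l) ⟩
    + 2 - (odd-value k + odd-value l) + (odd-value k - - odd-value l) ≡⟨ cong₂ _+_ (collect k l) (trans (cong (_- - odd-value l) e) (+-inverseʳ (- odd-value l))) ⟩
    - (k + l) * + 4 + 0ℤ              ≡⟨ +-identityʳ _ ⟩
    - (k + l) * + 4                   ∎)))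
    where
    open ≡-Reasoning
    shift : ∀ x y → + 2 ≡ + 2 - (x + y) + (x - - y)
    shift = solve-∀
    collect : ∀ k l → + 2 - ((+ 4 * k + 1ℤ) + (+ 4 * l + 1ℤ)) ≡ - (k + l) * + 4
    collect = solve-∀

  value-injective : ∀ i j → value i ≡ value j → i ≡ j
  value-injective (true  , k) (true  , l) e = cong (true ,_) (odd-value-injective e)
  value-injective (false , k) (false , l) e = cong (false ,_) (odd-value-injective (neg-injective e))
  value-injective (true  , k) (false , l) e = contradiction e (opposite-values k l)
  value-injective (false , k) (true  , l) e = contradiction (sym e) (opposite-values l k)

  even-or-value : ∀ x → (∃ λ a → x * x ≡ + 4 * a) ⊎ ∃ λ i → value i ≡ x
  even-or-value x = cases (x %ℕ 4) (n%ℕd<d x 4) (a≡a%ℕn+[a/ℕn]*n x 4)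
    where
    q : ℤ
    q = x /ℕ 4
    cases : ∀ r → r ℕ.< 4 → x ≡ + r + q * + 4 → (∃ λ a → x * x ≡ + 4 * a) ⊎ ∃ λ i → value i ≡ x
    cases 0 _ e = inj₁ (_ , trans (cong (λ z → z * z) e) (f q))
      where
      f : ∀ q → (0ℤ + q * + 4) * (0ℤ + q * + 4) ≡ + 4 * (+ 4 * q * q)
      f = solve-∀
    cases 1 _ e = inj₂ ((true , q) , trans (f q) (sym e))
      where
      f : ∀ q → + 4 * q + 1ℤ ≡ 1ℤ + q * + 4
      f = solve-∀
    cases 2 _ e = inj₁ (_ , trans (cong (λ z → z * z) e) (f q))
      where
      f : ∀ q → (+ 2 + q * + 4) * (+ 2 + q * + 4) ≡ + 4 * ((1ℤ + + 2 * q) * (1ℤ + + 2 * q))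
      f = solve-∀
    cases 3 _ e = inj₂ ((false , - q - 1ℤ) , trans (f q) (sym e))
      where
      f : ∀ q → - (+ 4 * (- q - 1ℤ) + 1ℤ) ≡ + 3 + q * + 4
      f = solve-∀
    cases (suc (suc (suc (suc _)))) (s≤s (s≤s (s≤s (s≤s ())))) _

  module _ (n : ℕ) where

    private
      Triple : Set
      Triple = SignedIndex × SignedIndex × SignedIndex

      toℍ : Triple → ℍ
      toℍ (i , j , k) = quat 0ℤ (value i) (value j) (value k)

      norm : ℕ
      norm = 8 ℕ.* n ℕ.+ 3

      +norm : + norm ≡ + 8 * + n + + 3
      +norm = cong (_+ + 3) (pos-* 8 n)

      totalWeight : Triple → ℕ
      totalWeight (i , j , k) = weight i ℕ.+ (weight j ℕ.+ weight k)

      N-toℍ : ∀ t → N (toℍ t) ≡ + 8 * + totalWeight t + + 3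
      N-toℍ (i , j , k) = begin
        0ℤ * 0ℤ + value i * value i + value j * value j + value k * value k
          ≡⟨ cong₂ _+_ (cong₂ _+_ (cong (λ z → 0ℤ * 0ℤ + z) (value-square i)) (value-square j)) (value-square k) ⟩
        0ℤ * 0ℤ + (+ 8 * + weight i + 1ℤ) + (+ 8 * + weight j + 1ℤ) + (+ 8 * + weight k + 1ℤ)
          ≡⟨ e (+ weight i) (+ weight j) (+ weight k) ⟩
        + 8 * (+ weight i + (+ weight j + + weight k)) + + 3 ∎
        where
        open ≡-Reasoning
        e : ∀ x y z → 0ℤ * 0ℤ + (+ 8 * x + 1ℤ) + (+ 8 * y + 1ℤ) + (+ 8 * z + 1ℤ) ≡ + 8 * (x + (y + z)) + + 3
        e = solve-∀

      allTriples : List Triple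
      allTriples = cartesianProduct (signedWindow n) (cartesianProduct (signedWindow n) (signedWindow n))

      signedWindow-unique : Unique (signedWindow n)
      signedWindow-unique = cartesianProduct⁺ (((λ ()) ∷ []) ∷ [] ∷ []) (window-unique (2 ℕ.+ n ℕ.* 5))

      ∈-signedWindow : ∀ i → weight i ℕ.≤ n → i ∈ signedWindow n
      ∈-signedWindow (s , k) t≤n = ∈-cartesianProduct⁺ (∈-bools s) (triangle<⇒∈-window (2 ℕ.+ n ℕ.* 5) k
        (s≤s (ℕ.m≤n⇒m≤1+n (ℕ.≤-trans t≤n (ℕ.m≤m*n n 5)))))
        where
        ∈-bools : ∀ s → s ∈ true List.∷ false List.∷ List.[]
        ∈-bools true  = here refl
        ∈-bools false = there (here refl)

      ∈-signedTriples : ∀ t → totalWeight t ≡ n → t ∈ signedTriples n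
      ∈-signedTriples t@(i , j , k) e = ∈-filter⁺ (λ t → totalWeight t ℕ.≟ n) {xs = allTriples}
        (∈-cartesianProduct⁺ (∈-signedWindow i (ℕ.≤-trans (ℕ.m≤m+n (weight i) (weight j ℕ.+ weight k)) (ℕ.≤-reflexive e)))
          (∈-cartesianProduct⁺ (∈-signedWindow j (ℕ.≤-trans (ℕ.m≤m+n (weight j) (weight k)) rest))
                               (∈-signedWindow k (ℕ.≤-trans (ℕ.m≤n+m (weight k) (weight j)) rest)))) e
        where
        rest : weight j ℕ.+ weight k ℕ.≤ n
        rest = ℕ.≤-trans (ℕ.m≤n+m (weight j ℕ.+ weight k) (weight i)) (ℕ.≤-reflexive e)

      into : ∀ {t} → t ∈ signedTriples n → toℍ t ∈ pureSphere norm
      into {t} t∈ = ∈-pureSphere⁺ norm (toℍ t) refl (trans (N-toℍ t)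
        (trans (cong (λ m → + 8 * + m + + 3) (proj₂ (∈-filter⁻ (λ t → totalWeight t ℕ.≟ n) {xs = allTriples} t∈))) (sym +norm)))

      toℍ-injective : ∀ s t → toℍ s ≡ toℍ t → s ≡ t
      toℍ-injective (i , j , k) (i′ , j′ , k′) e = cong₂ _,_ (value-injective i i′ (cong im₁ e))
        (cong₂ _,_ (value-injective j j′ (cong im₂ e)) (value-injective k k′ (cong im₃ e)))

      SquareResidue : ℤ → ℕ → Set
      SquareResidue x ε = ∃ λ a → x * x ≡ + 4 * a + + ε

      -- Here `d` is the number of even coordinates. Squares are 0 or 1 modulo 4 and the total is 3,
      -- so 4 divides `d`; this excludes 1, 2 and 3 and leaves only odd coordinates.
      residue-sum : ∀ x y z ε δ ζ d → N (quat 0ℤ x y z) ≡ + 8 * + n + + 3 →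
                    SquareResidue x ε → SquareResidue y δ → SquareResidue z ζ →
                    ε ℕ.+ δ ℕ.+ ζ ℕ.+ d ≡ 3 → 4 ℕ.∣ d
      residue-sum x y z ε δ ζ d e (a , f) (b , g) (c , h) s = ∣⇒∣ᵤ (divides (a + b + c - + 2 * + n) (begin
        + d
          ≡⟨ isolate (+ ε + + δ + + ζ) (+ d) (+ 8 * + n) ⟩
        + 8 * + n + (+ ε + + δ + + ζ + + d) - (+ ε + + δ + + ζ) - + 8 * + n
          ≡⟨ cong (λ w → + 8 * + n + + w - (+ ε + + δ + + ζ) - + 8 * + n) s ⟩
        + 8 * + n + + 3 - (+ ε + + δ + + ζ) - + 8 * + n
          ≡⟨ cong (λ w → w - (+ ε + + δ + + ζ) - + 8 * + n) e ⟨
        0ℤ * 0ℤ + x * x + y * y + z * z - (+ ε + + δ + + ζ) - + 8 * + n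
          ≡⟨ cong (λ w → w - (+ ε + + δ + + ζ) - + 8 * + n) (cong₂ _+_ (cong₂ _+_ (cong (λ w → 0ℤ * 0ℤ + w) f) g) h) ⟩
        0ℤ * 0ℤ + (+ 4 * a + + ε) + (+ 4 * b + + δ) + (+ 4 * c + + ζ) - (+ ε + + δ + + ζ) - + 8 * + n
          ≡⟨ collect a b c (+ ε) (+ δ) (+ ζ) (+ n) ⟩
        (a + b + c - + 2 * + n) * + 4 ∎))
        where
        open ≡-Reasoning
        isolate : ∀ s d m → d ≡ m + (s + d) - s - m
        isolate = solve-∀
        collect : ∀ a b c ε δ ζ n → 0ℤ * 0ℤ + (+ 4 * a + ε) + (+ 4 * b + δ) + (+ 4 * c + ζ) - (ε + δ + ζ) - + 8 * n ≡
                  (a + b + c - + 2 * n) * + 4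
        collect = solve-∀

      even : ∀ x → (∃ λ a → x * x ≡ + 4 * a) → SquareResidue x 0
      even x (a , e) = a , trans e (sym (+-identityʳ (+ 4 * a)))

      odd : ∀ i → SquareResidue (value i) 1
      odd i = + 2 * + weight i , trans (value-square i) (cong (_+ 1ℤ) (*-assoc (+ 4) (+ 2) (+ weight i)))

      onto : ∀ x y z → N (quat 0ℤ x y z) ≡ + 8 * + n + + 3 → ∃ λ t → t ∈ signedTriples n × toℍ t ≡ quat 0ℤ x y z
      onto x y z e with even-or-value x | even-or-value y | even-or-value z
      ... | inj₂ (i , refl) | inj₂ (j , refl) | inj₂ (k , refl) =
        (i , j , k) , ∈-signedTriples (i , j , k) (+-injective (*-cancelˡ-≡ (+ 8) (+ totalWeight (i , j , k)) (+ n)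
          (+-cancelʳ-≡ (+ 3) (+ 8 * + totalWeight (i , j , k)) (+ 8 * + n) (trans (sym (N-toℍ (i , j , k))) e)))) , refl
      ... | inj₁ f    | inj₁ g    | inj₁ h    =
        contradiction (residue-sum x y z 0 0 0 3 e (even x f) (even y g) (even z h) refl) (from-no (4 ℕ.∣? 3))
      ... | inj₁ f    | inj₁ g    | inj₂ (k , refl) =
        contradiction (residue-sum x y (value k) 0 0 1 2 e (even x f) (even y g) (odd k) refl) (from-no (4 ℕ.∣? 2))
      ... | inj₁ f    | inj₂ (j , refl) | inj₁ h    =
        contradiction (residue-sum x (value j) z 0 1 0 2 e (even x f) (odd j) (even z h) refl) (from-no (4 ℕ.∣? 2))
      ... | inj₂ (i , refl) | inj₁ g    | inj₁ h    =
        contradiction (residue-sum (value i) y z 1 0 0 2 e (odd i) (even y g) (even z h) refl) (from-no (4 ℕ.∣? 2))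
      ... | inj₁ f    | inj₂ (j , refl) | inj₂ (k , refl) =
        contradiction (residue-sum x (value j) (value k) 0 1 1 1 e (even x f) (odd j) (odd k) refl) (from-no (4 ℕ.∣? 1))
      ... | inj₂ (i , refl) | inj₁ g    | inj₂ (k , refl) =
        contradiction (residue-sum (value i) y (value k) 1 0 1 1 e (odd i) (even y g) (odd k) refl) (from-no (4 ℕ.∣? 1))
      ... | inj₂ (i , refl) | inj₂ (j , refl) | inj₁ h    =
        contradiction (residue-sum (value i) (value j) z 1 1 0 1 e (odd i) (odd j) (even z h) refl) (from-no (4 ℕ.∣? 1))

      onto-pure : ∀ x → Pure x → N x ≡ + 8 * + n + + 3 → ∃ λ t → t ∈ signedTriples n × toℍ t ≡ x
      onto-pure (quat _ x y z) refl e = onto x y z e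

    -- All coordinates of such a vector are odd, and an odd square is 8T + 1 with T triangular.
    -- Removing 3 and dividing by 8 leaves a sum of three triangular numbers.
    signedTriples-length : length (signedTriples n) ≡ length (pureSphere (8 ℕ.* n ℕ.+ 3))
    signedTriples-length = length-bijection toℍ
      (filter⁺ (λ t → totalWeight t ℕ.≟ n) {allTriples}
        (cartesianProduct⁺ signedWindow-unique (cartesianProduct⁺ signedWindow-unique signedWindow-unique)))
      (pureSphere-unique norm)
      into
      (λ {s} {t} _ _ → toℍ-injective s t)
      (λ {x} x∈ → let pure , e = ∈-pureSphere⁻ norm x∈ in onto-pure x pure (trans e +norm))

  5∣pureSphere⇒5∣pod : ∀ n → 5 ℕ.∣ length (pureSphere (8 ℕ.* n ℕ.+ 3)) → 5 ℕ.∣ pod (n ℕ.* 5 ℕ.+ 2)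
  5∣pureSphere⇒5∣pod n 5∣ = subst (λ m → 5 ℕ.∣ pod (m ℕ.+ 2)) (5*-* n)
    (∣⇒∣ᵤ (subst (+ 5 ∣_) (×1≡ (+ 5) (pod (index n))) (≡ₘ0⇒∣ (+ 5) (pod-signedTriples n
      (subst (λ z → _≡ₘ_ (+ 5) z 0ℤ) (sym (×1≡ (+ 5) (length (signedTriples n))))
        (∣⇒≡ₘ0 (+ 5) (∣ᵤ⇒∣ (subst (5 ℕ.∣_) (sym (signedTriples-length n)) 5∣))))))))

open import Data.Nat.Base using (ℕ; _+_; _*_; _^_; _/_; _%_; _<_)
open import Data.Nat.Coprimality using (Coprime)
open import Data.Nat.Divisibility using (_∣_)
open import Data.Nat.Primality using (Prime)
open import Relation.Binary.PropositionalEquality using (_≡_)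
open Lines
open Sphere
open ThreeSquares
open import Data.Integer.Base as ℤ using (+_)
import Data.Integer.Divisibility.Signed as ℤ
import Data.Integer.Properties as ℤ
open import Data.Nat.DivMod using (m≡m%n+[m/n]*n; %-distribˡ-*; m%n<n; m*n/n≡m)
open import Data.Nat.Divisibility
  using (divides; ∣-refl; ∣m⇒∣m*n; ∣n⇒∣m*n; m∣m*n; *-cancelˡ-∣; _∣?_; _∣0; ∣m∣n⇒∣m+n)
open import Data.Nat.Tactic.RingSolver using (solve-∀)
open import Relation.Binary.PropositionalEquality
  using (_≢_; refl; sym; trans; cong; cong₂; subst; module ≡-Reasoning)

-- Arithmetic of the primes congruent to 4 modulo 5.

module _ {p : ℕ} (pr : Prime p) (p%5≡4 : p % 5 ≡ 4) where

  p≢1 : p ≢ 1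
  p≢1 refl = contradiction p%5≡4 λ ()

  p≢2 : p ≢ 2
  p≢2 refl = contradiction p%5≡4 λ ()

  2∤p : ¬ 2 ∣ p
  2∤p 2∣p with prime⇒irreducible pr 2∣p
  ... | inj₁ ()
  ... | inj₂ 2≡p = p≢2 (sym 2≡p)

  p∤2 : ¬ + p ℤ.∣ + 2
  p∤2 h with prime⇒irreducible (toWitness {a? = prime? 2} _) (ℤ.∣⇒∣ᵤ h)
  ... | inj₁ p≡1 = p≢1 p≡1
  ... | inj₂ p≡2 = p≢2 p≡2

  square%8 : p * p % 8 ≡ 1
  square%8 = trans (%-distribˡ-* p p 8) (go (p % 8) (m%n<n p 8) (m≡m%n+[m/n]*n p 8))
    where
    q : ℕ
    q = p / 8
    even : ∀ {r} → 2 ∣ r → p ≡ r + q * 8 → 2 ∣ p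
    even 2∣r e = subst (2 ∣_) (sym e) (∣m∣n⇒∣m+n 2∣r (∣n⇒∣m*n q (divides 4 refl)))
    go : ∀ r → r < 8 → p ≡ r + q * 8 → r * r % 8 ≡ 1
    go 1 _ _ = refl
    go 3 _ _ = refl
    go 5 _ _ = refl
    go 7 _ _ = refl
    go 0 _ e = contradiction (even (divides 0 refl) e) 2∤p
    go 2 _ e = contradiction (even (divides 1 refl) e) 2∤p
    go 4 _ e = contradiction (even (divides 2 refl) e) 2∤p
    go 6 _ e = contradiction (even (divides 3 refl) e) 2∤p
    go (suc (suc (suc (suc (suc (suc (suc (suc _)))))))) (s≤s (s≤s (s≤s (s≤s (s≤s (s≤s (s≤s (s≤s ())))))))) _

  5∣sphere : 5 ∣ length (sphere p)
  5∣sphere with sphere-length pr p∤2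
  ... | inj₁ e = subst (5 ∣_) (sym e) (5 ∣0)
  ... | inj₂ e = subst (5 ∣_) (sym e) (∣m⇒∣m*n 8 (divides (suc (p / 5))
    (cong suc (trans (m≡m%n+[m/n]*n p 5) (cong (_+ p / 5 * 5) p%5≡4)))))

  module _ {N : ℕ} (coprime : Coprime N p) (pN%8≡3 : (p * N) % 8 ≡ 3) where

    -- Chosen so that 8n + 3 = p² · pN, where p² ≡ 1 modulo 8 preserves the residue 3 of pN. Then
    -- 5p³N + 1 = 5(8n + 3) + 1 = 8(5n + 2).
    n : ℕ
    n = p * p * (p * N) / 8

    p²pN≡8n+3 : p * p * (p * N) ≡ 8 * n + 3
    p²pN≡8n+3 = begin
      p * p * (p * N)                       ≡⟨ m≡m%n+[m/n]*n (p * p * (p * N)) 8 ⟩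
      p * p * (p * N) % 8 + n * 8           ≡⟨ cong (_+ n * 8) residue ⟩
      3 + n * 8                             ≡⟨ commute n ⟩
      8 * n + 3                             ∎
      where
      open ≡-Reasoning
      residue : p * p * (p * N) % 8 ≡ 3
      residue = trans (%-distribˡ-* (p * p) (p * N) 8) (cong₂ (λ x y → x * y % 8) square%8 pN%8≡3)
      commute : ∀ n → 3 + n * 8 ≡ 8 * n + 3
      commute = solve-∀

    index≡ : (5 * p ^ 3 * N + 1) / 8 ≡ n * 5 + 2
    index≡ = trans (cong (_/ 8) (begin
      5 * p ^ 3 * N + 1                     ≡⟨ expand p N ⟩
      5 * (p * p * (p * N)) + 1             ≡⟨ cong (λ m → 5 * m + 1) p²pN≡8n+3 ⟩
      5 * (8 * n + 3) + 1                   ≡⟨ collect n ⟩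
      (n * 5 + 2) * 8                       ∎)) (m*n/n≡m (n * 5 + 2) 8)
      where
      open ≡-Reasoning
      expand : ∀ p N → 5 * (p * (p * (p * 1))) * N + 1 ≡ 5 * (p * p * (p * N)) + 1
      expand = solve-∀
      collect : ∀ n → 5 * (8 * n + 3) + 1 ≡ (n * 5 + 2) * 8
      collect = solve-∀

    p²∤pN : ¬ + p ℤ.* + p ℤ.∣ + (p * N)
    p²∤pN h = p≢1 (coprime (*-cancelˡ-∣ p {{prime⇒nonZero pr}} (subst (_∣ p * N) (cong ℤ.∣_∣ (sym (ℤ.pos-* p p))) (ℤ.∣⇒∣ᵤ h)) , ∣-refl))

    -- In 8 r₃(p² · pN) = r₄(p) r₃(pN) the right side is divisible by 5, and 5 is prime to 8.
    5∣pureSphere : 5 ∣ length (pureSphere (8 * n + 3))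
    5∣pureSphere = [ (λ d → d) , (λ d → contradiction d (from-no (5 ∣? 8))) ]′
      (euclidsLemma _ 8 (toWitness {a? = prime? 5} _) (subst (λ m → 5 ∣ length (pureSphere m) * 8) p²pN≡8n+3
        (subst (5 ∣_) (sym (pureSphere-hecke pr p∤2 (p * N) (ℤ.∣ᵤ⇒∣ (m∣m*n N)) p²∤pN)) (∣m⇒∣m*n (length (pureSphere (p * N))) 5∣sphere))))

theorem5 : ∀ (p N : ℕ) → Prime p → p % 5 ≡ 4 → 0 < N → Coprime N p →
    (p * N) % 8 ≡ 3 → 5 ∣ pod ((5 * p ^ 3 * N + 1) / 8)
theorem5 p N pr p%5≡4 _ coprime pN%8≡3 =
  subst (λ m → 5 ∣ pod m) (sym (index≡ pr p%5≡4 coprime pN%8≡3))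
    (5∣pureSphere⇒5∣pod (n pr p%5≡4 coprime pN%8≡3) (5∣pureSphere pr p%5≡4 coprime pN%8≡3))
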